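{- Let $\mu$ be a strict partition of $m$ and let $\rho$ be an odd partition with no part equal to $1$. Then for every integer $n\ge0$, $$\mathbb{E}_{\mu,n}[\mathfrak{p}_\rho]=\mathfrak{p}_\rho(\mu).$$ In particular (case $\rho=\emptyset$), $\sum_{\lambda\in\mathcal{SP}_{n+m}}\frac{m!}{(n+m)!}2^{n-\ell(\lambda)+\ell(\mu)}\frac{g^\lambda}{g^\mu}g^{\lambda/\mu}=1$.
   Context: Partitions are finite weakly decreasing sequences of positive integers; $\ell$ = length, $|\cdot|$ = size; strict = distinct parts, odd = all parts odd; $\mathcal{SP}_k,\mathcal{OP}_k$ the strict/odd partitions of $k$. Shifted diagram $S(\lambda)=\{(i,j):1\le i\le\ell(\lambda),\ i\le j\le\lambda_i+i-1\}$. For strict $\lambda,\mu$ with $S(\lambda)\supseteq S(\mu)$, $g^{\lambda/\mu}$ is the number of chains $\mu=\lambda^{(0)},\dots,\lambda^{(k)}=\lambda$ ($k=|\lambda|-|\mu|$) of strict partitions, each diagram obtained from the previous by adding one box; $g^{\lambda/\mu}=0$ otherwise; $g^\lambda=g^{\lambda/\emptyset}$. For a function $\varphi$ on strict partitions, $\mathbb{E}_{\mu,n}[\varphi]=\sum_{\lambda\in\mathcal{SP}_{n+m}}\frac{m!}{(n+m)!}2^{n-\ell(\lambda)+\ell(\mu)}\frac{g^\lambda}{g^\mu}g^{\lambda/\mu}\varphi(\lambda)$. $p_r=\sum_ix_i^r$; $\Gamma$ = $\mathbb{Q}$-algebra generated by $p_1,p_3,\dots$; for $f\in\Gamma$, $f(\lambda)=f(\lambda_1,\dots,\lambda_{\ell(\lambda)},0,\dots)$.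 For $\rho\in\mathcal{OP}$: $p_\rho=\prod_ip_{\rho_i}$, $z_\rho=\prod_rr^{m_r(\rho)}m_r(\rho)!$; scalar product $\langle p_\rho,p_\sigma\rangle=2^{ -\ell(\rho)}z_\rho\delta_{\rho\sigma}$. For strict $\lambda$ of length $l$, $P_\lambda(x_1,\dots,x_N)=\frac1{(N-l)!}\sum_{\omega\in S_N}\omega\big(x_1^{\lambda_1}\cdots x_l^{\lambda_l}\prod_{1\le i\le l,\,i<j\le N}\frac{x_i+x_j}{x_i-x_j}\big)$ ($N\ge l$; zero if $N<l$), $Q_\lambda=2^{\ell(\lambda)}P_\lambda$, and $P^*_\lambda$ is defined by the same formula with $x_i^{\lambda_i}$ replaced by $x_i^{\downarrow\lambda_i}=x_i(x_i-1)\cdots(x_i-\lambda_i+1)$. $X^\lambda_\rho=\langle p_\rho,Q_\lambda\rangle$ for $|\lambda|=|\rho|$, and $\mathfrak{p}_\rho=\sum_{\lambda\in\mathcal{SP}_{|\rho|}}X^\lambda_\rho P^*_\lambda\in\Gamma$; $\mathfrak p_\emptyset=1$. -}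

module Defs where

open import Data.Bool using (Bool; true; false; _∧_; if_then_else_; T)
open import Data.Nat as ℕ using (ℕ; zero; suc; _∸_; _≤ᵇ_; _<ᵇ_; _≡ᵇ_)
open import Data.Nat using (_!)
open import Data.Integer using (+_)
open import Data.List using (List; []; _∷_; map; concatMap; length; applyUpTo)
open import Data.Nat.ListAction using (sum)
open import Data.Rational as Q using (ℚ; 0ℚ; 1ℚ; _+_; _*_; _-_)
open import Data.Rational.Properties using (_≟_)
open import Relation.Nullary using (yes; no)
open import Relation.Binary.PropositionalEquality using (_≡_)
open import Data.List.Relation.Unary.Unique.Propositional using (Unique)

strictB : List ℕ → Bool
strictB []            = true
strictB (a ∷ [])      = 1 ≤ᵇ a
strictB (a ∷ b ∷ r)   = (b <ᵇ a) ∧ strictB (b ∷ r)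

IsStrict : List ℕ → Set
IsStrict λ′ = T (strictB λ′)

oddB : ℕ → Bool
oddB zero          = false
oddB (suc zero)    = true
oddB (suc (suc n)) = oddB n

oddPartB : List ℕ → Bool
oddPartB []          = true
oddPartB (a ∷ [])    = oddB a
oddPartB (a ∷ b ∷ r) = (b ≤ᵇ a) ∧ oddB a ∧ oddPartB (b ∷ r)

IsOddPartition : List ℕ → Set
IsOddPartition ρ = T (oddPartB ρ)

-- Enumerations SP_k, OP_k (fuel f ≥ k; bound b = maximal allowed part)

spF : ℕ → ℕ → ℕ → List (List ℕ)
spF zero    zero    b = [] ∷ []
spF zero    (suc k) b = []
spF (suc f) zero    b = [] ∷ []
spF (suc f) (suc k) b =
  concatMap (λ p → if p ≤ᵇ suc k then map (p ∷_) (spF f (suc k ∸ p) (p ∸ 1)) else [])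
            (applyUpTo suc b)

SP : ℕ → List (List ℕ)
SP k = spF k k k

opF : ℕ → ℕ → ℕ → List (List ℕ)
opF zero    zero    b = [] ∷ []
opF zero    (suc k) b = []
opF (suc f) zero    b = [] ∷ []
opF (suc f) (suc k) b =
  concatMap (λ p → if (p ≤ᵇ suc k) ∧ oddB p then map (p ∷_) (opF f (suc k ∸ p) p) else [])
            (applyUpTo suc b)

OP : ℕ → List (List ℕ)
OP k = opF k k k

filterB : {A : Set} → (A → Bool) → List A → List A
filterB p []       = []
filterB p (x ∷ xs) = if p x then x ∷ filterB p xs else filterB p xs

eqListB : List ℕ → List ℕ → Bool
eqListB []       []       = true
eqListB (a ∷ as) (b ∷ bs) = (a ≡ᵇ b) ∧ eqListB as bs
eqListB _        _        = false

decAt : List ℕ → List (List ℕ)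
decAt []       = []
decAt (a ∷ as) = ((a ∸ 1) ∷ as) ∷ map (a ∷_) (decAt as)

dropZeros : List ℕ → List ℕ
dropZeros = filterB (λ a → 1 ≤ᵇ a)

-- strict partitions whose shifted diagram is that of λ minus one box
down : List ℕ → List (List ℕ)
down λ′ = filterB strictB (map dropZeros (decAt λ′))

chains : ℕ → List ℕ → List ℕ → ℕ
chains zero    λ′ μ = if eqListB λ′ μ then 1 else 0
chains (suc k) λ′ μ = sum (map (λ ν → chains k ν μ) (down λ′))

gskew : List ℕ → List ℕ → ℕ
gskew λ′ μ = if sum μ ≤ᵇ sum λ′ then chains (sum λ′ ∸ sum μ) λ′ μ else 0

g : List ℕ → ℕ
g λ′ = gskew λ′ []

ℕ→ℚ : ℕ → ℚ
ℕ→ℚ n = + n Q./ 1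

-- totalised division (x / 0 := 0); only used with nonzero denominators
_÷′_ : ℚ → ℚ → ℚ
p ÷′ q with q ≟ 0ℚ
... | yes _ = 0ℚ
... | no q≢0 = Q._÷_ p q {{Q.≢-nonZero q≢0}}

infixl 7 _÷′_

_^′_ : ℚ → ℕ → ℚ
x ^′ zero  = 1ℚ
x ^′ suc k = x * (x ^′ k)

falling : ℚ → ℕ → ℚ
falling x zero    = 1ℚ
falling x (suc k) = falling x k * (x - ℕ→ℚ k)

sumℚ : List ℚ → ℚ
sumℚ []       = 0ℚ
sumℚ (x ∷ xs) = x + sumℚ xs

prodℚ : List ℚ → ℚ
prodℚ []       = 1ℚ
prodℚ (x ∷ xs) = x * prodℚ xs

-- Symmetrisation over S_N, evaluated at a point x = (x_1,…,x_N) ∈ ℚ^N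
-- (given as a list).  perms x lists x ∘ ω for all ω ∈ S_N (N! lists).

insertAll : {A : Set} → A → List A → List (List A)
insertAll a []       = (a ∷ []) ∷ []
insertAll a (b ∷ bs) = (a ∷ b ∷ bs) ∷ map (b ∷_) (insertAll a bs)

perms : {A : Set} → List A → List (List A)
perms []       = [] ∷ []
perms (a ∷ as) = concatMap (insertAll a) (perms as)

-- x_1^{e(λ_1)}⋯x_l^{e(λ_l)} ∏_{1≤i≤l, i<j≤N} (x_i+x_j)/(x_i-x_j), evaluated at y
summand : (ℚ → ℕ → ℚ) → List ℕ → List ℚ → ℚ
summand e []       ys       = 1ℚ
summand e (a ∷ as) []       = 0ℚ
summand e (a ∷ as) (y ∷ ys) =
  e y a * prodℚ (map (λ z → (y + z) ÷′ (y - z)) ys) * summand e as ys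

symmetrise : (ℚ → ℕ → ℚ) → List ℕ → List ℚ → ℚ
symmetrise e λ′ x with length λ′ ≤ᵇ length x
... | false = 0ℚ
... | true  = sumℚ (map (summand e λ′) (perms x)) ÷′ ℕ→ℚ ((length x ∸ length λ′) !)

Pfun : List ℕ → List ℚ → ℚ
Pfun = symmetrise _^′_

Qfun : List ℕ → List ℚ → ℚ
Qfun λ′ x = (ℕ→ℚ 2 ^′ length λ′) * Pfun λ′ x

Pstar : List ℕ → List ℚ → ℚ
Pstar = symmetrise falling

pow : ℕ → List ℚ → ℚ
pow r x = sumℚ (map (λ xi → xi ^′ r) x)

pprod : List ℕ → List ℚ → ℚ
pprod ρ x = prodℚ (map (λ r → pow r x) ρ)

mult : ℕ → List ℕ → ℕ
mult r ρ = length (filterB (λ a → a ≡ᵇ r) ρ)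

zρ : List ℕ → ℕ
zρ ρ = prod (applyUpTo suc (sum ρ))
  where
  prod : List ℕ → ℕ
  prod []       = 1
  prod (r ∷ rs) = (r ℕ.^ mult r ρ) ℕ.* (mult r ρ !) ℕ.* prod rs

-- X^λ_σ = ⟨p_σ, Q_λ⟩.  With ⟨p_ρ,p_σ⟩ = 2^{-ℓ(ρ)} z_ρ δ, this says exactly
-- Q_λ = Σ_{σ ∈ 𝒪𝒫_{|λ|}} 2^{ℓ(σ)} z_σ^{-1} X^λ_σ p_σ  in Γ, i.e. as
-- polynomial identities in N variables for every N; we require it at all
-- points with pairwise distinct coordinates (where the defining rational
-- expression of Q_λ can be evaluated directly).
IsSpinCharacterTable : (List ℕ → List ℕ → ℚ) → Set
IsSpinCharacterTable X =
  ∀ λ′ → IsStrict λ′ → (x : List ℚ) → Unique x →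
  Qfun λ′ x ≡ sumℚ (map (λ σ → (ℕ→ℚ 2 ^′ length σ) * X λ′ σ ÷′ ℕ→ℚ (zρ σ) * pprod σ x)
                        (OP (sum λ′)))

frakp : (List ℕ → List ℕ → ℚ) → List ℕ → List ℕ → ℚ
frakp X ρ μ = sumℚ (map (λ λ′ → X λ′ ρ * Pstar λ′ (map ℕ→ℚ μ)) (SP (sum ρ)))

weight : List ℕ → ℕ → List ℕ → ℚ
weight μ n λ′ =
  ℕ→ℚ (sum μ !) ÷′ ℕ→ℚ ((n ℕ.+ sum μ) !)
  * (ℕ→ℚ 2 ^′ (n ℕ.+ length μ) ÷′ (ℕ→ℚ 2 ^′ length λ′))
  * (ℕ→ℚ (g λ′) ÷′ ℕ→ℚ (g μ))
  * ℕ→ℚ (gskew λ′ μ)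

𝔼 : List ℕ → ℕ → (List ℕ → ℚ) → ℚ
𝔼 μ n φ = sumℚ (map (λ λ′ → weight μ n λ′ * φ λ′) (SP (n ℕ.+ sum μ)))

{-# OPTIONS --safe #-}

-- Let U and D be the operators on functions of strict partitions that sum over the ways to add a
-- box (with weight 2 inside a row, 1 for a new row) and to remove a box; then U D - D U = 1.
-- The Pieri rule (p₁(x) - |ν|) P*_ν(x) = Σ P*_{ν + box}(x), together with the vanishing of
-- P*_ν(λ) when |ν| ≥ |λ| and ν ≠ λ, gives P*_ν(λ) = |λ|! g^{λ/ν} / ((|λ| - |ν|)! g^λ).  Hence
-- 𝔭_ρ(λ) g^λ is, up to factorials, D^{|λ| - |ρ|} χ at λ for χ = (ν ↦ X^ν_ρ), and the expectation
-- applies U^n to it.  The Pieri rule p₁ Q_μ = Σ 2^{ℓ(μ) - ℓ(ν)} Q_ν expresses U χ through the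
-- coefficient of p_ρ in multiples of p₁, so U χ = 0 when 1 is not a part of ρ, and then
-- U^n D^{n+i} χ = ((n+i)! / i!) D^i χ.

module Submission where

open import Defs
open import Data.Bool using (Bool; true; false; _∧_; if_then_else_; T)
open import Data.Empty using (⊥-elim)
import Data.Integer as ℤ
import Data.Integer.Properties as ℤₚ
open import Data.List using (List; []; _∷_; _++_; map; concatMap; length; applyUpTo)
import Data.List.Properties as Listₚ
import Data.List.Relation.Binary.Pointwise as Pointwise
open import Data.List.Relation.Binary.Permutation.Propositional as Perm using (_↭_; ↭-refl; ↭-sym; ↭-trans; ↭⇒↭ₛ)
import Data.List.Relation.Binary.Permutation.Propositional.Properties as Permₚ
import Data.List.Relation.Binary.Permutation.Setoid.Properties as PermSetoidₚ
open import Data.List.Relation.Unary.All as All using (All; []; _∷_)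
import Data.List.Relation.Unary.All.Properties as Allₚ
open import Data.List.Relation.Unary.AllPairs using (AllPairs; []; _∷_)
import Data.List.Relation.Unary.AllPairs.Properties as AllPairsₚ
open import Data.List.Relation.Unary.Linked using (Linked; []; [-]; _∷_)
import Data.List.Relation.Unary.Sorted.TotalOrder.Properties as Sortedₚ
open import Data.List.Relation.Unary.Unique.Propositional using (Unique)
open import Data.Maybe using (Maybe; just; nothing)
open import Data.Nat as ℕ using (ℕ; zero; suc; _!; _∸_; _≤ᵇ_; _<ᵇ_; _≡ᵇ_; z≤n; s≤s)
open import Data.Nat.ListAction using (sum)
open import Data.Nat.ListAction.Properties using (sum-++; sum-↭)
import Data.Nat.Properties as ℕₚ
open import Data.Product using (_×_; _,_; proj₁; proj₂; ∃-syntax)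
open import Data.Rational as ℚ using (ℚ; 0ℚ; 1ℚ; _+_; _*_; _-_; -_)
import Data.Rational.Properties as ℚₚ
open import Data.Rational.Unnormalised as ℚᵘ using (mkℚᵘ; *≡*)
import Data.Rational.Unnormalised.Properties as ℚᵘₚ
open import Data.Sum using (inj₁; inj₂; [_,_]′)
open import Data.Unit using (tt)
open import Function using (_∘_; id)
import Relation.Binary.Construct.Flip.EqAndOrd as Flip
open import Relation.Binary.PropositionalEquality
open import Relation.Nullary using (¬_; Dec; yes; no)
open import Relation.Nullary.Decidable.Core using (dec⇒maybe)
open import Tactic.RingSolver using (solve-∀)
open import Tactic.RingSolver.Core.AlmostCommutativeRing using (AlmostCommutativeRing; fromCommutativeRing)

-- The factor 2^(n - ℓ(λ) + ℓ(μ)) of the expectation reconciles two versions of U. The adjoint of D,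
-- which sums over chains, adds boxes with weight 1 everywhere; the commutation relation needs
-- weight 2 inside rows; conjugation by 2^ℓ passes from one to the other.
--
-- The main obstacle is "the coefficient of p_ρ". The table `X` is known only through identities at
-- points with pairwise distinct coordinates, so the coefficient has to be read off by a functional
-- built from such evaluations. Thue-Morse signed point sets of order r kill p_s for odd s < r and
-- make p_r positive; repeated differences along disjoint sets of orders ρ₁, ρ₂, ... kill every p_σ
-- with |σ| ≤ |ρ|, σ odd, except the rearrangements of ρ. A product p₁ p_τ is never one of these
-- when ρ has no part 1.
--
-- Both Pieri rules come from one computation in which a box is added to every row, legal or not; an
-- illegal addition creates two equal rows, and there the symmetrised sum vanishes by antisymmetry.
--
-- If |μ| < |ρ|, both sides of the theorem are 0: either every λ in the sum is smaller than ρ, or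
-- more additions than removals act on χ.

ℚ-ring : AlmostCommutativeRing _ _
ℚ-ring = fromCommutativeRing ℚₚ.+-*-commutativeRing (λ x → dec⇒maybe (0ℚ ℚₚ.≟ x))

-- Rational arithmetic with totalised division

ℕ→ℚ-+ : ∀ m n → ℕ→ℚ (m ℕ.+ n) ≡ ℕ→ℚ m + ℕ→ℚ n
ℕ→ℚ-+ m n = ℚₚ.toℚᵘ-injective (begin
  ℚ.toℚᵘ (ℕ→ℚ (m ℕ.+ n))                  ≈⟨ ℚₚ.toℚᵘ-fromℚᵘ (mkℚᵘ (ℤ.+ (m ℕ.+ n)) 0) ⟩
  mkℚᵘ (ℤ.+ (m ℕ.+ n)) 0                     ≈⟨ *≡* (cong (ℤ._* ℤ.+ 1) (sym (cong₂ ℤ._+_ (ℤₚ.*-identityʳ (ℤ.+ m)) (ℤₚ.*-identityʳ (ℤ.+ n))))) ⟩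
  mkℚᵘ (ℤ.+ m) 0 ℚᵘ.+ mkℚᵘ (ℤ.+ n) 0          ≈⟨ ℚᵘₚ.+-cong (ℚₚ.toℚᵘ-fromℚᵘ (mkℚᵘ (ℤ.+ m) 0)) (ℚₚ.toℚᵘ-fromℚᵘ (mkℚᵘ (ℤ.+ n) 0)) ⟨
  ℚ.toℚᵘ (ℕ→ℚ m) ℚᵘ.+ ℚ.toℚᵘ (ℕ→ℚ n)      ≈⟨ ℚₚ.toℚᵘ-homo-+ (ℕ→ℚ m) (ℕ→ℚ n) ⟨
  ℚ.toℚᵘ (ℕ→ℚ m + ℕ→ℚ n)                  ∎)
  where open ℚᵘₚ.≃-Reasoning

ℕ→ℚ-suc : ∀ n → ℕ→ℚ (suc n) ≡ 1ℚ + ℕ→ℚ n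
ℕ→ℚ-suc = ℕ→ℚ-+ 1

ℕ→ℚ-* : ∀ m n → ℕ→ℚ (m ℕ.* n) ≡ ℕ→ℚ m * ℕ→ℚ n
ℕ→ℚ-* zero    n = sym (ℚₚ.*-zeroˡ (ℕ→ℚ n))
ℕ→ℚ-* (suc m) n = begin
  ℕ→ℚ (n ℕ.+ m ℕ.* n)            ≡⟨ ℕ→ℚ-+ n (m ℕ.* n) ⟩
  ℕ→ℚ n + ℕ→ℚ (m ℕ.* n)          ≡⟨ cong (ℕ→ℚ n +_) (ℕ→ℚ-* m n) ⟩
  ℕ→ℚ n + ℕ→ℚ m * ℕ→ℚ n          ≡⟨ lemma (ℕ→ℚ m) (ℕ→ℚ n) ⟩
  (1ℚ + ℕ→ℚ m) * ℕ→ℚ n           ≡⟨ cong (_* ℕ→ℚ n) (ℕ→ℚ-suc m) ⟨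
  ℕ→ℚ (suc m) * ℕ→ℚ n            ∎
  where
  open ≡-Reasoning
  lemma : ∀ a b → b + a * b ≡ (1ℚ + a) * b
  lemma = solve-∀ ℚ-ring

ℕ→ℚ-injective : ∀ {m n} → ℕ→ℚ m ≡ ℕ→ℚ n → m ≡ n
ℕ→ℚ-injective {m} {n} eq with ℚₚ.fromℚᵘ-injective {mkℚᵘ (ℤ.+ m) 0} {mkℚᵘ (ℤ.+ n) 0} eq
... | *≡* p = ℤₚ.+-injective (trans (sym (ℤₚ.*-identityʳ (ℤ.+ m))) (trans p (ℤₚ.*-identityʳ (ℤ.+ n))))

ℕ→ℚ≢0 : ∀ n .{{_ : ℕ.NonZero n}} → ℕ→ℚ n ≢ 0ℚ
ℕ→ℚ≢0 (suc n) eq with () ← ℕ→ℚ-injective {suc n} {0} eq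

!≢0 : ∀ n → ℕ→ℚ (n !) ≢ 0ℚ
!≢0 n = ℕ→ℚ≢0 (n !) {{n ℕₚ.!≢0}}

2ℚ : ℚ
2ℚ = ℕ→ℚ 2

*-left-comm : ∀ a b c → a * (b * c) ≡ b * (a * c)
*-left-comm = solve-∀ ℚ-ring

+-left-comm : ∀ a b c → a + (b + c) ≡ b + (a + c)
+-left-comm = solve-∀ ℚ-ring

+-interchange : ∀ a b c d → a + b + (c + d) ≡ a + c + (b + d)
+-interchange = solve-∀ ℚ-ring

inv : ℚ → ℚ
inv q = 1ℚ ÷′ q

÷′-inv : ∀ p q → p ÷′ q ≡ p * inv q
÷′-inv p q with q ℚₚ.≟ 0ℚ
... | yes _  = sym (ℚₚ.*-zeroʳ p)
... | no q≢0 = cong (p *_) (sym (ℚₚ.*-identityˡ _))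

*-inv : ∀ {q} → q ≢ 0ℚ → q * inv q ≡ 1ℚ
*-inv {q} q≢0 with q ℚₚ.≟ 0ℚ
... | yes q≡0 = ⊥-elim (q≢0 q≡0)
... | no q≢0′ = trans (cong (q *_) (ℚₚ.*-identityˡ _)) (ℚₚ.*-inverseʳ q {{ℚ.≢-nonZero q≢0′}})

*-cancelˡ : ∀ {q} → q ≢ 0ℚ → ∀ {x y} → q * x ≡ q * y → x ≡ y
*-cancelˡ {q} q≢0 {x} {y} eq = begin
  x                 ≡⟨ insert x ⟩
  inv q * (q * x)   ≡⟨ cong (inv q *_) eq ⟩
  inv q * (q * y)   ≡⟨ insert y ⟨
  y                 ∎
  where
  open ≡-Reasoning
  rearrange : ∀ i q x → (q * i) * x ≡ i * (q * x)
  rearrange = solve-∀ ℚ-ring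
  insert : ∀ x → x ≡ inv q * (q * x)
  insert x = trans (sym (trans (cong (_* x) (*-inv q≢0)) (ℚₚ.*-identityˡ x))) (rearrange (inv q) q x)

*≢0 : ∀ {p q} → p ≢ 0ℚ → q ≢ 0ℚ → p * q ≢ 0ℚ
*≢0 {p} {q} p≢0 q≢0 eq = q≢0 (*-cancelˡ p≢0 (trans eq (sym (ℚₚ.*-zeroʳ p))))

inv≢0 : ∀ {q} → q ≢ 0ℚ → inv q ≢ 0ℚ
inv≢0 {q} q≢0 eq = ℚₚ.1≢0 (trans (sym (*-inv q≢0)) (trans (cong (q *_) eq) (ℚₚ.*-zeroʳ q)))

-≢0 : ∀ {x y} → x ≢ y → x - y ≢ 0ℚ
-≢0 {x} {y} x≢y eq = x≢y (trans (lemma x y) (trans (cong (_+ y) eq) (ℚₚ.+-identityˡ y)))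
  where
  lemma : ∀ x y → x ≡ (x - y) + y
  lemma = solve-∀ ℚ-ring

inv-neg : ∀ q → inv (- q) ≡ - inv q
inv-neg q = go (q ℚₚ.≟ 0ℚ)
  where
  lemma : ∀ q i → q * i ≡ - q * - i
  lemma = solve-∀ ℚ-ring
  go : Dec (q ≡ 0ℚ) → inv (- q) ≡ - inv q
  -- Totalised division gives 1 / 0 = 0, so zero is no exception.
  go (yes refl) = refl
  go (no q≢0)   = *-cancelˡ -q≢0 (trans (*-inv -q≢0) (trans (sym (*-inv q≢0)) (lemma q (inv q))))
    where
    -q≢0 : - q ≢ 0ℚ
    -q≢0 eq = q≢0 (ℚₚ.neg-injective eq)

-- Finite sums of rationals

Σℚ : {A : Set} → List A → (A → ℚ) → ℚ
Σℚ xs f = sumℚ (map f xs)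

module _ {A : Set} where

  Σ-cong-All : ∀ {f g : A → ℚ} {xs} → All (λ x → f x ≡ g x) xs → Σℚ xs f ≡ Σℚ xs g
  Σ-cong-All []       = refl
  Σ-cong-All (e ∷ es) = cong₂ _+_ e (Σ-cong-All es)

  Σ-cong : ∀ {f g : A → ℚ} → (∀ x → f x ≡ g x) → ∀ xs → Σℚ xs f ≡ Σℚ xs g
  Σ-cong e xs = Σ-cong-All (All.universal e xs)

  Σ-zero : ∀ (xs : List A) → Σℚ xs (λ _ → 0ℚ) ≡ 0ℚ
  Σ-zero []       = refl
  Σ-zero (x ∷ xs) = trans (ℚₚ.+-identityˡ _) (Σ-zero xs)

  Σ-zero-All : ∀ {f : A → ℚ} {xs} → All (λ x → f x ≡ 0ℚ) xs → Σℚ xs f ≡ 0ℚ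
  Σ-zero-All {xs = xs} all = trans (Σ-cong-All all) (Σ-zero xs)

  Σ-+ : ∀ (f g : A → ℚ) xs → Σℚ xs (λ x → f x + g x) ≡ Σℚ xs f + Σℚ xs g
  Σ-+ f g []       = refl
  Σ-+ f g (x ∷ xs) = trans (cong (f x + g x +_) (Σ-+ f g xs)) (+-interchange (f x) (g x) (Σℚ xs f) (Σℚ xs g))

  Σ-*ˡ : ∀ c (f : A → ℚ) xs → Σℚ xs (λ x → c * f x) ≡ c * Σℚ xs f
  Σ-*ˡ c f []       = sym (ℚₚ.*-zeroʳ c)
  Σ-*ˡ c f (x ∷ xs) = trans (cong (c * f x +_) (Σ-*ˡ c f xs)) (sym (ℚₚ.*-distribˡ-+ c (f x) (Σℚ xs f)))

  Σ-*ʳ : ∀ c (f : A → ℚ) xs → Σℚ xs (λ x → f x * c) ≡ Σℚ xs f * c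
  Σ-*ʳ c f xs = trans (Σ-cong (λ x → ℚₚ.*-comm (f x) c) xs) (trans (Σ-*ˡ c f xs) (ℚₚ.*-comm c _))

  Σ-++ : ∀ (f : A → ℚ) xs ys → Σℚ (xs ++ ys) f ≡ Σℚ xs f + Σℚ ys f
  Σ-++ f []       ys = sym (ℚₚ.+-identityˡ _)
  Σ-++ f (x ∷ xs) ys = trans (cong (f x +_) (Σ-++ f xs ys)) (sym (ℚₚ.+-assoc (f x) _ _))

  Σ-map : ∀ {B : Set} (f : A → ℚ) (h : B → A) xs → Σℚ (map h xs) f ≡ Σℚ xs (f ∘ h)
  Σ-map f h xs = cong sumℚ (sym (Listₚ.map-∘ xs))

  Σ-concatMap : ∀ {B : Set} (f : A → ℚ) (h : B → List A) xs → Σℚ (concatMap h xs) f ≡ Σℚ xs (λ x → Σℚ (h x) f)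
  Σ-concatMap f h []       = refl
  Σ-concatMap f h (x ∷ xs) = trans (Σ-++ f (h x) (concatMap h xs)) (cong (Σℚ (h x) f +_) (Σ-concatMap f h xs))

Σ-swap : ∀ {A B : Set} (f : A → B → ℚ) xs ys → Σℚ xs (λ x → Σℚ ys (f x)) ≡ Σℚ ys (λ y → Σℚ xs (λ x → f x y))
Σ-swap f []       ys = sym (Σ-zero ys)
Σ-swap f (x ∷ xs) ys = trans (cong (Σℚ ys (f x) +_) (Σ-swap f xs ys)) (sym (Σ-+ (f x) (λ y → Σℚ xs (λ x → f x y)) ys))

-- Symmetrised sums

-- Sum over the choice of one entry, the others keeping their order. It peels one variable at a time
-- off a sum over the symmetric group.
Σsel : {A : Set} → List A → (A → List A → ℚ) → ℚ
Σsel []       f = 0ℚ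
Σsel (x ∷ xs) f = f x xs + Σsel xs (λ y r → f y (x ∷ r))

Σsel-cong : ∀ {A : Set} {f g : A → List A → ℚ} x → (∀ y r → y ∷ r ↭ x → f y r ≡ g y r) → Σsel x f ≡ Σsel x g
Σsel-cong []       e = refl
Σsel-cong (x ∷ xs) e = cong₂ _+_ (e x xs ↭-refl)
  (Σsel-cong xs (λ y r p → e y (x ∷ r) (↭-trans (Perm.swap y x ↭-refl) (Perm.prep x p))))

Σsel-zero : ∀ {A : Set} {f : A → List A → ℚ} x → (∀ y r → y ∷ r ↭ x → f y r ≡ 0ℚ) → Σsel x f ≡ 0ℚ
Σsel-zero x e = trans (Σsel-cong x e) (const-zero x)
  where
  const-zero : ∀ x → Σsel x (λ _ _ → 0ℚ) ≡ 0ℚ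
  const-zero []       = refl
  const-zero (x ∷ xs) = trans (ℚₚ.+-identityˡ _) (const-zero xs)

Σsel-+ : ∀ {A : Set} (f g : A → List A → ℚ) x → Σsel x (λ y r → f y r + g y r) ≡ Σsel x f + Σsel x g
Σsel-+ f g []       = refl
Σsel-+ f g (x ∷ xs) =
  trans (cong (f x xs + g x xs +_) (Σsel-+ (λ y r → f y (x ∷ r)) (λ y r → g y (x ∷ r)) xs)) (+-interchange (f x xs) (g x xs) _ _)

Σsel-*ˡ : ∀ {A : Set} c (f : A → List A → ℚ) x → Σsel x (λ y r → c * f y r) ≡ c * Σsel x f
Σsel-*ˡ c f []       = sym (ℚₚ.*-zeroʳ c)
Σsel-*ˡ c f (x ∷ xs) = trans (cong (c * f x xs +_) (Σsel-*ˡ c _ xs)) (sym (ℚₚ.*-distribˡ-+ c _ _))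

Σsel-const : ∀ {A : Set} c (x : List A) → Σsel x (λ _ _ → c) ≡ ℕ→ℚ (length x) * c
Σsel-const c []       = sym (ℚₚ.*-zeroˡ c)
Σsel-const c (x ∷ xs) = trans (cong (c +_) (Σsel-const c xs))
  (trans (lemma c (ℕ→ℚ (length xs))) (cong (_* c) (sym (ℕ→ℚ-suc (length xs)))))
  where
  lemma : ∀ c l → c + l * c ≡ (1ℚ + l) * c
  lemma = solve-∀ ℚ-ring

insertAll-↭ : ∀ {A : Set} (a : A) q → All (_↭ a ∷ q) (insertAll a q)
insertAll-↭ a []       = ↭-refl ∷ []
insertAll-↭ a (b ∷ bs) = ↭-refl ∷ Allₚ.map⁺ (All.map (λ p → ↭-trans (Perm.prep b p) (Perm.swap b a ↭-refl)) (insertAll-↭ a bs))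

perms-↭ : ∀ {A : Set} (x : List A) → All (_↭ x) (perms x)
perms-↭ []       = ↭-refl ∷ []
perms-↭ (a ∷ as) = Allₚ.concat⁺ (Allₚ.map⁺ (All.map (λ p → All.map (λ q → ↭-trans q (Perm.prep a p)) (insertAll-↭ a _)) (perms-↭ as)))

-- `perms` inserts the head of its input at every place, whereas `summand` reads a permutation from
-- its first entry. Regrouping by first entry reconciles the two; `later` collects the insertions of
-- `a` behind the first entry.
Σ-perms-∷ : ∀ {A : Set} (x : A) xs (f : List A → ℚ) →
  Σℚ (perms (x ∷ xs)) f ≡ Σsel (x ∷ xs) (λ y r → Σℚ (perms r) (f ∘ (y ∷_)))
Σ-perms-∷ {A} a as f = begin
  Σℚ (perms (a ∷ as)) f
    ≡⟨ Σ-concatMap f (insertAll a) (perms as) ⟩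
  Σℚ (perms as) (λ q → Σℚ (insertAll a q) f)
    ≡⟨ Σ-cong split (perms as) ⟩
  Σℚ (perms as) (λ q → f (a ∷ q) + later q)
    ≡⟨ Σ-+ (f ∘ (a ∷_)) later (perms as) ⟩
  Σℚ (perms as) (f ∘ (a ∷_)) + Σℚ (perms as) later
    ≡⟨ cong (Σℚ (perms as) (f ∘ (a ∷_)) +_) (Σ-later as) ⟩
  Σℚ (perms as) (f ∘ (a ∷_)) + Σsel as (λ b r → Σℚ (perms (a ∷ r)) (f ∘ (b ∷_)))
    ∎
  where
  open ≡-Reasoning
  later : List A → ℚ
  later []       = 0ℚ
  later (b ∷ bs) = Σℚ (insertAll a bs) (f ∘ (b ∷_))
  split : ∀ q → Σℚ (insertAll a q) f ≡ f (a ∷ q) + later q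
  split []       = refl
  split (b ∷ bs) = cong (f (a ∷ b ∷ bs) +_) (Σ-map f (b ∷_) (insertAll a bs))
  Σ-later : ∀ as → Σℚ (perms as) later ≡ Σsel as (λ b r → Σℚ (perms (a ∷ r)) (f ∘ (b ∷_)))
  Σ-later []        = refl
  Σ-later (a′ ∷ as) = trans (Σ-perms-∷ a′ as later)
    (Σsel-cong (a′ ∷ as) (λ b r _ → sym (Σ-concatMap (f ∘ (b ∷_)) (insertAll a) (perms r))))

prodℚ-map-↭ : ∀ {A : Set} (φ : A → ℚ) {r s} → r ↭ s → prodℚ (map φ r) ≡ prodℚ (map φ s)
prodℚ-map-↭ φ Perm.refl           = refl
prodℚ-map-↭ φ (Perm.prep x p)     = cong (φ x *_) (prodℚ-map-↭ φ p)
prodℚ-map-↭ φ (Perm.swap x y p)   = trans (cong (λ t → φ x * (φ y * t)) (prodℚ-map-↭ φ p)) (*-left-comm (φ x) (φ y) _)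
prodℚ-map-↭ φ (Perm.trans p q)    = trans (prodℚ-map-↭ φ p) (prodℚ-map-↭ φ q)

ratio : ℚ → ℚ → ℚ
ratio y z = (y + z) ÷′ (y - z)

ratios : ℚ → List ℚ → ℚ
ratios y r = prodℚ (map (ratio y) r)

-- The symmetrisation of Defs with the factor 1 / (N - l)! already cancelled: only the first
-- l values of a permutation matter.
S : (ℚ → ℕ → ℚ) → List ℕ → List ℚ → ℚ
S e []      x = 1ℚ
S e (a ∷ ν) x = Σsel x (λ y r → e y a * ratios y r * S e ν r)

Σ-perms-1 : ∀ {A : Set} n (x : List A) → length x ≡ n → Σℚ (perms x) (λ _ → 1ℚ) ≡ ℕ→ℚ (n !)
Σ-perms-1 zero    []       _ = refl
Σ-perms-1 (suc n) (x ∷ xs) e = begin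
  Σℚ (perms (x ∷ xs)) (λ _ → 1ℚ)                       ≡⟨ Σ-perms-∷ x xs (λ _ → 1ℚ) ⟩
  Σsel (x ∷ xs) (λ _ r → Σℚ (perms r) (λ _ → 1ℚ))      ≡⟨ Σsel-cong (x ∷ xs) (λ y r p →
                                                             Σ-perms-1 n r (ℕₚ.suc-injective (trans (Permₚ.↭-length p) e))) ⟩
  Σsel (x ∷ xs) (λ _ _ → ℕ→ℚ (n !))                    ≡⟨ Σsel-const (ℕ→ℚ (n !)) (x ∷ xs) ⟩
  ℕ→ℚ (length (x ∷ xs)) * ℕ→ℚ (n !)                    ≡⟨ cong (λ k → ℕ→ℚ k * ℕ→ℚ (n !)) e ⟩
  ℕ→ℚ (suc n) * ℕ→ℚ (n !)                              ≡⟨ ℕ→ℚ-* (suc n) (n !) ⟨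
  ℕ→ℚ (suc n !)                                        ∎
  where open ≡-Reasoning

-- Each factor `ratios y` is symmetric in the variables that follow `y`, so once the variables of
-- the l rows are chosen, the (N - l)! arrangements of the others all contribute the same amount.
Σ-perms-summand : ∀ e ν x → length ν ℕ.≤ length x →
  Σℚ (perms x) (summand e ν) ≡ S e ν x * ℕ→ℚ ((length x ∸ length ν) !)
Σ-perms-summand e []      x _ = trans (Σ-perms-1 (length x) x refl) (sym (ℚₚ.*-identityˡ _))
Σ-perms-summand e (a ∷ ν) (x ∷ xs) (s≤s l≤) = begin
  Σℚ (perms (x ∷ xs)) (summand e (a ∷ ν))
    ≡⟨ Σ-perms-∷ x xs (summand e (a ∷ ν)) ⟩
  Σsel (x ∷ xs) (λ y r → Σℚ (perms r) (λ ys → e y a * ratios y ys * summand e ν ys))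
    ≡⟨ Σsel-cong (x ∷ xs) step ⟩
  Σsel (x ∷ xs) (λ y r → fact * (e y a * ratios y r * S e ν r))
    ≡⟨ Σsel-*ˡ fact (λ y r → e y a * ratios y r * S e ν r) (x ∷ xs) ⟩
  fact * S e (a ∷ ν) (x ∷ xs)
    ≡⟨ ℚₚ.*-comm fact _ ⟩
  S e (a ∷ ν) (x ∷ xs) * fact ∎
  where
  open ≡-Reasoning
  fact = ℕ→ℚ ((length xs ∸ length ν) !)
  lemma : ∀ a b c → a * (b * c) ≡ c * (a * b)
  lemma = solve-∀ ℚ-ring
  step : ∀ y r → y ∷ r ↭ x ∷ xs → Σℚ (perms r) (λ ys → e y a * ratios y ys * summand e ν ys)
                                 ≡ fact * (e y a * ratios y r * S e ν r)
  step y r p = begin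
    Σℚ (perms r) (λ ys → e y a * ratios y ys * summand e ν ys)
      ≡⟨ Σ-cong-All (All.map (λ q → cong (λ t → e y a * t * _) (prodℚ-map-↭ (ratio y) q)) (perms-↭ r)) ⟩
    Σℚ (perms r) (λ ys → e y a * ratios y r * summand e ν ys)
      ≡⟨ Σ-*ˡ (e y a * ratios y r) (summand e ν) (perms r) ⟩
    e y a * ratios y r * Σℚ (perms r) (summand e ν)
      ≡⟨ cong (e y a * ratios y r *_) (Σ-perms-summand e ν r (subst (length ν ℕ.≤_) (sym len) l≤)) ⟩
    e y a * ratios y r * (S e ν r * ℕ→ℚ ((length r ∸ length ν) !))
      ≡⟨ cong (λ k → e y a * ratios y r * (S e ν r * ℕ→ℚ ((k ∸ length ν) !))) len ⟩
    e y a * ratios y r * (S e ν r * fact)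
      ≡⟨ lemma (e y a * ratios y r) (S e ν r) fact ⟩
    fact * (e y a * ratios y r * S e ν r) ∎
    where
    len : length r ≡ length xs
    len = ℕₚ.suc-injective (Permₚ.↭-length p)

S-short : ∀ e ν x → length x ℕ.< length ν → S e ν x ≡ 0ℚ
S-short e (a ∷ ν) x (s≤s l≤) = Σsel-zero x (λ y r p → trans
  (cong (e y a * ratios y r *_) (S-short e ν r (subst (ℕ._≤ length ν) (sym (Permₚ.↭-length p)) l≤)))
  (ℚₚ.*-zeroʳ (e y a * ratios y r)))

symmetrise-S : ∀ e ν x → symmetrise e ν x ≡ S e ν x
symmetrise-S e ν x with length ν ≤ᵇ length x in eq
... | false = sym (S-short e ν x (ℕₚ.≰⇒> (λ l≤ → subst T eq (ℕₚ.≤⇒≤ᵇ l≤))))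
... | true  = *-cancelˡ (!≢0 (length x ∸ length ν)) (begin
  fact * (Σℚ (perms x) (summand e ν) ÷′ fact)      ≡⟨ cong (fact *_) (÷′-inv _ fact) ⟩
  fact * (Σℚ (perms x) (summand e ν) * inv fact)   ≡⟨ lemma fact _ (inv fact) ⟩
  fact * inv fact * Σℚ (perms x) (summand e ν)     ≡⟨ cong (_* Σℚ (perms x) (summand e ν)) (*-inv (!≢0 (length x ∸ length ν))) ⟩
  1ℚ * Σℚ (perms x) (summand e ν)                  ≡⟨ ℚₚ.*-identityˡ _ ⟩
  Σℚ (perms x) (summand e ν)                       ≡⟨ Σ-perms-summand e ν x (ℕₚ.≤ᵇ⇒≤ (length ν) (length x) (subst T (sym eq) tt)) ⟩
  S e ν x * fact                                   ≡⟨ ℚₚ.*-comm (S e ν x) fact ⟩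
  fact * S e ν x                                   ∎)
  where
  open ≡-Reasoning
  fact = ℕ→ℚ ((length x ∸ length ν) !)
  lemma : ∀ a b c → a * (b * c) ≡ a * c * b
  lemma = solve-∀ ℚ-ring

-- Pieri rules

Unique-↭ : ∀ {A : Set} {r s : List A} → r ↭ s → Unique r → Unique s
Unique-↭ {A} p = PermSetoidₚ.Unique-resp-↭ (setoid A) (↭⇒↭ₛ p)

gate : Bool → ℚ → ℚ
gate true  q = q
gate false q = 0ℚ

gate-+ : ∀ t p q → gate t (p + q) ≡ gate t p + gate t q
gate-+ true  p q = refl
gate-+ false p q = refl

gate-*ˡ : ∀ t c q → gate t (c * q) ≡ c * gate t q
gate-*ˡ true  c q = refl
gate-*ˡ false c q = sym (ℚₚ.*-zeroʳ c)

fits : (ℕ → ℕ → Bool) → Maybe ℕ → ℕ → Bool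
fits t nothing  a = true
fits t (just b) a = t a b

-- Box additions: t decides whether an enlarged row still fits below the row b above it, and
-- enlarging an existing row has weight w while starting a new row has weight 1.
up : (ℕ → ℕ → Bool) → ℚ → Maybe ℕ → List ℕ → (List ℕ → ℚ) → ℚ
up t w b []      f = gate (fits t b 1) (f (1 ∷ []))
up t w b (a ∷ ν) f = w * gate (fits t b (suc a)) (f (suc a ∷ ν)) + up t w (just a) ν (f ∘ (a ∷_))

module _ (t : ℕ → ℕ → Bool) (w : ℚ) where

  up-cong : ∀ b ν {f g} → (∀ κ → f κ ≡ g κ) → up t w b ν f ≡ up t w b ν g
  up-cong b []      e = cong (gate (fits t b 1)) (e (1 ∷ []))
  up-cong b (a ∷ ν) e = cong₂ _+_ (cong (λ q → w * gate (fits t b (suc a)) q) (e (suc a ∷ ν)))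
                                  (up-cong (just a) ν (λ κ → e (a ∷ κ)))

  up-+ : ∀ b ν f g → up t w b ν (λ κ → f κ + g κ) ≡ up t w b ν f + up t w b ν g
  up-+ b []      f g = gate-+ (fits t b 1) _ _
  up-+ b (a ∷ ν) f g = trans
    (cong₂ (λ p q → w * p + q) (gate-+ (fits t b (suc a)) _ _) (up-+ (just a) ν (f ∘ (a ∷_)) (g ∘ (a ∷_))))
    (lemma w (gate (fits t b (suc a)) (f (suc a ∷ ν))) (gate (fits t b (suc a)) (g (suc a ∷ ν)))
           (up t w (just a) ν (f ∘ (a ∷_))) (up t w (just a) ν (g ∘ (a ∷_))))
    where
    lemma : ∀ w p q r s → w * (p + q) + (r + s) ≡ w * p + r + (w * q + s)
    lemma = solve-∀ ℚ-ring

  up-*ˡ : ∀ b ν c f → up t w b ν (λ κ → c * f κ) ≡ c * up t w b ν f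
  up-*ˡ b []      c f = gate-*ˡ (fits t b 1) c _
  up-*ˡ b (a ∷ ν) c f = trans
    (cong₂ (λ p q → w * p + q) (gate-*ˡ (fits t b (suc a)) c _) (up-*ˡ (just a) ν c (f ∘ (a ∷_))))
    (lemma w c (gate (fits t b (suc a)) (f (suc a ∷ ν))) (up t w (just a) ν (f ∘ (a ∷_))))
    where
    lemma : ∀ w c p q → w * (c * p) + c * q ≡ c * (w * p + q)
    lemma = solve-∀ ℚ-ring

  up-zero : ∀ b ν → up t w b ν (λ _ → 0ℚ) ≡ 0ℚ
  up-zero b ν = trans (up-*ˡ b ν 0ℚ (λ _ → 0ℚ)) (ℚₚ.*-zeroˡ (up t w b ν (λ _ → 0ℚ)))

  up-Σ : ∀ {A : Set} b ν (xs : List A) (f : List ℕ → A → ℚ) →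
    up t w b ν (λ κ → Σℚ xs (f κ)) ≡ Σℚ xs (λ x → up t w b ν (λ κ → f κ x))
  up-Σ b ν []       f = up-zero b ν
  up-Σ b ν (x ∷ xs) f = trans (up-+ b ν (λ κ → f κ x) (λ κ → Σℚ xs (f κ)))
                              (cong (up t w b ν (λ κ → f κ x) +_) (up-Σ b ν xs f))

  up-Σsel : ∀ {A : Set} b ν (x : List A) (f : List ℕ → A → List A → ℚ) →
    up t w b ν (λ κ → Σsel x (f κ)) ≡ Σsel x (λ y r → up t w b ν (λ κ → f κ y r))
  up-Σsel b ν []       f = up-zero b ν
  up-Σsel b ν (x ∷ xs) f = trans (up-+ b ν (λ κ → f κ x xs) (λ κ → Σsel xs (λ y r → f κ y (x ∷ r))))
    (cong (up t w b ν (λ κ → f κ x xs) +_) (up-Σsel b ν xs (λ κ y r → f κ y (x ∷ r))))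

-- Choosing y then z leaves the same rest as choosing z then y, so the two terms cancel.
Σsel²-antisym : ∀ {A : Set} (K : A → A → List A → ℚ) → (∀ y z s → K y z s ≡ - K z y s) →
  ∀ x → Σsel x (λ y r → Σsel r (K y)) ≡ 0ℚ
Σsel²-antisym K anti []       = refl
Σsel²-antisym K anti (x ∷ xs) = begin
  Σsel xs (K x) + Σsel xs (λ y r → K y x r + Σsel r (λ z s → K y z (x ∷ s)))
    ≡⟨ cong (Σsel xs (K x) +_) (Σsel-+ (λ y r → K y x r) (λ y r → Σsel r (λ z s → K y z (x ∷ s))) xs) ⟩
  Σsel xs (K x) + (Σsel xs (λ y r → K y x r) + Σsel xs (λ y r → Σsel r (λ z s → K y z (x ∷ s))))
    ≡⟨ cong₂ (λ p q → p + (Σsel xs (λ y r → K y x r) + q)) negate (Σsel²-antisym (λ y z s → K y z (x ∷ s)) (λ y z s → anti y z (x ∷ s)) xs) ⟩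
  - 1ℚ * Σsel xs (λ y r → K y x r) + (Σsel xs (λ y r → K y x r) + 0ℚ)
    ≡⟨ lemma (Σsel xs (λ y r → K y x r)) ⟩
  0ℚ ∎
  where
  open ≡-Reasoning
  lemma : ∀ a → - 1ℚ * a + (a + 0ℚ) ≡ 0ℚ
  lemma = solve-∀ ℚ-ring
  neg-* : ∀ a → - a ≡ - 1ℚ * a
  neg-* = solve-∀ ℚ-ring
  negate : Σsel xs (K x) ≡ - 1ℚ * Σsel xs (λ y r → K y x r)
  negate = trans (Σsel-cong xs (λ y r _ → trans (anti x y r) (neg-* (K y x r)))) (Σsel-*ˡ (- 1ℚ) (λ y r → K y x r) xs)

-- This includes y = z, where totalised division makes both sides 0; hence `S-repeat` holds at
-- arbitrary points.
ratio-antisym : ∀ y z → ratio y z ≡ - ratio z y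
ratio-antisym y z = begin
  (y + z) ÷′ (y - z)            ≡⟨ ÷′-inv (y + z) (y - z) ⟩
  (y + z) * inv (y - z)         ≡⟨ cong (λ q → (y + z) * inv q) (flip y z) ⟩
  (y + z) * inv (- (z - y))     ≡⟨ cong ((y + z) *_) (inv-neg (z - y)) ⟩
  (y + z) * - inv (z - y)       ≡⟨ lemma y z (inv (z - y)) ⟩
  - ((z + y) * inv (z - y))     ≡⟨ cong -_ (÷′-inv (z + y) (z - y)) ⟨
  - ((z + y) ÷′ (z - y))        ∎
  where
  open ≡-Reasoning
  flip : ∀ y z → y - z ≡ - (z - y)
  flip = solve-∀ ℚ-ring
  lemma : ∀ y z i → (y + z) * - i ≡ - ((z + y) * i)
  lemma = solve-∀ ℚ-ring

-- Exchanging the variables of the two equal rows changes the term only through the sign of the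
-- ratio between them.
S-repeat : ∀ e κ a ν x → S e (κ ++ a ∷ a ∷ ν) x ≡ 0ℚ
S-repeat e [] a ν x = trans
  (Σsel-cong x (λ y r _ → trans (sym (Σsel-*ˡ (e y a * ratios y r) (λ z s → e z a * ratios z s * S e ν s) r))
    (Σsel-cong r (λ z s p → cong (λ q → e y a * q * (e z a * ratios z s * S e ν s)) (sym (prodℚ-map-↭ (ratio y) p))))))
  (Σsel²-antisym K anti x)
  where
  K : ℚ → ℚ → List ℚ → ℚ
  K y z s = e y a * (ratio y z * ratios y s) * (e z a * ratios z s * S e ν s)
  lemma : ∀ a b c d f g → a * (- b * c) * (d * f * g) ≡ - (d * (b * f) * (a * c * g))
  lemma = solve-∀ ℚ-ring
  anti : ∀ y z s → K y z s ≡ - K z y s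
  anti y z s = trans (cong (λ q → e y a * (q * ratios y s) * (e z a * ratios z s * S e ν s)) (ratio-antisym y z))
                     (lemma (e y a) (ratio z y) (ratios y s) (e z a) (ratios z s) (S e ν s))
S-repeat e (k ∷ κ) a ν x = Σsel-zero x (λ y r _ → trans (cong (e y k * ratios y r *_) (S-repeat e κ a ν r)) (ℚₚ.*-zeroʳ (e y k * ratios y r)))

-- The partial fraction expansion in t of the product of (t + y)/(t - y): the limit at infinity is
-- 1, and the residue at y is 2y times the product of the (y + z)/(y - z). The induction uses the
-- expansion of the shorter product both at t and at the new pole s.
ratios-partial-fractions : ∀ t x → All (t ≢_) x → Unique x →
  ratios t x ≡ 1ℚ + Σsel x (λ y r → 2ℚ * y * ratios y r * inv (t - y))
ratios-partial-fractions t []       _          _          = refl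
ratios-partial-fractions t (s ∷ xs) (t≢s ∷ t≢) (s≢ ∷ uniq) = begin
  ratio t s * ratios t xs
    ≡⟨ cong₂ _*_ (÷′-inv (t + s) (t - s)) (ratios-partial-fractions t xs t≢ uniq) ⟩
  (t + s) * A * (1ℚ + Σsel xs (λ y r → G y r * inv (t - y)))
    ≡⟨ distribute ((t + s) * A) (Σsel xs (λ y r → G y r * inv (t - y))) ⟩
  (t + s) * A + (t + s) * A * Σsel xs (λ y r → G y r * inv (t - y))
    ≡⟨ cong ((t + s) * A +_) (Σsel-*ˡ ((t + s) * A) (λ y r → G y r * inv (t - y)) xs) ⟨
  (t + s) * A + Σsel xs (λ y r → (t + s) * A * (G y r * inv (t - y)))
    ≡⟨ cong₂ _+_ (expand t s A) (Σsel-cong xs termwise) ⟩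
  (t - s) * A + 2ℚ * s * A + Σsel xs (λ y r → 2ℚ * s * A * (G y r * inv (s - y)) + 2ℚ * y * ratios y (s ∷ r) * inv (t - y))
    ≡⟨ cong₂ (λ p q → p + 2ℚ * s * A + q) (*-inv (-≢0 t≢s))
         (trans (Σsel-+ (λ y r → 2ℚ * s * A * (G y r * inv (s - y))) (λ y r → 2ℚ * y * ratios y (s ∷ r) * inv (t - y)) xs)
                (cong (_+ rest) (Σsel-*ˡ (2ℚ * s * A) (λ y r → G y r * inv (s - y)) xs))) ⟩
  1ℚ + 2ℚ * s * A + (2ℚ * s * A * Σsel xs (λ y r → G y r * inv (s - y)) + rest)
    ≡⟨ collect (2ℚ * s) A (Σsel xs (λ y r → G y r * inv (s - y))) rest ⟩
  1ℚ + (2ℚ * s * (1ℚ + Σsel xs (λ y r → G y r * inv (s - y))) * A + rest)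
    -- The shorter expansion evaluated at t = s supplies the residue at s.
    ≡⟨ cong (λ q → 1ℚ + (2ℚ * s * q * A + rest)) (ratios-partial-fractions s xs s≢ uniq) ⟨
  1ℚ + (2ℚ * s * ratios s xs * A + rest) ∎
  where
  open ≡-Reasoning
  A = inv (t - s)
  G : ℚ → List ℚ → ℚ
  G y r = 2ℚ * y * ratios y r
  rest = Σsel xs (λ y r → 2ℚ * y * ratios y (s ∷ r) * inv (t - y))
  distribute : ∀ a b → a * (1ℚ + b) ≡ a + a * b
  distribute = solve-∀ ℚ-ring
  expand : ∀ t s a → (t + s) * a ≡ (t - s) * a + 2ℚ * s * a
  expand = solve-∀ ℚ-ring
  collect : ∀ u a b c → 1ℚ + u * a + (u * a * b + c) ≡ 1ℚ + (u * (1ℚ + b) * a + c)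
  collect = solve-∀ ℚ-ring
  insert-unit : ∀ u v → v ≡ 1ℚ → u ≡ u * v
  insert-unit u v v≡1 = trans (sym (ℚₚ.*-identityʳ u)) (cong (u *_) (sym v≡1))
  -- With a, b, c the inverses of t - s, t - y, y - s, this is the splitting of (t + s)/((t - s)(t -
  -- y)) into its parts at the poles s and y; the products equal to 1 keep it polynomial.
  poly : ∀ t s y a b c → (t + s) * a * b * ((y - s) * c)
                       ≡ 2ℚ * s * a * - c * ((t - y) * b) + (y + s) * c * b * ((t - s) * a)
  poly = solve-∀ ℚ-ring
  factor : ∀ u y ρ i j v b → u * (2ℚ * y * ρ * i) + 2ℚ * y * (j * v * ρ) * b
                             ≡ 2ℚ * y * ρ * (u * i + j * v * b)
  factor = solve-∀ ℚ-ring
  flip : ∀ s y → s - y ≡ - (y - s)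
  flip = solve-∀ ℚ-ring
  termwise : ∀ y r → y ∷ r ↭ xs →
    (t + s) * A * (G y r * inv (t - y)) ≡ 2ℚ * s * A * (G y r * inv (s - y)) + 2ℚ * y * ratios y (s ∷ r) * inv (t - y)
  termwise y r p = begin
    (t + s) * A * (G y r * B)
      ≡⟨ *-left-comm ((t + s) * A) (G y r) B ⟩
    G y r * ((t + s) * A * B)
      ≡⟨ cong (G y r *_) (begin
           (t + s) * A * B
             ≡⟨ insert-unit ((t + s) * A * B) ((y - s) * C) (*-inv (-≢0 (s≢y ∘ sym))) ⟩
           (t + s) * A * B * ((y - s) * C)
             ≡⟨ poly t s y A B C ⟩
           2ℚ * s * A * - C * ((t - y) * B) + (y + s) * C * B * ((t - s) * A)
             ≡⟨ cong₂ _+_ (sym (insert-unit (2ℚ * s * A * - C) ((t - y) * B) (*-inv (-≢0 t≢y))))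
                          (sym (insert-unit ((y + s) * C * B) ((t - s) * A) (*-inv (-≢0 t≢s)))) ⟩
           2ℚ * s * A * - C + (y + s) * C * B
             ≡⟨ cong (λ q → 2ℚ * s * A * q + (y + s) * C * B) (trans (sym (inv-neg (y - s))) (cong inv (sym (flip s y)))) ⟩
           2ℚ * s * A * inv (s - y) + (y + s) * C * B ∎) ⟩
    G y r * (2ℚ * s * A * inv (s - y) + (y + s) * C * B)
      ≡⟨ factor (2ℚ * s * A) y (ratios y r) (inv (s - y)) (y + s) C B ⟨
    2ℚ * s * A * (G y r * inv (s - y)) + 2ℚ * y * ((y + s) * C * ratios y r) * B
      ≡⟨ cong (λ q → 2ℚ * s * A * (G y r * inv (s - y)) + 2ℚ * y * (q * ratios y r) * B) (÷′-inv (y + s) (y - s)) ⟨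
    2ℚ * s * A * (G y r * inv (s - y)) + 2ℚ * y * ratios y (s ∷ r) * B ∎
    where
    B = inv (t - y)
    C = inv (y - s)
    t≢y : t ≢ y
    t≢y = All.head (Permₚ.All-resp-↭ (↭-sym p) t≢)
    s≢y : s ≢ y
    s≢y = All.head (Permₚ.All-resp-↭ (↭-sym p) s≢)

-- P₁ = p₁
Σsel-ratios : ∀ x → Unique x → Σsel x (λ y r → y * ratios y r) ≡ sumℚ x
Σsel-ratios []       _           = refl
Σsel-ratios (t ∷ xs) (t≢ ∷ uniq) = begin
  t * ratios t xs + Σsel xs (λ y r → y * ratios y (t ∷ r))
    ≡⟨ cong (λ q → t * q + rest) (ratios-partial-fractions t xs t≢ uniq) ⟩
  t * (1ℚ + Σsel xs (λ y r → 2ℚ * y * ratios y r * inv (t - y))) + rest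
    ≡⟨ distribute t _ rest ⟩
  t + (t * Σsel xs (λ y r → 2ℚ * y * ratios y r * inv (t - y)) + rest)
    ≡⟨ cong (λ q → t + (q + rest)) (Σsel-*ˡ t (λ y r → 2ℚ * y * ratios y r * inv (t - y)) xs) ⟨
  t + (Σsel xs (λ y r → t * (2ℚ * y * ratios y r * inv (t - y))) + rest)
    ≡⟨ cong (t +_) (Σsel-+ (λ y r → t * (2ℚ * y * ratios y r * inv (t - y))) (λ y r → y * ratios y (t ∷ r)) xs) ⟨
  t + Σsel xs (λ y r → t * (2ℚ * y * ratios y r * inv (t - y)) + y * ratios y (t ∷ r))
    ≡⟨ cong (t +_) (Σsel-cong xs termwise) ⟩
  t + Σsel xs (λ y r → y * ratios y r)
    ≡⟨ cong (t +_) (Σsel-ratios xs uniq) ⟩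
  t + sumℚ xs ∎
  where
  open ≡-Reasoning
  rest = Σsel xs (λ y r → y * ratios y (t ∷ r))
  distribute : ∀ a b c → a * (1ℚ + b) + c ≡ a + (a * b + c)
  distribute = solve-∀ ℚ-ring
  -- With b = 1/(t - y) this is 2ty - y(t + y) = y(t - y): the partial fraction at y compensates the
  -- factor (y + t)/(y - t) that the new variable t brings into the term of y.
  poly : ∀ t y ρ b → t * (2ℚ * y * ρ * b) + y * (- ((t + y) * b) * ρ) ≡ y * ρ * ((t - y) * b)
  poly = solve-∀ ℚ-ring
  termwise : ∀ y r → y ∷ r ↭ xs → t * (2ℚ * y * ratios y r * inv (t - y)) + y * ratios y (t ∷ r) ≡ y * ratios y r
  termwise y r p = begin
    t * (2ℚ * y * ratios y r * inv (t - y)) + y * (ratio y t * ratios y r)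
      ≡⟨ cong (λ q → t * (2ℚ * y * ratios y r * inv (t - y)) + y * (q * ratios y r))
           (trans (ratio-antisym y t) (cong -_ (÷′-inv (t + y) (t - y)))) ⟩
    t * (2ℚ * y * ratios y r * inv (t - y)) + y * (- ((t + y) * inv (t - y)) * ratios y r)
      ≡⟨ poly t y (ratios y r) (inv (t - y)) ⟩
    y * ratios y r * ((t - y) * inv (t - y))
      ≡⟨ cong (y * ratios y r *_) (*-inv (-≢0 (All.head (Permₚ.All-resp-↭ (↭-sym p) t≢)))) ⟩
    y * ratios y r * 1ℚ
      ≡⟨ ℚₚ.*-identityʳ (y * ratios y r) ⟩
    y * ratios y r ∎

-- The bound is exclusive and stands for the row above, `nothing` meaning no row above; inductions
-- on rows thereby remember what limits the first row. Positivity is built into the shape `suc a`.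
data Strict : Maybe ℕ → List ℕ → Set where
  []   : ∀ {b} → Strict b []
  cons : ∀ {b a ν} → T (fits _<ᵇ_ b (suc a)) → Strict (just (suc a)) ν → Strict b (suc a ∷ ν)

up< : ℚ → Maybe ℕ → List ℕ → (List ℕ → ℚ) → ℚ
up< = up _<ᵇ_

-- Additions to every row, legal or not: for these the Pieri rule holds term by term.
upAll : List ℕ → (List ℕ → ℚ) → ℚ
upAll = up (λ _ _ → true) 1ℚ nothing

just-all : ∀ b ν f → up (λ _ _ → true) 1ℚ (just b) ν f ≡ upAll ν f
just-all b []      f = refl
just-all b (a ∷ ν) f = refl

-- Adding a box to strict rows is illegal only if the row becomes equal to the one above. Such
-- sequences are killed by `head-0` when the row above is the bound `suc b` and by `repeat-0`
-- further down.
upAll-strict : ∀ b {ν} f → Strict (just (suc b)) ν → (∀ κ → f (suc b ∷ κ) ≡ 0ℚ) →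
  (∀ κ a κ′ → f (κ ++ a ∷ a ∷ κ′) ≡ 0ℚ) → upAll ν f ≡ up< 1ℚ (just (suc b)) ν f
upAll-strict zero    f []         head-0 repeat-0 = head-0 []
upAll-strict (suc b) f []         head-0 repeat-0 = refl
upAll-strict b       f (cons {a = a} {ν} a<b strict) head-0 repeat-0 = cong₂ (λ p q → 1ℚ * p + q) head
  (trans (just-all (suc a) ν (f ∘ (suc a ∷_)))
         (upAll-strict a (f ∘ (suc a ∷_)) strict (λ κ → repeat-0 [] (suc a) κ) (λ κ → repeat-0 (suc a ∷ κ))))
  where
  head : f (suc (suc a) ∷ ν) ≡ gate (suc a <ᵇ b) (f (suc (suc a) ∷ ν))
  head with suc a <ᵇ b in eq
  ... | true  = refl
  ... | false with refl ← ℕₚ.≤-antisym (ℕₚ.<ᵇ⇒< a b a<b) (ℕₚ.≮⇒≥ (λ lt → subst T eq (ℕₚ.<⇒<ᵇ lt))) = head-0 ν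

-- One proof for both rules: c = 1 gives falling factorials and P*, c = 0 gives powers and P.
module Pieri (e : ℚ → ℕ → ℚ) (c : ℚ) (e-zero : ∀ y → e y 0 ≡ 1ℚ)
             (e-suc : ∀ y a → e y (suc a) ≡ e y a * (y - c * ℕ→ℚ a)) where

  -- In a term whose first row has variable y, a box in that row multiplies the term by y - ca, and
  -- by induction the boxes in the other rows multiply it by the sum of the other variables minus
  -- c|ν|. The two factors add up to one that no longer depends on y. The base case is P₁ = p₁.
  S-upAll : ∀ ν x → Unique x → upAll ν (λ κ → S e κ x) ≡ (sumℚ x - c * ℕ→ℚ (sum ν)) * S e ν x
  S-upAll []      x uniq = begin
    Σsel x (λ y r → e y 1 * ratios y r * 1ℚ)    ≡⟨ Σsel-cong x (λ y r _ → trans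
                                                     (cong (λ q → q * ratios y r * 1ℚ) (trans (e-suc y 0) (cong (_* (y - c * 0ℚ)) (e-zero y))))
                                                     (lemma y c (ratios y r))) ⟩
    Σsel x (λ y r → y * ratios y r)             ≡⟨ Σsel-ratios x uniq ⟩
    sumℚ x                                       ≡⟨ lemma′ (sumℚ x) c ⟩
    (sumℚ x - c * 0ℚ) * 1ℚ                       ∎
    where
    open ≡-Reasoning
    lemma : ∀ y c ρ → 1ℚ * (y - c * 0ℚ) * ρ * 1ℚ ≡ y * ρ
    lemma = solve-∀ ℚ-ring
    lemma′ : ∀ s c → s ≡ (s - c * 0ℚ) * 1ℚ
    lemma′ = solve-∀ ℚ-ring
  S-upAll (a ∷ ν) x uniq = begin
    1ℚ * S e (suc a ∷ ν) x + up (λ _ _ → true) 1ℚ (just a) ν (λ κ → S e (a ∷ κ) x)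
      ≡⟨ cong₂ _+_ (ℚₚ.*-identityˡ (S e (suc a ∷ ν) x)) (just-all a ν (λ κ → S e (a ∷ κ) x)) ⟩
    S e (suc a ∷ ν) x + upAll ν (λ κ → Σsel x (λ y r → e y a * ratios y r * S e κ r))
      ≡⟨ cong (S e (suc a ∷ ν) x +_) (up-Σsel _ 1ℚ nothing ν x (λ κ y r → e y a * ratios y r * S e κ r)) ⟩
    S e (suc a ∷ ν) x + Σsel x (λ y r → upAll ν (λ κ → e y a * ratios y r * S e κ r))
      ≡⟨ Σsel-+ (λ y r → e y (suc a) * ratios y r * S e ν r) (λ y r → upAll ν (λ κ → e y a * ratios y r * S e κ r)) x ⟨
    Σsel x (λ y r → e y (suc a) * ratios y r * S e ν r + upAll ν (λ κ → e y a * ratios y r * S e κ r))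
      ≡⟨ Σsel-cong x termwise ⟩
    Σsel x (λ y r → (sumℚ x - c * ℕ→ℚ (a ℕ.+ sum ν)) * (e y a * ratios y r * S e ν r))
      ≡⟨ Σsel-*ˡ (sumℚ x - c * ℕ→ℚ (a ℕ.+ sum ν)) (λ y r → e y a * ratios y r * S e ν r) x ⟩
    (sumℚ x - c * ℕ→ℚ (a ℕ.+ sum ν)) * S e (a ∷ ν) x ∎
    where
    open ≡-Reasoning
    sumℚ-↭ : ∀ {r s} → r ↭ s → sumℚ r ≡ sumℚ s
    sumℚ-↭ Perm.refl         = refl
    sumℚ-↭ (Perm.prep x p)   = cong (x +_) (sumℚ-↭ p)
    sumℚ-↭ (Perm.swap x y p) = trans (cong (λ t → x + (y + t)) (sumℚ-↭ p)) (+-left-comm x y _)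
    sumℚ-↭ (Perm.trans p q)  = trans (sumℚ-↭ p) (sumℚ-↭ q)
    lemma : ∀ E y c a ρ s σ n → E * (y - c * a) * ρ * s + E * ρ * ((σ - c * n) * s) ≡ (y + σ - c * (a + n)) * (E * ρ * s)
    lemma = solve-∀ ℚ-ring
    termwise : ∀ y r → y ∷ r ↭ x →
      e y (suc a) * ratios y r * S e ν r + upAll ν (λ κ → e y a * ratios y r * S e κ r)
        ≡ (sumℚ x - c * ℕ→ℚ (a ℕ.+ sum ν)) * (e y a * ratios y r * S e ν r)
    termwise y r p with Unique-↭ (↭-sym p) uniq
    ... | _ ∷ uniq-r = begin
      e y (suc a) * ratios y r * S e ν r + upAll ν (λ κ → e y a * ratios y r * S e κ r)
        ≡⟨ cong₂ (λ p q → p * ratios y r * S e ν r + q) (e-suc y a)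
             (trans (up-*ˡ _ 1ℚ nothing ν (e y a * ratios y r) (λ κ → S e κ r)) (cong (e y a * ratios y r *_) (S-upAll ν r uniq-r))) ⟩
      e y a * (y - c * ℕ→ℚ a) * ratios y r * S e ν r + e y a * ratios y r * ((sumℚ r - c * ℕ→ℚ (sum ν)) * S e ν r)
        ≡⟨ lemma (e y a) y c (ℕ→ℚ a) (ratios y r) (S e ν r) (sumℚ r) (ℕ→ℚ (sum ν)) ⟩
      (y + sumℚ r - c * (ℕ→ℚ a + ℕ→ℚ (sum ν))) * (e y a * ratios y r * S e ν r)
        ≡⟨ cong₂ (λ p q → (p - c * q) * (e y a * ratios y r * S e ν r)) (sumℚ-↭ p) (sym (ℕ→ℚ-+ a (sum ν))) ⟩
      (sumℚ x - c * ℕ→ℚ (a ℕ.+ sum ν)) * (e y a * ratios y r * S e ν r) ∎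

  S-up : ∀ {ν} x → Strict nothing ν → Unique x → up< 1ℚ nothing ν (λ κ → S e κ x) ≡ (sumℚ x - c * ℕ→ℚ (sum ν)) * S e ν x
  S-up x []                        uniq = S-upAll [] x uniq
  S-up x (cons {a = a} {ν} _ strict) uniq = trans
    (cong (1ℚ * S e (suc (suc a) ∷ ν) x +_)
      (sym (trans (just-all (suc a) ν (λ κ → S e (suc a ∷ κ) x))
                  (upAll-strict a (λ κ → S e (suc a ∷ κ) x) strict
             (λ κ → S-repeat e [] (suc a) κ x) (λ κ b κ′ → S-repeat e (suc a ∷ κ) b κ′ x)))))
    (S-upAll (suc a ∷ ν) x uniq)

open Pieri using (S-up)

falling-up : ∀ {ν} x → Strict nothing ν → Unique x →
  up< 1ℚ nothing ν (λ κ → S falling κ x) ≡ (sumℚ x - ℕ→ℚ (sum ν)) * S falling ν x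
falling-up {ν} x strict uniq = trans
  (S-up falling 1ℚ (λ _ → refl) (λ y a → cong (λ q → falling y a * (y - q)) (sym (ℚₚ.*-identityˡ (ℕ→ℚ a)))) x strict uniq)
  (cong (λ q → (sumℚ x - q) * S falling ν x) (ℚₚ.*-identityˡ (ℕ→ℚ (sum ν))))

power-up : ∀ {ν} x → Strict nothing ν → Unique x → up< 1ℚ nothing ν (λ κ → S _^′_ κ x) ≡ sumℚ x * S _^′_ ν x
power-up {ν} x strict uniq = trans
  (S-up _^′_ 0ℚ (λ _ → refl) (λ y a → lemma₁ y (y ^′ a) (ℕ→ℚ a)) x strict uniq)
  (lemma₂ (sumℚ x) (ℕ→ℚ (sum ν)) (S _^′_ ν x))
  where
  lemma₁ : ∀ y p n → y * p ≡ p * (y - 0ℚ * n)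
  lemma₁ = solve-∀ ℚ-ring
  lemma₂ : ∀ s n p → (s - 0ℚ * n) * p ≡ s * p
  lemma₂ = solve-∀ ℚ-ring

-- Vanishing of P*

falling-vanish : ∀ {y a} → y ℕ.< a → falling (ℕ→ℚ y) a ≡ 0ℚ
falling-vanish {y} {suc a} (s≤s y≤a) with ℕₚ.m≤n⇒m<n∨m≡n y≤a
... | inj₁ y<a  = trans (cong (_* (ℕ→ℚ y - ℕ→ℚ a)) (falling-vanish y<a)) (ℚₚ.*-zeroˡ (ℕ→ℚ y - ℕ→ℚ a))
... | inj₂ refl = trans (cong (falling (ℕ→ℚ y) y *_) (ℚₚ.+-inverseʳ (ℕ→ℚ y))) (ℚₚ.*-zeroʳ (falling (ℕ→ℚ y) y))

Σsel-map : ∀ {A B : Set} (h : A → B) (f : B → List B → ℚ) xs → Σsel (map h xs) f ≡ Σsel xs (λ y r → f (h y) (map h r))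
Σsel-map h f []       = refl
Σsel-map h f (x ∷ xs) = cong (f (h x) (map h xs) +_) (Σsel-map h (λ y r → f y (h x ∷ r)) xs)

-- A term survives only if every row of ν receives a part of λ at least as long. Since |λ| ≤ |ν|,
-- all these inequalities are then equalities and, parts being positive, none is left over, so λ is
-- a rearrangement of ν.
falling-S-vanish : ∀ ν λ′ → All (ℕ._> 0) λ′ → sum λ′ ℕ.≤ sum ν → ¬ (ν ↭ λ′) → S falling ν (map ℕ→ℚ λ′) ≡ 0ℚ
falling-S-vanish []      []       _ _ ≁ = ⊥-elim (≁ ↭-refl)
falling-S-vanish []      (zero ∷ λ′) (() ∷ _)
falling-S-vanish (a ∷ ν) λ′ pos le ≁ = trans (Σsel-map ℕ→ℚ (λ y r → falling y a * ratios y r * S falling ν r) λ′) (Σsel-zero λ′ termwise)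
  where
  termwise : ∀ y r → y ∷ r ↭ λ′ → falling (ℕ→ℚ y) a * ratios (ℕ→ℚ y) (map ℕ→ℚ r) * S falling ν (map ℕ→ℚ r) ≡ 0ℚ
  termwise y r p with y ℕₚ.<? a
  ... | yes y<a = trans (cong (λ q → q * ratios (ℕ→ℚ y) (map ℕ→ℚ r) * S falling ν (map ℕ→ℚ r)) (falling-vanish y<a))
                        (lemma (ratios (ℕ→ℚ y) (map ℕ→ℚ r)) (S falling ν (map ℕ→ℚ r)))
    where
    lemma : ∀ p q → 0ℚ * p * q ≡ 0ℚ
    lemma = solve-∀ ℚ-ring
  ... | no y≮a = trans (cong (falling (ℕ→ℚ y) a * ratios (ℕ→ℚ y) (map ℕ→ℚ r) *_)
                          (falling-S-vanish ν r (All.tail (Permₚ.All-resp-↭ (↭-sym p) pos)) le-r ≁-r))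
                       (ℚₚ.*-zeroʳ (falling (ℕ→ℚ y) a * ratios (ℕ→ℚ y) (map ℕ→ℚ r)))
    where
    a≤y : a ℕ.≤ y
    a≤y = ℕₚ.≮⇒≥ y≮a
    le′ : y ℕ.+ sum r ℕ.≤ a ℕ.+ sum ν
    le′ = subst (ℕ._≤ a ℕ.+ sum ν) (sym (sum-↭ p)) le
    le-r : sum r ℕ.≤ sum ν
    le-r = ℕₚ.+-cancelˡ-≤ a (sum r) (sum ν) (ℕₚ.≤-trans (ℕₚ.+-monoˡ-≤ (sum r) a≤y) le′)
    ≁-r : ¬ (ν ↭ r)
    ≁-r q = ≁ (↭-trans (subst (λ k → a ∷ ν ↭ k ∷ r) a≡y (Perm.prep a q)) p)
      where
      a≡y : a ≡ y
      a≡y = ℕₚ.≤-antisym a≤y (ℕₚ.+-cancelʳ-≤ (sum ν) y a (subst (λ k → y ℕ.+ k ℕ.≤ a ℕ.+ sum ν) (sym (sum-↭ q)) le′))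

-- Commutation of box addition and box removal

dnHead : ℕ → List ℕ → (List ℕ → ℚ) → ℚ
dnHead a []      f = f (dropZeros (a ∸ 1 ∷ []))
dnHead a (c ∷ ν) f = gate (suc c <ᵇ a) (f (a ∸ 1 ∷ c ∷ ν))

-- Box removal as a recursion on rows, which suits the commutation with `up`; `Σ-down` identifies it
-- with the filtered enumeration `down`.
dn : List ℕ → (List ℕ → ℚ) → ℚ
dn []      f = 0ℚ
dn (a ∷ ν) f = dnHead a ν f + dn ν (f ∘ (a ∷_))

dn-cong : ∀ ν {f g} → (∀ κ → f κ ≡ g κ) → dn ν f ≡ dn ν g
dn-cong []          e = refl
dn-cong (a ∷ [])    e = cong (_+ 0ℚ) (e _)
dn-cong (a ∷ c ∷ ν) e = cong₂ _+_ (cong (gate (suc c <ᵇ a)) (e _)) (dn-cong (c ∷ ν) (λ κ → e (a ∷ κ)))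

dn-+ : ∀ ν f g → dn ν (λ κ → f κ + g κ) ≡ dn ν f + dn ν g
dn-+ []      f g = refl
dn-+ (a ∷ ν) f g = trans (cong₂ _+_ (head ν) (dn-+ ν (f ∘ (a ∷_)) (g ∘ (a ∷_))))
  (+-interchange (dnHead a ν f) (dnHead a ν g) (dn ν (f ∘ (a ∷_))) (dn ν (g ∘ (a ∷_))))
  where
  head : ∀ ν → dnHead a ν (λ κ → f κ + g κ) ≡ dnHead a ν f + dnHead a ν g
  head []      = refl
  head (c ∷ ν) = gate-+ (suc c <ᵇ a) _ _

dn-*ˡ : ∀ ν c f → dn ν (λ κ → c * f κ) ≡ c * dn ν f
dn-*ˡ []      c f = sym (ℚₚ.*-zeroʳ c)
dn-*ˡ (a ∷ ν) c f = trans (cong₂ _+_ (head ν) (dn-*ˡ ν c (f ∘ (a ∷_)))) (sym (ℚₚ.*-distribˡ-+ c (dnHead a ν f) (dn ν (f ∘ (a ∷_)))))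
  where
  head : ∀ ν → dnHead a ν (λ κ → c * f κ) ≡ c * dnHead a ν f
  head []      = refl
  head (d ∷ ν) = gate-*ˡ (suc d <ᵇ a) c _

dn-zero : ∀ ν → dn ν (λ _ → 0ℚ) ≡ 0ℚ
dn-zero ν = trans (dn-*ˡ ν 0ℚ (λ _ → 0ℚ)) (ℚₚ.*-zeroˡ (dn ν (λ _ → 0ℚ)))

dn-Σ : ∀ {A : Set} ν (xs : List A) (f : List ℕ → A → ℚ) → dn ν (λ κ → Σℚ xs (f κ)) ≡ Σℚ xs (λ x → dn ν (λ κ → f κ x))
dn-Σ ν []       f = dn-zero ν
dn-Σ ν (x ∷ xs) f = trans (dn-+ ν (λ κ → f κ x) (λ κ → Σℚ xs (f κ))) (cong (dn ν (λ κ → f κ x) +_) (dn-Σ ν xs f))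

fits-pred : ∀ b a → T (fits _<ᵇ_ b (suc a)) → T (fits _<ᵇ_ b a)
fits-pred nothing  a h = tt
fits-pred (just b) a h = ℕₚ.<⇒<ᵇ (ℕₚ.<-trans (ℕₚ.n<1+n a) (ℕₚ.<ᵇ⇒< (suc a) b h))

fits-1 : ∀ b a → T (fits _<ᵇ_ b (suc a)) → T (fits _<ᵇ_ b 1)
fits-1 b zero    h = h
fits-1 b (suc a) h = fits-1 b a (fits-pred b (suc a) h)

Strict-suc : ∀ {b ν} → Strict (just b) ν → Strict (just (suc b)) ν
Strict-suc []                         = []
Strict-suc {b} (cons {a = a} h strict) = cons (fits-pred (just (suc b)) (suc a) h) strict

gate-T : ∀ {t} → T t → ∀ q → gate t q ≡ q
gate-T {true} _ q = refl

gate-cong : ∀ t {p q} → (T t → p ≡ q) → gate t p ≡ gate t q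
gate-cong true  e = e tt
gate-cong false e = refl

up-cong-Strict : ∀ w {b ν f g} → Strict b ν → (∀ {κ} → Strict b κ → sum κ ≡ suc (sum ν) → f κ ≡ g κ) →
  up< w b ν f ≡ up< w b ν g
up-cong-Strict w {b} []                e = gate-cong (fits _<ᵇ_ b 1) (λ h → e (cons h []) refl)
up-cong-Strict w {b} (cons {a = a} {ν} h strict) e = cong₂ (λ p q → w * p + q)
  (gate-cong (fits _<ᵇ_ b (suc (suc a))) (λ h′ → e (cons h′ (Strict-suc strict)) refl))
  (up-cong-Strict w strict (λ {κ} strict′ eq → e (cons h strict′)
     (cong suc (trans (cong (a ℕ.+_) eq) (ℕₚ.+-suc a (sum ν))))))

dn-cong-Strict : ∀ {b ν f g} → Strict b ν → (∀ {κ} → Strict b κ → suc (sum κ) ≡ sum ν → f κ ≡ g κ) → dn ν f ≡ dn ν g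
dn-cong-Strict []                                        e = refl
dn-cong-Strict {b} (cons {a = zero}  {[]} h strict)      e = cong (_+ 0ℚ) (e [] refl)
dn-cong-Strict {b} (cons {a = suc a} {[]} h strict)      e = cong (_+ 0ℚ) (e (cons (fits-pred b (suc a) h) []) refl)
dn-cong-Strict {b} (cons {a = zero}  {suc c ∷ ν} h (cons () _)) e
dn-cong-Strict {b} (cons {a = suc a} {suc c ∷ ν} h strict@(cons _ strict′)) e = cong₂ _+_
  (gate-cong (suc c <ᵇ suc a) (λ h′ → e (cons (fits-pred b (suc a) h) (cons h′ strict′)) refl))
  (dn-cong-Strict strict (λ {κ} strict″ eq → e (cons h strict″)
    (cong suc (trans (sym (ℕₚ.+-suc (suc a) (sum κ))) (cong (suc a ℕ.+_) eq)))))

-- Growing and then shrinking the first row contributes 2. A bound that forbids the growth removes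
-- this contribution and turns the commutator from +1 into -1.
sgn : Maybe ℕ → List ℕ → ℚ → ℚ
sgn b []      q = gate (fits _<ᵇ_ b 1) q
sgn b (a ∷ _) q = if fits _<ᵇ_ b (suc a) then q else - q

-- Reading s and t as 0 or 1, the signs are 2s - 1 and 2t - 1, and the coefficients of `F` agree
-- because 2s + (2t - 1) = 2t + (2s - 1).
sign-cases : ∀ s t F Y Z V → 2ℚ * gate s (F + Y) + (gate t Z + (V + (if t then F else - F)))
                             ≡ gate t (2ℚ * F + Z) + (2ℚ * gate s Y + V) + (if s then F else - F)
sign-cases true true = lemma
  where
  lemma : ∀ F Y Z V → 2ℚ * (F + Y) + (Z + (V + F)) ≡ 2ℚ * F + Z + (2ℚ * Y + V) + F
  lemma = solve-∀ ℚ-ring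
sign-cases true false F Y Z V = lemma F Y V
  where
  lemma : ∀ F Y V → 2ℚ * (F + Y) + (0ℚ + (V + - F)) ≡ 0ℚ + (2ℚ * Y + V) + F
  lemma = solve-∀ ℚ-ring
sign-cases false true F Y Z V = lemma F Z V
  where
  lemma : ∀ F Z V → 2ℚ * 0ℚ + (Z + (V + F)) ≡ 2ℚ * F + Z + (2ℚ * 0ℚ + V) + - F
  lemma = solve-∀ ℚ-ring
sign-cases false false F Y Z V = lemma F V
  where
  lemma : ∀ F V → 2ℚ * 0ℚ + (0ℚ + (V + - F)) ≡ 0ℚ + (2ℚ * 0ℚ + V) + - F
  lemma = solve-∀ ℚ-ring

-- The commutation relation of the oscillator algebra.  Under the row bound b the relation
-- acquires the sign sgn, which is what makes the induction on rows close.
up-dn-bounded : ∀ {b ν} f → Strict b ν → up< 2ℚ b ν (λ κ → dn κ f) ≡ dn ν (λ κ → up< 2ℚ b κ f) + sgn b ν (f ν)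
up-dn-bounded {b} f [] = trans (cong (gate (fits _<ᵇ_ b 1)) (ℚₚ.+-identityʳ (f []))) (sym (ℚₚ.+-identityˡ _))
up-dn-bounded {b} f (cons {a = zero} {[]} h strict)
  rewrite gate-T h (f (1 ∷ [])) with fits _<ᵇ_ b 2
... | true  = lemma (f (1 ∷ []))
  where
  lemma : ∀ p → 2ℚ * (p + 0ℚ) + 0ℚ ≡ p + 0ℚ + p
  lemma = solve-∀ ℚ-ring
... | false = lemma (f (1 ∷ []))
  where
  lemma : ∀ p → 2ℚ * 0ℚ + 0ℚ ≡ p + 0ℚ + - p
  lemma = solve-∀ ℚ-ring
up-dn-bounded {b} f (cons {a = suc a} {[]} h strict)
  rewrite gate-T h (f (suc (suc a) ∷ [])) with fits _<ᵇ_ b (suc (suc (suc a)))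
... | true  = lemma (f (suc (suc a) ∷ [])) (gate (1 <ᵇ suc a) (f (suc a ∷ 1 ∷ [])))
  where
  lemma : ∀ p q → 2ℚ * (p + 0ℚ) + (q + (p + 0ℚ)) ≡ 2ℚ * p + q + 0ℚ + p
  lemma = solve-∀ ℚ-ring
... | false = lemma (f (suc (suc a) ∷ [])) (gate (1 <ᵇ suc a) (f (suc a ∷ 1 ∷ [])))
  where
  lemma : ∀ p q → 2ℚ * 0ℚ + (q + (p + 0ℚ)) ≡ 2ℚ * p + q + 0ℚ + - p
  lemma = solve-∀ ℚ-ring
up-dn-bounded {b} f (cons {a = zero} {suc c ∷ ν} h (cons () _))
up-dn-bounded {b} f (cons {a = suc a} {suc c ∷ ν} h strict@(cons c<a strict′)) = begin
  2ℚ * gate above (gate (suc c <ᵇ suc (suc a)) (f (suc (suc a) ∷ suc c ∷ ν)) + dn (suc c ∷ ν) (f ∘ (suc (suc (suc a)) ∷_)))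
    + up< 2ℚ (just (suc (suc a))) (suc c ∷ ν) (λ κ → dnHead (suc (suc a)) κ f + dn κ (f ∘ (suc (suc a) ∷_)))
      ≡⟨ cong₂ (λ p q → 2ℚ * gate above (p + dn (suc c ∷ ν) (f ∘ (suc (suc (suc a)) ∷_))) + q) (gate-T c<a (f (suc (suc a) ∷ suc c ∷ ν)))
           (trans (up-+ _<ᵇ_ 2ℚ (just (suc (suc a))) (suc c ∷ ν) (λ κ → dnHead (suc (suc a)) κ f) (λ κ → dn κ (f ∘ (suc (suc a) ∷_))))
                  (cong (up< 2ℚ (just (suc (suc a))) (suc c ∷ ν) (λ κ → dnHead (suc (suc a)) κ f) +_)
                        (up-dn-bounded (f ∘ (suc (suc a) ∷_)) strict))) ⟩
  2ℚ * gate above (F + Y) + (up< 2ℚ (just (suc (suc a))) (suc c ∷ ν) (λ κ → dnHead (suc (suc a)) κ f)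
    + (dn (suc c ∷ ν) (λ κ → up< 2ℚ (just (suc (suc a))) κ (f ∘ (suc (suc a) ∷_))) + (if gap then F else - F)))
      ≡⟨ cong (λ q → 2ℚ * gate above (F + Y) + (q + (V + (if gap then F else - F)))) gated ⟩
  2ℚ * gate above (F + Y) + (gate gap Z + (V + (if gap then F else - F)))
      ≡⟨ sign-cases above gap F Y Z V ⟩
  gate gap (2ℚ * F + Z) + (2ℚ * gate above Y + V) + (if above then F else - F)
      ≡⟨ cong (λ q → gate gap (2ℚ * q + Z) + (2ℚ * gate above Y + V) + (if above then F else - F)) (gate-T h F) ⟨
  gate gap (up< 2ℚ b (suc a ∷ suc c ∷ ν) f) + (2ℚ * gate above Y + V) + (if above then F else - F)
      ≡⟨ cong (λ q → gate gap (up< 2ℚ b (suc a ∷ suc c ∷ ν) f) + q + (if above then F else - F)) (sym split) ⟩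
  gate gap (up< 2ℚ b (suc a ∷ suc c ∷ ν) f)
    + dn (suc c ∷ ν) (λ κ → up< 2ℚ b (suc (suc a) ∷ κ) f) + (if above then F else - F) ∎
  where
  open ≡-Reasoning
  above = fits _<ᵇ_ b (suc (suc (suc a)))
  gap = suc (suc c) <ᵇ suc (suc a)
  F = f (suc (suc a) ∷ suc c ∷ ν)
  Y = dn (suc c ∷ ν) (f ∘ (suc (suc (suc a)) ∷_))
  V = dn (suc c ∷ ν) (λ κ → up< 2ℚ (just (suc (suc a))) κ (f ∘ (suc (suc a) ∷_)))
  gate-dn : ∀ t → dn (suc c ∷ ν) (λ κ → 2ℚ * gate t (f (suc (suc (suc a)) ∷ κ))) ≡ 2ℚ * gate t Y
  gate-dn true  = dn-*ˡ (suc c ∷ ν) 2ℚ (λ κ → f (suc (suc (suc a)) ∷ κ))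
  gate-dn false = trans (dn-zero (suc c ∷ ν)) refl
  split : dn (suc c ∷ ν) (λ κ → up< 2ℚ b (suc (suc a) ∷ κ) f) ≡ 2ℚ * gate above Y + V
  split = trans (dn-+ (suc c ∷ ν) (λ κ → 2ℚ * gate above (f (suc (suc (suc a)) ∷ κ))) (λ κ → up< 2ℚ (just (suc (suc a))) κ (f ∘ (suc (suc a) ∷_))))
                (cong (_+ V) (gate-dn above))
  Z = up< 2ℚ (just (suc a)) (suc c ∷ ν) (f ∘ (suc a ∷_))
  -- If the first two rows differ by one, the second cannot grow and the first cannot shrink, so
  -- everything vanishes. Otherwise shrinking the first row merely lowers the bound on the second.
  gated : up< 2ℚ (just (suc (suc a))) (suc c ∷ ν) (λ κ → dnHead (suc (suc a)) κ f) ≡ gate gap Z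
  gated with suc (suc c) <ᵇ suc (suc a)
  ... | true  = refl
  ... | false = trans (cong (2ℚ * 0ℚ +_) (up-zero _<ᵇ_ 2ℚ (just (suc c)) ν)) refl

up-dn : ∀ {ν} f → Strict nothing ν → up< 2ℚ nothing ν (λ κ → dn κ f) ≡ dn ν (λ κ → up< 2ℚ nothing κ f) + f ν
up-dn f []             = up-dn-bounded {nothing} f []
up-dn f s@(cons _ _) = up-dn-bounded f s

-- Iterated additions and removals

dn^ : ℕ → (List ℕ → ℚ) → List ℕ → ℚ
dn^ zero    f ν = f ν
dn^ (suc k) f ν = dn ν (dn^ k f)

up^ : ℚ → ℕ → (List ℕ → ℚ) → List ℕ → ℚ
up^ w zero    f ν = f ν
up^ w (suc n) f ν = up^ w n (λ κ → up< w nothing κ f) ν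

up^-cong : ∀ w n {ν f g} → Strict nothing ν → (∀ {κ} → Strict nothing κ → sum κ ≡ n ℕ.+ sum ν → f κ ≡ g κ) →
  up^ w n f ν ≡ up^ w n g ν
up^-cong w zero    strict e = e strict refl
up^-cong w (suc n) strict e = up^-cong w n strict (λ strict′ eq →
  up-cong-Strict w strict′ (λ strict″ eq′ → e strict″ (trans eq′ (cong suc eq))))

up^-*ˡ : ∀ w n {ν} → Strict nothing ν → ∀ c f → up^ w n (λ κ → c * f κ) ν ≡ c * up^ w n f ν
up^-*ˡ w zero    strict c f = refl
up^-*ˡ w (suc n) strict c f = trans
  (up^-cong w n strict (λ {κ} _ _ → up-*ˡ _<ᵇ_ w nothing κ c f))
  (up^-*ˡ w n strict c (λ κ → up< w nothing κ f))

-- Enlarging a row gives 2 · 2^ℓ and starting a row gives 1 · 2^(ℓ+1), so the weights become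
-- uniform.
up-2^length : ∀ b ν f → up< 2ℚ b ν (λ κ → 2ℚ ^′ length κ * f κ) ≡ 2ℚ ^′ suc (length ν) * up< 1ℚ b ν f
up-2^length b []      f = gate-*ˡ (fits _<ᵇ_ b 1) (2ℚ * 1ℚ) (f (1 ∷ []))
up-2^length b (a ∷ ν) f = begin
  2ℚ * gate t (2ℚ ^′ suc (length ν) * f (suc a ∷ ν)) + up< 2ℚ (just a) ν (λ κ → 2ℚ * 2ℚ ^′ length κ * f (a ∷ κ))
    ≡⟨ cong₂ (λ p q → 2ℚ * p + q) (gate-*ˡ t (2ℚ ^′ suc (length ν)) (f (suc a ∷ ν)))
         (trans (up-cong _<ᵇ_ 2ℚ (just a) ν (λ κ → ℚₚ.*-assoc 2ℚ (2ℚ ^′ length κ) (f (a ∷ κ))))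
                (trans (up-*ˡ _<ᵇ_ 2ℚ (just a) ν 2ℚ (λ κ → 2ℚ ^′ length κ * f (a ∷ κ)))
                       (cong (2ℚ *_) (up-2^length (just a) ν (f ∘ (a ∷_)))))) ⟩
  2ℚ * (2ℚ ^′ suc (length ν) * gate t (f (suc a ∷ ν))) + 2ℚ * (2ℚ ^′ suc (length ν) * up< 1ℚ (just a) ν (f ∘ (a ∷_)))
    ≡⟨ lemma (2ℚ ^′ suc (length ν)) (gate t (f (suc a ∷ ν))) (up< 1ℚ (just a) ν (f ∘ (a ∷_))) ⟩
  2ℚ * 2ℚ ^′ suc (length ν) * (1ℚ * gate t (f (suc a ∷ ν)) + up< 1ℚ (just a) ν (f ∘ (a ∷_))) ∎
  where
  open ≡-Reasoning
  t = fits _<ᵇ_ b (suc a)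
  lemma : ∀ p q r → 2ℚ * (p * q) + 2ℚ * (p * r) ≡ 2ℚ * p * (1ℚ * q + r)
  lemma = solve-∀ ℚ-ring

^′≢0 : ∀ {x} → x ≢ 0ℚ → ∀ n → x ^′ n ≢ 0ℚ
^′≢0 x≢0 zero    = ℚₚ.1≢0
^′≢0 x≢0 (suc n) = *≢0 x≢0 (^′≢0 x≢0 n)

2ℚ≢0 : 2ℚ ≢ 0ℚ
2ℚ≢0 ()

up^-2^length : ∀ n {ν} → Strict nothing ν → ∀ f →
  up^ 2ℚ n (λ κ → 2ℚ ^′ length κ * f κ) ν ≡ 2ℚ ^′ (n ℕ.+ length ν) * up^ 1ℚ n f ν
up^-2^length zero    strict f = refl
up^-2^length (suc n) {ν} strict f = begin
  up^ 2ℚ n (λ κ → up< 2ℚ nothing κ (λ κ → 2ℚ ^′ length κ * f κ)) ν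
    ≡⟨ up^-cong 2ℚ n strict (λ {κ} _ _ → trans (up-2^length nothing κ f) (ℚₚ.*-assoc 2ℚ (2ℚ ^′ length κ) (up< 1ℚ nothing κ f))) ⟩
  up^ 2ℚ n (λ κ → 2ℚ * (2ℚ ^′ length κ * up< 1ℚ nothing κ f)) ν
    ≡⟨ up^-*ˡ 2ℚ n strict 2ℚ (λ κ → 2ℚ ^′ length κ * up< 1ℚ nothing κ f) ⟩
  2ℚ * up^ 2ℚ n (λ κ → 2ℚ ^′ length κ * up< 1ℚ nothing κ f) ν
    ≡⟨ cong (2ℚ *_) (up^-2^length n strict (λ κ → up< 1ℚ nothing κ f)) ⟩
  2ℚ * (2ℚ ^′ (n ℕ.+ length ν) * up^ 1ℚ (suc n) f ν)
    ≡⟨ ℚₚ.*-assoc 2ℚ (2ℚ ^′ (n ℕ.+ length ν)) (up^ 1ℚ (suc n) f ν) ⟨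
  2ℚ * 2ℚ ^′ (n ℕ.+ length ν) * up^ 1ℚ (suc n) f ν ∎
  where open ≡-Reasoning

-- Vacuum vectors of the oscillator algebra, with addition as annihilation and removal as creation
-- operator.
Harmonic : (List ℕ → ℚ) → Set
Harmonic f = ∀ {ν} → Strict nothing ν → up< 2ℚ nothing ν f ≡ 0ℚ

module _ {f : List ℕ → ℚ} (harmonic : Harmonic f) where

  up-dn^ : ∀ j {ν} → Strict nothing ν → up< 2ℚ nothing ν (dn^ (suc j) f) ≡ ℕ→ℚ (suc j) * dn^ j f ν
  up-dn^ zero {ν} strict = begin
    up< 2ℚ nothing ν (dn^ 1 f)                         ≡⟨ up-dn f strict ⟩
    dn ν (λ κ → up< 2ℚ nothing κ f) + f ν              ≡⟨ cong (_+ f ν) (trans (dn-cong-Strict strict (λ strict′ _ → harmonic strict′)) (dn-zero ν)) ⟩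
    0ℚ + f ν                                           ≡⟨ lemma (f ν) ⟩
    1ℚ * f ν                                           ∎
    where
    open ≡-Reasoning
    lemma : ∀ p → 0ℚ + p ≡ 1ℚ * p
    lemma = solve-∀ ℚ-ring
  up-dn^ (suc j) {ν} strict = begin
    up< 2ℚ nothing ν (dn^ (suc (suc j)) f)
      ≡⟨ up-dn (dn^ (suc j) f) strict ⟩
    dn ν (λ κ → up< 2ℚ nothing κ (dn^ (suc j) f)) + dn^ (suc j) f ν
      ≡⟨ cong (_+ dn^ (suc j) f ν) (dn-cong-Strict strict (λ strict′ _ → up-dn^ j strict′)) ⟩
    dn ν (λ κ → ℕ→ℚ (suc j) * dn^ j f κ) + dn^ (suc j) f ν
      ≡⟨ cong (_+ dn^ (suc j) f ν) (dn-*ˡ ν (ℕ→ℚ (suc j)) (dn^ j f)) ⟩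
    ℕ→ℚ (suc j) * dn^ (suc j) f ν + dn^ (suc j) f ν
      ≡⟨ lemma (ℕ→ℚ (suc j)) (dn^ (suc j) f ν) ⟩
    (1ℚ + ℕ→ℚ (suc j)) * dn^ (suc j) f ν
      ≡⟨ cong (_* dn^ (suc j) f ν) (ℕ→ℚ-suc (suc j)) ⟨
    ℕ→ℚ (suc (suc j)) * dn^ (suc j) f ν ∎
    where
    open ≡-Reasoning
    lemma : ∀ n p → n * p + p ≡ (1ℚ + n) * p
    lemma = solve-∀ ℚ-ring

  up^-dn^ : ∀ n i {ν} → Strict nothing ν → up^ 2ℚ n (dn^ (n ℕ.+ i) f) ν * ℕ→ℚ (i !) ≡ ℕ→ℚ ((n ℕ.+ i) !) * dn^ i f ν
  up^-dn^ zero    i {ν} strict = ℚₚ.*-comm (dn^ i f ν) (ℕ→ℚ (i !))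
  up^-dn^ (suc n) i {ν} strict = begin
    up^ 2ℚ n (λ κ → up< 2ℚ nothing κ (dn^ (suc (n ℕ.+ i)) f)) ν * ℕ→ℚ (i !)
      ≡⟨ cong (_* ℕ→ℚ (i !)) (trans (up^-cong 2ℚ n strict (λ strict′ _ → up-dn^ (n ℕ.+ i) strict′))
                                     (up^-*ˡ 2ℚ n strict (ℕ→ℚ (suc (n ℕ.+ i))) (dn^ (n ℕ.+ i) f))) ⟩
    ℕ→ℚ (suc (n ℕ.+ i)) * up^ 2ℚ n (dn^ (n ℕ.+ i) f) ν * ℕ→ℚ (i !)
      ≡⟨ ℚₚ.*-assoc (ℕ→ℚ (suc (n ℕ.+ i))) (up^ 2ℚ n (dn^ (n ℕ.+ i) f) ν) (ℕ→ℚ (i !)) ⟩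
    ℕ→ℚ (suc (n ℕ.+ i)) * (up^ 2ℚ n (dn^ (n ℕ.+ i) f) ν * ℕ→ℚ (i !))
      ≡⟨ cong (ℕ→ℚ (suc (n ℕ.+ i)) *_) (up^-dn^ n i strict) ⟩
    ℕ→ℚ (suc (n ℕ.+ i)) * (ℕ→ℚ ((n ℕ.+ i) !) * dn^ i f ν)
      ≡⟨ ℚₚ.*-assoc (ℕ→ℚ (suc (n ℕ.+ i))) (ℕ→ℚ ((n ℕ.+ i) !)) (dn^ i f ν) ⟨
    ℕ→ℚ (suc (n ℕ.+ i)) * ℕ→ℚ ((n ℕ.+ i) !) * dn^ i f ν
      ≡⟨ cong (_* dn^ i f ν) (ℕ→ℚ-* (suc (n ℕ.+ i)) ((n ℕ.+ i) !)) ⟨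
    ℕ→ℚ (suc (n ℕ.+ i) !) * dn^ i f ν ∎
    where open ≡-Reasoning

  -- The first j additions undo the j removals up to a scalar; the next one meets `f` itself and
  -- annihilates it.
  up^-dn^-vanish : ∀ j i {ν} → Strict nothing ν → up^ 2ℚ (j ℕ.+ suc i) (dn^ j f) ν ≡ 0ℚ
  up^-dn^-vanish zero i {ν} strict = begin
    up^ 2ℚ i (λ κ → up< 2ℚ nothing κ f) ν   ≡⟨ up^-cong 2ℚ i strict (λ {κ} strict′ _ → trans (harmonic strict′) (sym (ℚₚ.*-zeroˡ 0ℚ))) ⟩
    up^ 2ℚ i (λ κ → 0ℚ * 0ℚ) ν              ≡⟨ up^-*ˡ 2ℚ i strict 0ℚ (λ _ → 0ℚ) ⟩
    0ℚ * up^ 2ℚ i (λ κ → 0ℚ) ν              ≡⟨ ℚₚ.*-zeroˡ (up^ 2ℚ i (λ κ → 0ℚ) ν) ⟩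
    0ℚ                                       ∎
    where open ≡-Reasoning
  up^-dn^-vanish (suc j) i {ν} strict = begin
    up^ 2ℚ (j ℕ.+ suc i) (λ κ → up< 2ℚ nothing κ (dn^ (suc j) f)) ν
      ≡⟨ up^-cong 2ℚ (j ℕ.+ suc i) strict (λ strict′ _ → up-dn^ j strict′) ⟩
    up^ 2ℚ (j ℕ.+ suc i) (λ κ → ℕ→ℚ (suc j) * dn^ j f κ) ν
      ≡⟨ up^-*ˡ 2ℚ (j ℕ.+ suc i) strict (ℕ→ℚ (suc j)) (dn^ j f) ⟩
    ℕ→ℚ (suc j) * up^ 2ℚ (j ℕ.+ suc i) (dn^ j f) ν
      ≡⟨ cong (ℕ→ℚ (suc j) *_) (up^-dn^-vanish j i strict) ⟩
    ℕ→ℚ (suc j) * 0ℚ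
      ≡⟨ ℚₚ.*-zeroʳ (ℕ→ℚ (suc j)) ⟩
    0ℚ ∎
    where open ≡-Reasoning

-- Enumeration of partitions

∧-T : ∀ {s t} → T s → T t → T (s ∧ t)
∧-T {true} _ h = h

T-∧ˡ : ∀ s {t} → T (s ∧ t) → T s
T-∧ˡ true _ = tt

T-∧ʳ : ∀ s {t} → T (s ∧ t) → T t
T-∧ʳ true h = h

gate-zero : ∀ t → gate t 0ℚ ≡ 0ℚ
gate-zero true  = refl
gate-zero false = refl

δ : List ℕ → List ℕ → ℚ
δ x y = gate (eqListB x y) 1ℚ

δ-∷-≡ : ∀ a x y → δ (a ∷ x) (a ∷ y) ≡ δ x y
δ-∷-≡ zero    x y = refl
δ-∷-≡ (suc a) x y = δ-∷-≡ a x y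

δ-∷-≢ : ∀ {a b} → a ≢ b → ∀ x y → δ (a ∷ x) (b ∷ y) ≡ 0ℚ
δ-∷-≢ {a} {b} a≢b x y with a ≡ᵇ b in eq
... | true  = ⊥-elim (a≢b (ℕₚ.≡ᵇ⇒≡ a b (subst T (sym eq) tt)))
... | false = refl

δ-refl : ∀ x → δ x x ≡ 1ℚ
δ-refl []      = refl
δ-refl (a ∷ x) = trans (δ-∷-≡ a x x) (δ-refl x)

δ-sym : ∀ x y → δ x y ≡ δ y x
δ-sym []      []      = refl
δ-sym []      (b ∷ y) = refl
δ-sym (a ∷ x) []      = refl
δ-sym (a ∷ x) (b ∷ y) with a ℕₚ.≟ b
... | yes refl = trans (δ-∷-≡ a x y) (trans (δ-sym x y) (sym (δ-∷-≡ a y x)))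
... | no a≢b   = trans (δ-∷-≢ a≢b x y) (sym (δ-∷-≢ (a≢b ∘ sym) y x))

δ-≢ : ∀ {x y} → x ≢ y → δ x y ≡ 0ℚ
δ-≢ {[]}    {[]}    x≢y = ⊥-elim (x≢y refl)
δ-≢ {[]}    {b ∷ y} x≢y = refl
δ-≢ {a ∷ x} {[]}    x≢y = refl
δ-≢ {a ∷ x} {b ∷ y} x≢y with a ℕₚ.≟ b
... | yes refl = trans (δ-∷-≡ a x y) (δ-≢ (x≢y ∘ cong (a ∷_)))
... | no a≢b   = δ-∷-≢ a≢b x y

dnHead-δ-≢ : ∀ a e ν κ → a ≢ suc e → dnHead (suc a) ν (δ (suc e ∷ κ)) ≡ 0ℚ
dnHead-δ-≢ zero    e []      κ _  = refl
dnHead-δ-≢ (suc a) e []      κ ne = δ-∷-≢ (ne ∘ sym) κ []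
dnHead-δ-≢ a       e (c ∷ ν) κ ne = trans (cong (gate (suc c <ᵇ suc a)) (δ-∷-≢ (ne ∘ sym) κ (c ∷ ν))) (gate-zero (suc c <ᵇ suc a))

up-δ-[] : ∀ b ν → up< 1ℚ b ν (δ []) ≡ 0ℚ
up-δ-[] b []      = gate-zero (fits _<ᵇ_ b 1)
up-δ-[] b (a ∷ ν) = cong₂ (λ p q → 1ℚ * p + q) (gate-zero (fits _<ᵇ_ b (suc a))) (up-zero _<ᵇ_ 1ℚ (just a) ν)

-- Removal and weight-one addition have transposed matrices. Compare the first rows: if they are
-- equal, the box lies in the tails; if that of ν is longer by one, the tails must coincide;
-- otherwise both entries are 0.
dn-up-δ : ∀ {b ν κ} → Strict b ν → Strict b κ → dn ν (δ κ) ≡ up< 1ℚ b κ (δ ν)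
dn-up-δ {b} {κ = κ} [] _ = sym (up-δ-[] b κ)
dn-up-δ {b} (cons {a = zero}  {[]} h strict) [] = sym (gate-T h 1ℚ)
dn-up-δ {b} (cons {a = suc a} {[]} h strict) [] = sym (gate-zero (fits _<ᵇ_ b 1))
dn-up-δ {b} (cons {a = zero}  {suc c ∷ ν} h (cons () _)) []
dn-up-δ {b} (cons {a = suc a} {suc c ∷ ν} h strict) [] = trans
  (cong₂ _+_ (gate-zero (c <ᵇ a)) (dn-zero (suc c ∷ ν)))
  (sym (gate-zero (fits _<ᵇ_ b 1)))
dn-up-δ {b} (cons {a = a} {ν} h strict) (cons {a = d} {κ} h′ strict′) with a ℕₚ.≟ d
... | yes refl = cong₂ _+_
        (trans (dnHead-δ-≢ a a ν κ (ℕₚ.1+n≢n ∘ sym))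
               (sym (trans (cong (1ℚ *_) (trans (cong (gate t) (δ-∷-≢ {suc a} {suc (suc a)} (ℕₚ.1+n≢n ∘ sym) ν κ)) (gate-zero t))) (ℚₚ.*-zeroʳ 1ℚ))))
        (trans (dn-cong ν (δ-∷-≡ a κ)) (trans (dn-up-δ strict strict′) (sym (up-cong _<ᵇ_ 1ℚ (just (suc a)) κ (δ-∷-≡ a ν)))))
  where
  t = fits _<ᵇ_ b (suc (suc a))
... | no a≢d = cong₂ _+_ head
        (trans (trans (dn-cong ν (λ η → δ-∷-≢ (a≢d ∘ sym ∘ ℕₚ.suc-injective) κ η)) (dn-zero ν))
               (sym (trans (up-cong _<ᵇ_ 1ℚ (just (suc d)) κ (λ η → δ-∷-≢ (a≢d ∘ ℕₚ.suc-injective) ν η)) (up-zero _<ᵇ_ 1ℚ (just (suc d)) κ))))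
  where
  t = fits _<ᵇ_ b (suc (suc d))
  -- The test that makes the removal legal is automatic when the tails coincide, because κ fits
  -- below the shortened row; when it fails, the tails differ and both sides are 0.
  below : ∀ c ν → Strict (just (suc d)) κ → gate (suc c <ᵇ suc (suc d)) (δ κ (c ∷ ν)) ≡ δ (c ∷ ν) κ
  below c ν strict″ with suc c <ᵇ suc (suc d) in eq | strict″
  ... | true  | _ = δ-sym κ (c ∷ ν)
  ... | false | [] = refl
  ... | false | cons {a = e} {κ′} e< _ = sym (δ-∷-≢ c≢e ν κ′)
    where
    c≢e : c ≢ suc e
    c≢e refl = subst T eq e<
  equal-heads : ∀ ν → dnHead (suc (suc d)) ν (δ (suc d ∷ κ)) ≡ δ ν κ
  equal-heads []      = trans (δ-∷-≡ d κ []) (δ-sym κ [])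
  equal-heads (c ∷ ν) = trans (cong (gate (c <ᵇ suc d)) (δ-∷-≡ d κ (c ∷ ν))) (below c ν strict′)
  head : dnHead (suc a) ν (δ (suc d ∷ κ)) ≡ 1ℚ * gate t (δ (suc a ∷ ν) (suc (suc d) ∷ κ))
  head with a ℕₚ.≟ suc d
  ... | yes refl = trans (equal-heads ν)
                     (sym (trans (ℚₚ.*-identityˡ _) (trans (gate-T h (δ (suc (suc d) ∷ ν) (suc (suc d) ∷ κ))) (δ-∷-≡ (suc (suc d)) ν κ))))
  ... | no a≢sd  = trans (dnHead-δ-≢ a d ν κ a≢sd)
                     (sym (trans (cong (1ℚ *_) (trans (cong (gate t) (δ-∷-≢ (a≢sd ∘ ℕₚ.suc-injective) ν κ)) (gate-zero t))) (ℚₚ.*-zeroʳ 1ℚ)))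

-- A part p satisfies ok and is followed by parts at most next p.
data Parts (ok : ℕ → Bool) (next : ℕ → ℕ) : ℕ → List ℕ → Set where
  []   : ∀ {b} → Parts ok next b []
  cons : ∀ {b a x} → T (ok (suc a)) → a ℕ.< b → Parts ok next (next (suc a)) x → Parts ok next b (suc a ∷ x)

-- Common treatment of `spF` and `opF`, which differ only in the admissible parts and in the bound
-- handed to the following parts.
module Enumeration (ok : ℕ → Bool) (next : ℕ → ℕ) (test : ℕ → ℕ → Bool) (E : ℕ → ℕ → ℕ → List (List ℕ))
  (E-zero : ∀ f b → E f 0 b ≡ [] ∷ [])
  (E-suc : ∀ f k b → E (suc f) (suc k) b ≡
     concatMap (λ p → if test k p then map (p ∷_) (E f (suc k ∸ p) (next p)) else []) (applyUpTo suc b))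
  (test⇒≤ : ∀ k p → T (test k p) → p ℕ.≤ suc k) (test⇒ok : ∀ k p → T (test k p) → T (ok p))
  (⇒test : ∀ k p → p ℕ.≤ suc k → T (ok p) → T (test k p)) where

  extend : ℕ → ℕ → ℕ → List (List ℕ)
  extend f k p = if test k p then map (p ∷_) (E f (suc k ∸ p) (next p)) else []

  E-All : ∀ f k b → k ℕ.≤ f → All (λ x → Parts ok next b x × sum x ≡ k) (E f k b)
  E-All f       zero    b _ rewrite E-zero f b = ([] , refl) ∷ []
  E-All (suc f) (suc k) b (s≤s k≤f) rewrite E-suc f k b = Allₚ.concat⁺ (Allₚ.map⁺ (Allₚ.applyUpTo⁺₁ suc b step))
    where
    step : ∀ {i} → i ℕ.< b → All (λ x → Parts ok next b x × sum x ≡ suc k) (extend f k (suc i))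
    step {i} i<b with test k (suc i) in eq
    ... | false = []
    ... | true  = Allₚ.map⁺ (All.map
      (λ { {x} (parts , e) → cons (test⇒ok k (suc i) t) i<b parts
                     , cong suc (trans (cong (i ℕ.+_) e) (ℕₚ.m+[n∸m]≡n (ℕₚ.≤-pred (test⇒≤ k (suc i) t)))) })
      (E-All f (k ∸ i) (next (suc i)) (ℕₚ.≤-trans (ℕₚ.m∸n≤m k i) k≤f)))
      where
      t = subst T (sym eq) tt

  Σ-applyUpTo-single : ∀ (h : ℕ → ℕ) (F : ℕ → ℚ) {a b} → a ℕ.< b → (∀ i → i ≢ a → F (h i) ≡ 0ℚ) →
    Σℚ (applyUpTo h b) F ≡ F (h a)
  Σ-applyUpTo-single h F {zero}  {suc b} _ vanish = trans
    (cong (F (h 0) +_) (Σ-zero-All (Allₚ.applyUpTo⁺₂ (h ∘ suc) b (λ i → vanish (suc i) (λ ())))))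
    (ℚₚ.+-identityʳ (F (h 0)))
  Σ-applyUpTo-single h F {suc a} {suc b} (s≤s a<b) vanish = trans
    (cong₂ _+_ (vanish 0 (λ ())) (Σ-applyUpTo-single (h ∘ suc) F a<b (λ i i≢a → vanish (suc i) (i≢a ∘ ℕₚ.suc-injective))))
    (ℚₚ.+-identityˡ (F (h (suc a))))

  -- The list contains each admissible `y` exactly once, expressed as the evaluation rule that sums
  -- over partitions need.
  E-δ : ∀ f b {y} → Parts ok next b y → sum y ℕ.≤ f → ∀ (G : List ℕ → ℚ) → Σℚ (E f (sum y) b) (λ x → δ y x * G x) ≡ G y
  E-δ f       b [] _ G rewrite E-zero f b = lemma (G [])
    where
    lemma : ∀ g → 1ℚ * g + 0ℚ ≡ g
    lemma = solve-∀ ℚ-ring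
  E-δ (suc f) b (cons {a = a} {y} ok-a a<b parts) (s≤s le) G rewrite E-suc f (a ℕ.+ sum y) b = begin
    Σℚ (concatMap (extend f k) (applyUpTo suc b)) (λ x → δ (suc a ∷ y) x * G x)
      ≡⟨ Σ-concatMap (λ x → δ (suc a ∷ y) x * G x) (extend f k) (applyUpTo suc b) ⟩
    Σℚ (applyUpTo suc b) (λ p → Σℚ (extend f k p) (λ x → δ (suc a ∷ y) x * G x))
      ≡⟨ Σ-applyUpTo-single suc (λ p → Σℚ (extend f k p) (λ x → δ (suc a ∷ y) x * G x)) a<b other ⟩
    Σℚ (extend f k (suc a)) (λ x → δ (suc a ∷ y) x * G x)
      ≡⟨ cong (λ xs → Σℚ xs (λ x → δ (suc a ∷ y) x * G x)) chosen ⟩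
    Σℚ (map (suc a ∷_) (E f (sum y) (next (suc a)))) (λ x → δ (suc a ∷ y) x * G x)
      ≡⟨ Σ-map (λ x → δ (suc a ∷ y) x * G x) (suc a ∷_) (E f (sum y) (next (suc a))) ⟩
    Σℚ (E f (sum y) (next (suc a))) (λ x → δ (suc a ∷ y) (suc a ∷ x) * G (suc a ∷ x))
      ≡⟨ Σ-cong (λ x → cong (_* G (suc a ∷ x)) (δ-∷-≡ a y x)) (E f (sum y) (next (suc a))) ⟩
    Σℚ (E f (sum y) (next (suc a))) (λ x → δ y x * G (suc a ∷ x))
      ≡⟨ E-δ f (next (suc a)) parts (ℕₚ.≤-trans (ℕₚ.m≤n+m (sum y) a) le) (λ x → G (suc a ∷ x)) ⟩
    G (suc a ∷ y) ∎
    where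
    open ≡-Reasoning
    k = a ℕ.+ sum y
    chosen : extend f k (suc a) ≡ map (suc a ∷_) (E f (sum y) (next (suc a)))
    chosen with test k (suc a) in eq
    ... | true  = cong (λ s → map (suc a ∷_) (E f s (next (suc a)))) (ℕₚ.m+n∸m≡n a (sum y))
    ... | false = ⊥-elim (subst T eq (⇒test k (suc a) (s≤s (ℕₚ.m≤m+n a (sum y))) ok-a))
    other : ∀ i → i ≢ a → Σℚ (extend f k (suc i)) (λ x → δ (suc a ∷ y) x * G x) ≡ 0ℚ
    other i i≢a with test k (suc i)
    ... | false = refl
    ... | true  = Σ-zero-All (Allₚ.map⁺ (All.universal
      (λ x → trans (cong (_* G (suc i ∷ x)) (δ-∷-≢ (i≢a ∘ sym ∘ ℕₚ.suc-injective) y x)) (ℚₚ.*-zeroˡ (G (suc i ∷ x))))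
      (E f (suc k ∸ suc i) (next (suc i)))))

StrictParts : ℕ → List ℕ → Set
StrictParts = Parts (λ _ → true) (_∸ 1)

OddParts : ℕ → List ℕ → Set
OddParts = Parts oddB id

spF-zero : ∀ f b → spF f 0 b ≡ [] ∷ []
spF-zero zero    b = refl
spF-zero (suc f) b = refl

opF-zero : ∀ f b → opF f 0 b ≡ [] ∷ []
opF-zero zero    b = refl
opF-zero (suc f) b = refl

module SPEnum = Enumeration (λ _ → true) (_∸ 1) (λ k p → p ≤ᵇ suc k) spF spF-zero (λ f k b → refl)
  (λ k p → ℕₚ.≤ᵇ⇒≤ p (suc k)) (λ _ _ _ → tt) (λ k p p≤ _ → ℕₚ.≤⇒≤ᵇ p≤)

module OPEnum = Enumeration oddB id (λ k p → (p ≤ᵇ suc k) ∧ oddB p) opF opF-zero (λ f k b → refl)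
  (λ k p h → ℕₚ.≤ᵇ⇒≤ p (suc k) (T-∧ˡ (p ≤ᵇ suc k) h)) (λ k p → T-∧ʳ (p ≤ᵇ suc k))
  (λ k p p≤ odd → ∧-T (ℕₚ.≤⇒≤ᵇ p≤) odd)

Parts⇒Strict : ∀ {b x} → StrictParts b x → Strict (just (suc b)) x
Parts⇒Strict []                  = []
Parts⇒Strict (cons _ a<b parts) = cons (ℕₚ.<⇒<ᵇ a<b) (Parts⇒Strict parts)

Strict⇒Parts : ∀ {b x} → Strict (just (suc b)) x → StrictParts b x
Strict⇒Parts []              = []
Strict⇒Parts (cons h strict) = cons tt (ℕₚ.<ᵇ⇒< _ _ h) (Strict⇒Parts strict)

Strict-forget : ∀ {b x} → Strict b x → Strict nothing x
Strict-forget []              = []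
Strict-forget (cons h strict) = cons tt strict

Strict⇒Parts-sum : ∀ {x} → Strict nothing x → StrictParts (sum x) x
Strict⇒Parts-sum []                          = []
Strict⇒Parts-sum (cons {a = a} {x} _ strict) = cons tt (ℕₚ.m≤m+n (suc a) (sum x)) (Strict⇒Parts strict)

Parts-sorted : ∀ {ok next} → (∀ p → next p ℕ.≤ p) → ∀ {b x} → Parts ok next b x → Linked ℕ._≥_ x
Parts-sorted next≤ []                          = []
Parts-sorted next≤ (cons _ _ [])               = [-]
Parts-sorted next≤ (cons {a = a} _ _ parts@(cons _ c< _)) = ℕₚ.≤-trans c< (next≤ (suc a)) ∷ Parts-sorted next≤ parts

sorted-↭⇒≡ : ∀ {x y} → Linked ℕ._≥_ x → Linked ℕ._≥_ y → x ↭ y → x ≡ y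
sorted-↭⇒≡ x↘ y↘ p = Pointwise.Pointwise-≡⇒≡
  (Sortedₚ.↗↭↗⇒≋ (Flip.totalOrder ℕₚ.≤-totalOrder) x↘ y↘ (↭⇒↭ₛ p))

Strict-↭⇒≡ : ∀ {x y} → Strict nothing x → Strict nothing y → x ↭ y → x ≡ y
Strict-↭⇒≡ sx sy = sorted-↭⇒≡ (sorted sx) (sorted sy)
  where
  sorted : ∀ {x} → Strict nothing x → Linked ℕ._≥_ x
  sorted s = Parts-sorted (λ p → ℕₚ.m∸n≤m p 1) (Strict⇒Parts-sum s)

SP-All : ∀ k → All (λ x → Strict nothing x × sum x ≡ k) (SP k)
SP-All k = All.map (λ (parts , e) → Strict-forget (Parts⇒Strict parts) , e) (SPEnum.E-All k k k ℕₚ.≤-refl)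

SP-δ : ∀ {y} → Strict nothing y → ∀ (G : List ℕ → ℚ) → Σℚ (SP (sum y)) (λ x → δ y x * G x) ≡ G y
SP-δ {y} s = SPEnum.E-δ (sum y) (sum y) (Strict⇒Parts-sum s) ℕₚ.≤-refl

IsStrict⇒Strict : ∀ x → IsStrict x → Strict nothing x
IsStrict⇒Strict []      _ = []
IsStrict⇒Strict (a ∷ x) h = go nothing a x tt h
  where
  go : ∀ b a x → T (fits _<ᵇ_ b a) → T (strictB (a ∷ x)) → Strict b (a ∷ x)
  go b (suc a) []      h h′ = cons h []
  go b (suc a) (c ∷ x) h h′ = cons h (go (just (suc a)) c x (T-∧ˡ (c <ᵇ suc a) h′) (T-∧ʳ (c <ᵇ suc a) h′))

Strict⇒IsStrict : ∀ {b x} → Strict b x → IsStrict x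
Strict⇒IsStrict []                      = tt
Strict⇒IsStrict (cons _ [])             = tt
Strict⇒IsStrict (cons _ s@(cons h _))   = ∧-T h (Strict⇒IsStrict s)

IsOddPartition⇒Parts : ∀ x → IsOddPartition x → OddParts (sum x) x
IsOddPartition⇒Parts []      _ = []
IsOddPartition⇒Parts (a ∷ x) h = go (a ℕ.+ sum x) a x (ℕₚ.m≤m+n a (sum x)) h
  where
  go : ∀ b a x → a ℕ.≤ b → T (oddPartB (a ∷ x)) → OddParts b (a ∷ x)
  go b (suc a) []      a≤b h = cons h a≤b []
  go b zero    (c ∷ x) a≤b h = ⊥-elim (T-∧ʳ (c ≤ᵇ 0) h)
  go b (suc a) (c ∷ x) a≤b h = cons (T-∧ˡ (oddB (suc a)) h′) a≤b
      (go (suc a) c x (ℕₚ.≤ᵇ⇒≤ c (suc a) (T-∧ˡ (c ≤ᵇ suc a) h)) (T-∧ʳ (oddB (suc a)) h′))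
    where
    h′ = T-∧ʳ (c ≤ᵇ suc a) h

OP-All : ∀ k → All (λ x → OddParts k x × sum x ≡ k) (OP k)
OP-All k = OPEnum.E-All k k k ℕₚ.≤-refl

OP-δ : ∀ {y} → OddParts (sum y) y → ∀ (G : List ℕ → ℚ) → Σℚ (OP (sum y)) (λ x → δ y x * G x) ≡ G y
OP-δ {y} parts = OPEnum.E-δ (sum y) (sum y) parts ℕₚ.≤-refl

-- Box removal and chain counts of the definitions

Σ-filterB : ∀ {A : Set} (p : A → Bool) (f : A → ℚ) xs → Σℚ (filterB p xs) f ≡ Σℚ xs (λ x → gate (p x) (f x))
Σ-filterB p f []       = refl
Σ-filterB p f (x ∷ xs) with p x
... | true  = cong (f x +_) (Σ-filterB p f xs)
... | false = trans (Σ-filterB p f xs) (sym (ℚₚ.+-identityˡ _))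

dropZeros-Strict : ∀ {b x} → Strict b x → dropZeros x ≡ x
dropZeros-Strict []              = refl
dropZeros-Strict (cons h strict) = cong (_ ∷_) (dropZeros-Strict strict)

headBelow : ℕ → List ℕ → Bool
headBelow a []      = true
headBelow a (c ∷ _) = c <ᵇ a

-- Lowering a row never endangers its comparison with the row above, so the test `strictB` can be
-- passed on to the tail.
decAt-headBelow : ∀ {a x} → Strict (just (suc a)) x → All (λ y → T (headBelow (suc a) (dropZeros y))) (decAt x)
decAt-headBelow []                                    = []
decAt-headBelow {a} (cons {a = zero}  {x} h strict)   = tail strict ∷ Allₚ.map⁺ (All.universal (λ _ → h) (decAt x))
  where
  tail : ∀ {x} → Strict (just 1) x → T (headBelow (suc a) (dropZeros x))
  tail []             = tt
  tail (cons () _)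
decAt-headBelow {a} (cons {a = suc c} {x} h strict)   =
  fits-pred (just (suc a)) (suc c) h ∷ Allₚ.map⁺ (All.universal (λ _ → h) (decAt x))

strictB-∷ : ∀ a y → T (headBelow (suc a) y) → strictB (suc a ∷ y) ≡ strictB y
strictB-∷ a []      h = refl
strictB-∷ a (c ∷ y) h with c <ᵇ suc a
... | true = refl

Σ-decAt : ∀ {b x} → Strict b x → ∀ f →
  Σℚ (decAt x) (λ y → gate (strictB (dropZeros y)) (f (dropZeros y))) ≡ dn x f
Σ-decAt []                         f = refl
Σ-decAt (cons {a = a} {x} h strict) f = cong₂ _+_ (head a strict) (begin
  Σℚ (map (suc a ∷_) (decAt x)) (λ y → gate (strictB (dropZeros y)) (f (dropZeros y)))
    ≡⟨ Σ-map (λ y → gate (strictB (dropZeros y)) (f (dropZeros y))) (suc a ∷_) (decAt x) ⟩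
  Σℚ (decAt x) (λ y → gate (strictB (suc a ∷ dropZeros y)) (f (suc a ∷ dropZeros y)))
    ≡⟨ Σ-cong-All (All.map (λ {y} h → cong (λ t → gate t (f (suc a ∷ dropZeros y))) (strictB-∷ a (dropZeros y) h)) (decAt-headBelow strict)) ⟩
  Σℚ (decAt x) (λ y → gate (strictB (dropZeros y)) (f (suc a ∷ dropZeros y)))
    ≡⟨ Σ-decAt strict (f ∘ (suc a ∷_)) ⟩
  dn x (f ∘ (suc a ∷_)) ∎)
  where
  open ≡-Reasoning
  head : ∀ a {x} → Strict (just (suc a)) x → gate (strictB (dropZeros (a ∷ x))) (f (dropZeros (a ∷ x))) ≡ dnHead (suc a) x f
  head zero    []     = refl
  head zero    (cons () _)
  head (suc a) []     = refl
  head (suc a) {suc c ∷ x} s@(cons h strict) rewrite dropZeros-Strict strict with suc c <ᵇ suc a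
  ... | true  = gate-T (Strict⇒IsStrict s) _
  ... | false = refl

Σ-down : ∀ {b x} → Strict b x → ∀ f → Σℚ (down x) f ≡ dn x f
Σ-down {x = x} strict f = trans (Σ-filterB strictB f (map dropZeros (decAt x)))
  (trans (Σ-map (λ y → gate (strictB y) (f y)) dropZeros (decAt x)) (Σ-decAt strict f))

ℕ→ℚ-sum : ∀ {A : Set} (f : A → ℕ) xs → ℕ→ℚ (sum (map f xs)) ≡ Σℚ xs (ℕ→ℚ ∘ f)
ℕ→ℚ-sum f []       = refl
ℕ→ℚ-sum f (x ∷ xs) = trans (ℕ→ℚ-+ (f x) (sum (map f xs))) (cong (ℕ→ℚ (f x) +_) (ℕ→ℚ-sum f xs))

chains-dn^ : ∀ k {x} y → Strict nothing x → ℕ→ℚ (chains k x y) ≡ dn^ k (λ z → δ z y) x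
chains-dn^ zero    {x} y strict with eqListB x y
... | true  = refl
... | false = refl
chains-dn^ (suc k) {x} y strict = begin
  ℕ→ℚ (sum (map (λ z → chains k z y) (down x)))   ≡⟨ ℕ→ℚ-sum (λ z → chains k z y) (down x) ⟩
  Σℚ (down x) (λ z → ℕ→ℚ (chains k z y))          ≡⟨ Σ-down strict (λ z → ℕ→ℚ (chains k z y)) ⟩
  dn x (λ z → ℕ→ℚ (chains k z y))                 ≡⟨ dn-cong-Strict strict (λ strict′ _ → chains-dn^ k y strict′) ⟩
  dn x (dn^ k (λ z → δ z y))                       ∎
  where open ≡-Reasoning

-- Adjointness of removal and addition

Σ-δ-expand : ∀ k {x} → Strict nothing x → sum x ≡ k → ∀ (H : List ℕ → ℚ) → H x ≡ Σℚ (SP k) (λ y → H y * δ y x)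
Σ-δ-expand k {x} strict refl H = trans (sym (SP-δ strict H))
  (Σ-cong (λ y → trans (ℚₚ.*-comm (δ x y) (H y)) (cong (H y *_) (δ-sym x y))) (SP k))

-- Summation by parts: expanding `H` and `G` in indicator functions reduces it to the matrix entries
-- compared in `dn-up-δ`.
Σ-SP-adjoint : ∀ k (H G : List ℕ → ℚ) →
  Σℚ (SP (suc k)) (λ x → dn x H * G x) ≡ Σℚ (SP k) (λ y → H y * up< 1ℚ nothing y G)
Σ-SP-adjoint k H G = begin
  Σℚ (SP (suc k)) (λ x → dn x H * G x)
    ≡⟨ Σ-cong-All (All.map (λ (strict , e) → cong (_* G _) (expand strict e)) (SP-All (suc k))) ⟩
  Σℚ (SP (suc k)) (λ x → Σℚ (SP k) (λ y → H y * dn x (δ y)) * G x)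
    ≡⟨ Σ-cong (λ x → sym (Σ-*ʳ (G x) (λ y → H y * dn x (δ y)) (SP k))) (SP (suc k)) ⟩
  Σℚ (SP (suc k)) (λ x → Σℚ (SP k) (λ y → H y * dn x (δ y) * G x))
    ≡⟨ Σ-swap (λ x y → H y * dn x (δ y) * G x) (SP (suc k)) (SP k) ⟩
  Σℚ (SP k) (λ y → Σℚ (SP (suc k)) (λ x → H y * dn x (δ y) * G x))
    ≡⟨ Σ-cong-All (All.map (λ (strict , e) → collect strict e) (SP-All k)) ⟩
  Σℚ (SP k) (λ y → H y * up< 1ℚ nothing y G) ∎
  where
  open ≡-Reasoning
  expand : ∀ {x} → Strict nothing x → sum x ≡ suc k → dn x H ≡ Σℚ (SP k) (λ y → H y * dn x (δ y))
  expand {x} strict e = begin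
    dn x H                                    ≡⟨ dn-cong-Strict strict (λ strict′ e′ → Σ-δ-expand k strict′ (ℕₚ.suc-injective (trans e′ e)) H) ⟩
    dn x (λ z → Σℚ (SP k) (λ y → H y * δ y z)) ≡⟨ dn-Σ x (SP k) (λ z y → H y * δ y z) ⟩
    Σℚ (SP k) (λ y → dn x (λ z → H y * δ y z)) ≡⟨ Σ-cong (λ y → dn-*ˡ x (H y) (δ y)) (SP k) ⟩
    Σℚ (SP k) (λ y → H y * dn x (δ y))        ∎
  collect : ∀ {y} → Strict nothing y → sum y ≡ k →
    Σℚ (SP (suc k)) (λ x → H y * dn x (δ y) * G x) ≡ H y * up< 1ℚ nothing y G
  collect {y} strict e = begin
    Σℚ (SP (suc k)) (λ x → H y * dn x (δ y) * G x)
      ≡⟨ Σ-cong-All (All.map (λ {x} (strict′ , _) → trans (cong (λ q → H y * q * G x) (dn-up-δ strict′ strict))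
           (trans (lemma (H y) (up< 1ℚ nothing y (δ x)) (G x)) (cong (H y *_) (sym (up-*ˡ _<ᵇ_ 1ℚ nothing y (G x) (δ x)))))) (SP-All (suc k))) ⟩
    Σℚ (SP (suc k)) (λ x → H y * up< 1ℚ nothing y (λ z → G x * δ x z))
      ≡⟨ Σ-*ˡ (H y) (λ x → up< 1ℚ nothing y (λ z → G x * δ x z)) (SP (suc k)) ⟩
    H y * Σℚ (SP (suc k)) (λ x → up< 1ℚ nothing y (λ z → G x * δ x z))
      ≡⟨ cong (H y *_) (up-Σ _<ᵇ_ 1ℚ nothing y (SP (suc k)) (λ z x → G x * δ x z)) ⟨
    H y * up< 1ℚ nothing y (λ z → Σℚ (SP (suc k)) (λ x → G x * δ x z))
      ≡⟨ cong (H y *_) (up-cong-Strict 1ℚ strict (λ strict′ e′ → Σ-δ-expand (suc k) strict′ (trans e′ (cong suc e)) G)) ⟨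
    H y * up< 1ℚ nothing y G ∎
    where
    lemma : ∀ h u g → h * u * g ≡ h * (g * u)
    lemma = solve-∀ ℚ-ring

Σ-SP-dn^ : ∀ j {y} → Strict nothing y → ∀ (G : List ℕ → ℚ) →
  Σℚ (SP (j ℕ.+ sum y)) (λ x → dn^ j (λ z → δ z y) x * G x) ≡ up^ 1ℚ j G y
Σ-SP-dn^ zero    {y} strict G = trans (Σ-cong (λ x → cong (_* G x) (δ-sym x y)) (SP (sum y))) (SP-δ strict G)
Σ-SP-dn^ (suc j) {y} strict G = trans
  (Σ-SP-adjoint (j ℕ.+ sum y) (dn^ j (λ z → δ z y)) G)
  (Σ-SP-dn^ j strict (λ x → up< 1ℚ nothing x G))

-- Chain counts and P*

Strict-below : ∀ {b x} → Strict (just b) x → All (ℕ._< b) x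
Strict-below []                  = []
Strict-below {b} (cons {a = a} h strict) = a<b ∷ All.map (λ c<a → ℕₚ.<-trans c<a a<b) (Strict-below strict)
  where
  a<b = ℕₚ.<ᵇ⇒< (suc a) b h

Strict-positive : ∀ {b x} → Strict b x → All (ℕ._> 0) x
Strict-positive []              = []
Strict-positive (cons h strict) = s≤s z≤n ∷ Strict-positive strict

Strict-Unique : ∀ {b x} → Strict b x → Unique (map ℕ→ℚ x)
Strict-Unique []              = []
Strict-Unique (cons h strict) =
  Allₚ.map⁺ (All.map (λ c<a e → ℕₚ.<-irrefl (sym (ℕ→ℚ-injective e)) c<a) (Strict-below strict)) ∷ Strict-Unique strict

sumℚ-ℕ→ℚ : ∀ x → sumℚ (map ℕ→ℚ x) ≡ ℕ→ℚ (sum x)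
sumℚ-ℕ→ℚ []      = refl
sumℚ-ℕ→ℚ (a ∷ x) = trans (cong (ℕ→ℚ a +_) (sumℚ-ℕ→ℚ x)) (sym (ℕ→ℚ-+ a (sum x)))

Pstar-S : ∀ ν x → Pstar ν (map ℕ→ℚ x) ≡ S falling ν (map ℕ→ℚ x)
Pstar-S ν x = symmetrise-S falling ν (map ℕ→ℚ x)

Pstar-vanish : ∀ {ν x} → Strict nothing ν → Strict nothing x → sum x ℕ.≤ sum ν → ν ≢ x → Pstar ν (map ℕ→ℚ x) ≡ 0ℚ
Pstar-vanish {ν} {x} sν sx le ν≢x = trans (Pstar-S ν x)
  (falling-S-vanish ν x (Strict-positive sx) le (λ p → ν≢x (Strict-↭⇒≡ sν sx p)))

module _ {x : List ℕ} (strict : Strict nothing x) where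

  private
    h : List ℕ → ℚ
    h ν = Pstar ν (map ℕ→ℚ x)

  Pstar-up : ∀ i {ν} → Strict nothing ν → sum x ≡ i ℕ.+ sum ν → up< 1ℚ nothing ν h ≡ ℕ→ℚ i * h ν
  Pstar-up i {ν} sν e = begin
    up< 1ℚ nothing ν h
      ≡⟨ up-cong _<ᵇ_ 1ℚ nothing ν (λ κ → Pstar-S κ x) ⟩
    up< 1ℚ nothing ν (λ κ → S falling κ (map ℕ→ℚ x))
      ≡⟨ falling-up (map ℕ→ℚ x) sν (Strict-Unique strict) ⟩
    (sumℚ (map ℕ→ℚ x) - ℕ→ℚ (sum ν)) * S falling ν (map ℕ→ℚ x)
      ≡⟨ cong₂ (λ p q → (p - ℕ→ℚ (sum ν)) * q)
           (trans (sumℚ-ℕ→ℚ x) (trans (cong ℕ→ℚ e) (ℕ→ℚ-+ i (sum ν)))) (sym (Pstar-S ν x)) ⟩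
    (ℕ→ℚ i + ℕ→ℚ (sum ν) - ℕ→ℚ (sum ν)) * h ν
      ≡⟨ lemma (ℕ→ℚ i) (ℕ→ℚ (sum ν)) (h ν) ⟩
    ℕ→ℚ i * h ν ∎
    where
    open ≡-Reasoning
    lemma : ∀ i s h → (i + s - s) * h ≡ i * h
    lemma = solve-∀ ℚ-ring

  -- By `Pstar-up`, an addition starting from size |x| - k has factor k; the j additions contribute
  -- i + j, ..., i + 1.
  Pstar-up^ : ∀ j i {ν} → Strict nothing ν → sum x ≡ i ℕ.+ (j ℕ.+ sum ν) →
    up^ 1ℚ j h ν * ℕ→ℚ (i !) ≡ ℕ→ℚ ((i ℕ.+ j) !) * h ν
  Pstar-up^ zero    i {ν} sν e = trans (ℚₚ.*-comm (h ν) (ℕ→ℚ (i !))) (cong (λ k → ℕ→ℚ (k !) * h ν) (sym (ℕₚ.+-identityʳ i)))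
  Pstar-up^ (suc j) i {ν} sν e = begin
    up^ 1ℚ j (λ κ → up< 1ℚ nothing κ h) ν * ℕ→ℚ (i !)
      ≡⟨ cong (_* ℕ→ℚ (i !)) (trans
           (up^-cong 1ℚ j sν (λ {κ} sκ eκ → Pstar-up (suc i) sκ
              (trans e′ (cong (suc i ℕ.+_) (sym eκ)))))
           (up^-*ˡ 1ℚ j sν (ℕ→ℚ (suc i)) h)) ⟩
    ℕ→ℚ (suc i) * up^ 1ℚ j h ν * ℕ→ℚ (i !)
      ≡⟨ lemma (ℕ→ℚ (suc i)) (up^ 1ℚ j h ν) (ℕ→ℚ (i !)) ⟩
    up^ 1ℚ j h ν * (ℕ→ℚ (suc i) * ℕ→ℚ (i !))
      ≡⟨ cong (up^ 1ℚ j h ν *_) (ℕ→ℚ-* (suc i) (i !)) ⟨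
    up^ 1ℚ j h ν * ℕ→ℚ (suc i !)
      ≡⟨ Pstar-up^ j (suc i) sν e′ ⟩
    ℕ→ℚ ((suc i ℕ.+ j) !) * h ν
      ≡⟨ cong (λ k → ℕ→ℚ (k !) * h ν) (sym (ℕₚ.+-suc i j)) ⟩
    ℕ→ℚ ((i ℕ.+ suc j) !) * h ν ∎
    where
    open ≡-Reasoning
    e′ : sum x ≡ suc i ℕ.+ (j ℕ.+ sum ν)
    e′ = trans e (ℕₚ.+-suc i (j ℕ.+ sum ν))
    lemma : ∀ a b c → a * b * c ≡ b * (a * c)
    lemma = solve-∀ ℚ-ring

  -- Adding j = |x| - |ν| boxes multiplies P*_ν(x) by j!. The same expression is a sum of P*_κ(x)
  -- over |κ| = |x|, weighted by chains from ν to κ, and vanishing leaves only κ = x.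
  Pstar-chains-diagonal : ∀ j {ν} → Strict nothing ν → sum x ≡ j ℕ.+ sum ν → ℕ→ℚ (j !) * h ν ≡ ℕ→ℚ (chains j x ν) * h x
  Pstar-chains-diagonal j {ν} sν e = begin
    ℕ→ℚ (j !) * h ν
      ≡⟨ Pstar-up^ j 0 sν e ⟨
    up^ 1ℚ j h ν * 1ℚ
      ≡⟨ ℚₚ.*-identityʳ (up^ 1ℚ j h ν) ⟩
    up^ 1ℚ j h ν
      ≡⟨ Σ-SP-dn^ j sν h ⟨
    Σℚ (SP (j ℕ.+ sum ν)) (λ κ → dn^ j (λ z → δ z ν) κ * h κ)
      ≡⟨ cong (λ k → Σℚ (SP k) (λ κ → dn^ j (λ z → δ z ν) κ * h κ)) (sym e) ⟩
    Σℚ (SP (sum x)) (λ κ → dn^ j (λ z → δ z ν) κ * h κ)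
      ≡⟨ Σ-cong-All (All.map (λ {κ} (sκ , eκ) → concentrate sκ eκ) (SP-All (sum x))) ⟩
    Σℚ (SP (sum x)) (λ κ → δ x κ * (dn^ j (λ z → δ z ν) κ * h κ))
      ≡⟨ SP-δ strict (λ κ → dn^ j (λ z → δ z ν) κ * h κ) ⟩
    dn^ j (λ z → δ z ν) x * h x
      ≡⟨ cong (_* h x) (chains-dn^ j ν strict) ⟨
    ℕ→ℚ (chains j x ν) * h x ∎
    where
    open ≡-Reasoning
    concentrate : ∀ {κ} → Strict nothing κ → sum κ ≡ sum x →
      dn^ j (λ z → δ z ν) κ * h κ ≡ δ x κ * (dn^ j (λ z → δ z ν) κ * h κ)
    concentrate {κ} sκ eκ with Listₚ.≡-dec ℕₚ._≟_ κ x
    ... | yes refl = sym (trans (cong (_* (dn^ j (λ z → δ z ν) κ * h κ)) (δ-refl κ)) (ℚₚ.*-identityˡ (dn^ j (λ z → δ z ν) κ * h κ)))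
    ... | no κ≢x   = trans vanish (sym (trans (cong (δ x κ *_) vanish) (ℚₚ.*-zeroʳ (δ x κ))))
      where
      vanish : dn^ j (λ z → δ z ν) κ * h κ ≡ 0ℚ
      vanish = trans (cong (dn^ j (λ z → δ z ν) κ *_) (Pstar-vanish sκ strict (ℕₚ.≤-reflexive (sym eκ)) κ≢x))
                     (ℚₚ.*-zeroʳ (dn^ j (λ z → δ z ν) κ))

  -- The case ν = ∅, where P*_∅ = 1. It determines the diagonal value P*_x(x), and since the left
  -- side is a factorial it also shows that g^x is not 0.
  g-diagonal : ℕ→ℚ (sum x !) ≡ ℕ→ℚ (g x) * h x
  g-diagonal = begin
    ℕ→ℚ (sum x !)                    ≡⟨ ℚₚ.*-identityʳ (ℕ→ℚ (sum x !)) ⟨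
    ℕ→ℚ (sum x !) * 1ℚ               ≡⟨ cong (ℕ→ℚ (sum x !) *_) (Pstar-S [] x) ⟨
    ℕ→ℚ (sum x !) * h []             ≡⟨ Pstar-chains-diagonal (sum x) [] (sym (ℕₚ.+-identityʳ (sum x))) ⟩
    ℕ→ℚ (chains (sum x) x []) * h x  ∎
    where open ≡-Reasoning

  g≢0 : ℕ→ℚ (g x) ≢ 0ℚ
  g≢0 eq = !≢0 (sum x) (trans g-diagonal (trans (cong (_* h x) eq) (ℚₚ.*-zeroˡ (h x))))

  Pstar-chains : ∀ j {ν} → Strict nothing ν → sum x ≡ j ℕ.+ sum ν →
    ℕ→ℚ (j !) * (ℕ→ℚ (g x) * h ν) ≡ ℕ→ℚ (sum x !) * ℕ→ℚ (chains j x ν)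
  Pstar-chains j {ν} sν e = begin
    ℕ→ℚ (j !) * (ℕ→ℚ (g x) * h ν)              ≡⟨ *-left-comm (ℕ→ℚ (j !)) (ℕ→ℚ (g x)) (h ν) ⟩
    ℕ→ℚ (g x) * (ℕ→ℚ (j !) * h ν)              ≡⟨ cong (ℕ→ℚ (g x) *_) (Pstar-chains-diagonal j sν e) ⟩
    ℕ→ℚ (g x) * (ℕ→ℚ (chains j x ν) * h x)     ≡⟨ lemma₂ (ℕ→ℚ (g x)) (ℕ→ℚ (chains j x ν)) (h x) ⟩
    ℕ→ℚ (g x) * h x * ℕ→ℚ (chains j x ν)       ≡⟨ cong (_* ℕ→ℚ (chains j x ν)) g-diagonal ⟨
    ℕ→ℚ (sum x !) * ℕ→ℚ (chains j x ν)         ∎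
    where
    open ≡-Reasoning
    lemma₂ : ∀ a b c → a * (b * c) ≡ a * c * b
    lemma₂ = solve-∀ ℚ-ring

-- Independence of odd power sums

-- f has constant s-fold finite differences: they are c · h₁ ⋯ hₛ for the steps h₁, …, hₛ.
data ConstantDifference : ℕ → ℚ → (ℚ → ℚ) → Set where
  base : ∀ {c f} → (∀ u → f u ≡ c) → ConstantDifference zero c f
  step : ∀ {s c f} → (∀ h → ConstantDifference s (c * h) (λ u → f (h + u) - f u)) → ConstantDifference (suc s) c f

cd-cong : ∀ {s c d f g} → c ≡ d → (∀ u → f u ≡ g u) → ConstantDifference s c f → ConstantDifference s d g
cd-cong c≡d f≗g (base cd) = base (λ u → trans (sym (f≗g u)) (trans (cd u) c≡d))
cd-cong c≡d f≗g (step cd) = step (λ h → cd-cong (cong (_* h) c≡d) (λ u → cong₂ _-_ (f≗g (h + u)) (f≗g u)) (cd h))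

cd-+ : ∀ {s c d f g} → ConstantDifference s c f → ConstantDifference s d g → ConstantDifference s (c + d) (λ u → f u + g u)
cd-+ (base cf) (base cg) = base (λ u → cong₂ _+_ (cf u) (cg u))
cd-+ {c = c} {d} {f} {g} (step cf) (step cg) = step (λ h → cd-cong (sym (ℚₚ.*-distribʳ-+ h c d))
  (λ u → lemma (f (h + u)) (f u) (g (h + u)) (g u)) (cd-+ (cf h) (cg h)))
  where
  lemma : ∀ a b c d → a - b + (c - d) ≡ a + c - (b + d)
  lemma = solve-∀ ℚ-ring

cd-*ˡ : ∀ k {s c f} → ConstantDifference s c f → ConstantDifference s (k * c) (λ u → k * f u)
cd-*ˡ k (base cd) = base (λ u → cong (k *_) (cd u))
cd-*ˡ k {c = c} {f} (step cd) = step (λ h → cd-cong (sym (ℚₚ.*-assoc k c h)) (λ u → lemma k (f (h + u)) (f u)) (cd-*ˡ k (cd h)))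
  where
  lemma : ∀ k a b → k * (a - b) ≡ k * a - k * b
  lemma = solve-∀ ℚ-ring

cd-shift : ∀ k {s c f} → ConstantDifference s c f → ConstantDifference s c (λ u → f (k + u))
cd-shift k (base cd) = base (λ u → cd (k + u))
cd-shift k {f = f} (step cd) = step (λ h → cd-cong refl (λ u → cong (λ v → f v - f (k + u)) (+-left-comm h k u)) (cd-shift k (cd h)))

-- The product rule Δ(u f(u)) = u Δf(u) + h f(u + h) for step h: the first term is handled by
-- induction, and the second raises the multiplier by one. Starting from 1 it yields r! for the r-th
-- power.
cd-var* : ∀ {s c f} → ConstantDifference s c f → ConstantDifference (suc s) (ℕ→ℚ (suc s) * c) (λ u → u * f u)
cd-var* {c = c} (base cd) = step (λ h → base (λ u →
  trans (cong₂ (λ p q → (h + u) * p - u * q) (cd (h + u)) (cd u)) (lemma h u c)))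
  where
  lemma : ∀ h u c → (h + u) * c - u * c ≡ 1ℚ * c * h
  lemma = solve-∀ ℚ-ring
cd-var* {suc s} {c} {f} (step cd) = step (λ h → cd-cong
  (trans (lemma₁ (ℕ→ℚ (suc s)) c h) (cong (λ n → n * c * h) (sym (ℕ→ℚ-suc (suc s)))))
  (λ u → lemma₂ h u (f (h + u)) (f u))
  (cd-+ (cd-var* (cd h)) (cd-*ˡ h (cd-shift h {f = f} (step cd)))))
  where
  lemma₁ : ∀ n c h → n * (c * h) + h * c ≡ (1ℚ + n) * c * h
  lemma₁ = solve-∀ ℚ-ring
  lemma₂ : ∀ h u a b → u * (a - b) + h * a ≡ (h + u) * a - u * b
  lemma₂ = solve-∀ ℚ-ring

cd-suc : ∀ {s c f} → ConstantDifference s c f → ConstantDifference (suc s) 0ℚ f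
cd-suc {c = c} (base cd) = step (λ h → base (λ u →
  trans (cong₂ _-_ (cd (h + u)) (cd u)) (trans (ℚₚ.+-inverseʳ c) (sym (ℚₚ.*-zeroˡ h)))))
cd-suc (step cd) = step (λ h → cd-cong (sym (ℚₚ.*-zeroˡ h)) (λ _ → refl) (cd-suc (cd h)))

cd-power : ∀ r → ConstantDifference r (ℕ→ℚ (r !)) (_^′ r)
cd-power zero    = base (λ _ → refl)
cd-power (suc r) = cd-cong (sym (ℕ→ℚ-* (suc r) (r !))) (λ _ → refl) (cd-var* (cd-power r))

cd-power-zero : ∀ {r s} → r ℕ.< s → ConstantDifference s 0ℚ (_^′ r)
cd-power-zero {r} {suc s} (s≤s r≤s) with ℕₚ.m≤n⇒m<n∨m≡n r≤s
... | inj₁ r<s  = cd-suc (cd-power-zero r<s)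
... | inj₂ refl = cd-suc (cd-power s)

-- The steps are 2^(s-1), ..., 2, 1: their subset sums are distinct, which keeps the points of
-- `prouhet` distinct.
dyadicDifference : ℕ → (ℚ → ℚ) → ℚ → ℚ
dyadicDifference zero    f u = f u
dyadicDifference (suc s) f u = dyadicDifference s f (ℕ→ℚ (2 ℕ.^ s) + u) - dyadicDifference s f u

dyadicSteps : ℕ → ℚ
dyadicSteps zero    = 1ℚ
dyadicSteps (suc s) = ℕ→ℚ (2 ℕ.^ s) * dyadicSteps s

dyadicDifference-Δ : ∀ s h f u →
  dyadicDifference s (λ v → f (h + v) - f v) u ≡ dyadicDifference s f (h + u) - dyadicDifference s f u
dyadicDifference-Δ zero    h f u = refl
dyadicDifference-Δ (suc s) h f u = trans
  (cong₂ _-_ (trans (dyadicDifference-Δ s h f (k + u)) (cong (λ v → dyadicDifference s f v - dyadicDifference s f (k + u)) (+-left-comm h k u)))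
             (dyadicDifference-Δ s h f u))
  (lemma (dyadicDifference s f (k + (h + u))) (dyadicDifference s f (k + u)) (dyadicDifference s f (h + u)) (dyadicDifference s f u))
  where
  k = ℕ→ℚ (2 ℕ.^ s)
  lemma : ∀ a b c d → a - b - (c - d) ≡ a - c - (b - d)
  lemma = solve-∀ ℚ-ring

dyadicDifference-cd : ∀ {s c f} → ConstantDifference s c f → ∀ u → dyadicDifference s f u ≡ c * dyadicSteps s
dyadicDifference-cd {c = c} (base cd) u = trans (cd u) (sym (ℚₚ.*-identityʳ c))
dyadicDifference-cd {suc s} {c} {f} (step cd) u = begin
  dyadicDifference s f (k + u) - dyadicDifference s f u   ≡⟨ dyadicDifference-Δ s k f u ⟨
  dyadicDifference s (λ v → f (k + v) - f v) u            ≡⟨ dyadicDifference-cd (cd k) u ⟩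
  c * k * dyadicSteps s                                    ≡⟨ ℚₚ.*-assoc c k (dyadicSteps s) ⟩
  c * (k * dyadicSteps s)                                  ∎
  where
  open ≡-Reasoning
  k = ℕ→ℚ (2 ℕ.^ s)

-- Thue–Morse signed integers (Prouhet's solution of the Tarry–Escott problem): an odd power
-- sum of degree r over prouhet s u is an s-fold difference of the r-th power.
prouhet : ℕ → ℕ → List ℚ
prouhet zero    u = ℕ→ℚ u ∷ []
prouhet (suc s) u = map -_ (prouhet s u) ++ prouhet s (2 ℕ.^ s ℕ.+ u)

pow-++ : ∀ r x y → pow r (x ++ y) ≡ pow r x + pow r y
pow-++ r x y = Σ-++ (λ q → q ^′ r) x y

^′-neg-odd : ∀ r → T (oddB r) → ∀ q → (- q) ^′ r ≡ - 1ℚ * q ^′ r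
^′-neg-odd (suc zero) _ q = lemma q
  where
  lemma : ∀ q → - q * 1ℚ ≡ - 1ℚ * (q * 1ℚ)
  lemma = solve-∀ ℚ-ring
^′-neg-odd (suc (suc r)) odd q = trans (cong (λ p → - q * (- q * p)) (^′-neg-odd r odd q)) (lemma q (q ^′ r))
  where
  lemma : ∀ q p → - q * (- q * (- 1ℚ * p)) ≡ - 1ℚ * (q * (q * p))
  lemma = solve-∀ ℚ-ring

pow-neg-odd : ∀ r → T (oddB r) → ∀ x → pow r (map -_ x) ≡ - 1ℚ * pow r x
pow-neg-odd r odd x = trans (Σ-map (λ q → q ^′ r) -_ x) (trans (Σ-cong (^′-neg-odd r odd) x) (Σ-*ˡ (- 1ℚ) (λ q → q ^′ r) x))

-- For odd r a negated point contributes with a minus sign, so the signs of the difference can be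
-- realised by the points themselves.
pow-prouhet : ∀ r → T (oddB r) → ∀ s u → pow r (prouhet s u) ≡ dyadicDifference s (_^′ r) (ℕ→ℚ u)
pow-prouhet r odd zero    u = ℚₚ.+-identityʳ (ℕ→ℚ u ^′ r)
pow-prouhet r odd (suc s) u = begin
  pow r (map -_ (prouhet s u) ++ prouhet s (2 ℕ.^ s ℕ.+ u))
    ≡⟨ pow-++ r (map -_ (prouhet s u)) (prouhet s (2 ℕ.^ s ℕ.+ u)) ⟩
  pow r (map -_ (prouhet s u)) + pow r (prouhet s (2 ℕ.^ s ℕ.+ u))
    ≡⟨ cong₂ _+_ (trans (pow-neg-odd r odd (prouhet s u)) (cong (- 1ℚ *_) (pow-prouhet r odd s u)))
                 (trans (pow-prouhet r odd s (2 ℕ.^ s ℕ.+ u)) (cong (dyadicDifference s (_^′ r)) (ℕ→ℚ-+ (2 ℕ.^ s) u))) ⟩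
  - 1ℚ * dyadicDifference s (_^′ r) (ℕ→ℚ u) + dyadicDifference s (_^′ r) (ℕ→ℚ (2 ℕ.^ s) + ℕ→ℚ u)
    ≡⟨ lemma (dyadicDifference s (_^′ r) (ℕ→ℚ u)) (dyadicDifference s (_^′ r) (ℕ→ℚ (2 ℕ.^ s) + ℕ→ℚ u)) ⟩
  dyadicDifference s (_^′ r) (ℕ→ℚ (2 ℕ.^ s) + ℕ→ℚ u) - dyadicDifference s (_^′ r) (ℕ→ℚ u) ∎
  where
  open ≡-Reasoning
  lemma : ∀ a b → - 1ℚ * a + b ≡ b - a
  lemma = solve-∀ ℚ-ring

pow-prouhet-vanish : ∀ {r s} → T (oddB r) → r ℕ.< s → ∀ u → pow r (prouhet s u) ≡ 0ℚ
pow-prouhet-vanish {r} {s} odd r<s u = trans (pow-prouhet r odd s u)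
  (trans (dyadicDifference-cd (cd-power-zero r<s) (ℕ→ℚ u)) (ℚₚ.*-zeroˡ (dyadicSteps s)))

*-pos : ∀ {p q} → 0ℚ ℚ.< p → 0ℚ ℚ.< q → 0ℚ ℚ.< p * q
*-pos {p} {q} 0<p 0<q = ℚₚ.positive⁻¹ (p * q) {{ℚₚ.pos*pos⇒pos p {{ℚ.positive 0<p}} q {{ℚ.positive 0<q}}}}

*-nonNeg : ∀ {p q} → 0ℚ ℚ.≤ p → 0ℚ ℚ.≤ q → 0ℚ ℚ.≤ p * q
*-nonNeg {p} {q} 0≤p 0≤q = ℚₚ.nonNegative⁻¹ (p * q)
  {{ℚₚ.nonNeg*nonNeg⇒nonNeg p {{ℚ.nonNegative 0≤p}} q {{ℚ.nonNegative 0≤q}}}}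

ℕ→ℚ-pos : ∀ n .{{_ : ℕ.NonZero n}} → 0ℚ ℚ.< ℕ→ℚ n
ℕ→ℚ-pos n = ℚₚ.positive⁻¹ (ℕ→ℚ n) {{ℚₚ.normalize-pos n 1}}

ℕ→ℚ-nonNeg : ∀ n → 0ℚ ℚ.≤ ℕ→ℚ n
ℕ→ℚ-nonNeg n = ℚₚ.nonNegative⁻¹ (ℕ→ℚ n) {{ℚₚ.normalize-nonNeg n 1}}

dyadicSteps-pos : ∀ s → 0ℚ ℚ.< dyadicSteps s
dyadicSteps-pos zero    = ℕ→ℚ-pos 1
dyadicSteps-pos (suc s) = *-pos (ℕ→ℚ-pos (2 ℕ.^ s) {{ℕₚ.m^n≢0 2 s}}) (dyadicSteps-pos s)

pow-prouhet-pos : ∀ {r} → T (oddB r) → ∀ u → 0ℚ ℚ.< pow r (prouhet r u)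
pow-prouhet-pos {r} odd u = subst (0ℚ ℚ.<_)
  (sym (trans (pow-prouhet r odd r u) (dyadicDifference-cd (cd-power r) (ℕ→ℚ u))))
  (*-pos (ℕ→ℚ-pos (r !) {{r ℕₚ.!≢0}}) (dyadicSteps-pos r))

-- Distinctness is tracked through absolute values, since the point sets contain negated integers;
-- sets with disjoint ranges of absolute values can be concatenated.
AbsIn : ℕ → ℕ → ℚ → Set
AbsIn a b q = ∃[ n ] a ℕ.≤ n × n ℕ.< b × ℚ.∣ q ∣ ≡ ℕ→ℚ n

AbsFrom : ℕ → ℚ → Set
AbsFrom a q = ∃[ n ] a ℕ.≤ n × ℚ.∣ q ∣ ≡ ℕ→ℚ n

AbsIn-≢ : ∀ {a b p q} → AbsIn a b p → AbsFrom b q → p ≢ q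
AbsIn-≢ (m , _ , m<b , ∣p∣) (n , b≤n , ∣q∣) refl =
  ℕₚ.<-irrefl (ℕ→ℚ-injective (trans (sym ∣p∣) ∣q∣)) (ℕₚ.<-≤-trans m<b b≤n)

prouhet-AbsIn : ∀ s u → All (AbsIn u (2 ℕ.^ s ℕ.+ u)) (prouhet s u)
prouhet-AbsIn zero    u = (u , ℕₚ.≤-refl , ℕₚ.≤-refl , ℚₚ.0≤p⇒∣p∣≡p (ℕ→ℚ-nonNeg u)) ∷ []
prouhet-AbsIn (suc s) u = Allₚ.++⁺
  (Allₚ.map⁺ (All.map (λ {q} (n , u≤n , n< , ∣q∣) → n , u≤n , ℕₚ.<-≤-trans n< (ℕₚ.+-monoˡ-≤ u (ℕₚ.m≤m+n (2 ℕ.^ s) _))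
                          , trans (ℚₚ.∣-p∣≡∣p∣ q) ∣q∣) (prouhet-AbsIn s u)))
  (All.map (λ (n , k≤n , n< , ∣q∣) → n , ℕₚ.≤-trans (ℕₚ.m≤n+m u (2 ℕ.^ s)) k≤n , subst (n ℕ.<_) double n< , ∣q∣)
           (prouhet-AbsIn s (2 ℕ.^ s ℕ.+ u)))
  where
  double : 2 ℕ.^ s ℕ.+ (2 ℕ.^ s ℕ.+ u) ≡ 2 ℕ.^ suc s ℕ.+ u
  double = trans (sym (ℕₚ.+-assoc (2 ℕ.^ s) (2 ℕ.^ s) u)) (cong (λ k → 2 ℕ.^ s ℕ.+ k ℕ.+ u) (sym (ℕₚ.+-identityʳ (2 ℕ.^ s))))

AbsIn⇒AbsFrom : ∀ {a b q} → AbsIn a b q → AbsFrom a q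
AbsIn⇒AbsFrom (n , a≤n , _ , ∣q∣) = n , a≤n , ∣q∣

Unique-++ : ∀ {a b x y} → All (AbsIn a b) x → All (AbsFrom b) y → Unique x → Unique y → Unique (x ++ y)
Unique-++ x< y≥ ux uy = AllPairsₚ.++⁺ ux uy (All.map (λ p< → All.map (AbsIn-≢ p<) y≥) x<)

prouhet-Unique : ∀ s u → Unique (prouhet s u)
prouhet-Unique zero    u = [] ∷ []
prouhet-Unique (suc s) u = Unique-++ neg-range (All.map AbsIn⇒AbsFrom (prouhet-AbsIn s (2 ℕ.^ s ℕ.+ u)))
  (AllPairsₚ.map⁺ (neg-Unique (prouhet-Unique s u)))
  (prouhet-Unique s (2 ℕ.^ s ℕ.+ u))
  where
  neg-range : All (AbsIn u (2 ℕ.^ s ℕ.+ u)) (map -_ (prouhet s u))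
  neg-range = Allₚ.map⁺ (All.map (λ {q} (n , u≤n , n< , ∣q∣) → n , u≤n , n< , trans (ℚₚ.∣-p∣≡∣p∣ q) ∣q∣) (prouhet-AbsIn s u))
  neg-Unique : ∀ {x} → Unique x → AllPairs (λ p q → - p ≢ - q) x
  neg-Unique []       = []
  neg-Unique (p ∷ ps) = All.map (λ p≢q e → p≢q (ℚₚ.neg-injective e)) p ∷ neg-Unique ps

-- The mixed difference of f along pairwise disjoint Prouhet sets of orders ρ₁, ρ₂, …, at ∅.
mixed : List ℕ → ℕ → (List ℚ → ℚ) → ℚ
mixed []      u f = f []
mixed (r ∷ ρ) u f = mixed ρ (2 ℕ.^ r ℕ.+ u) (λ x → f (prouhet r u ++ x) - f x)

-- Each set uses absolute values from u up to 2^r + u, exclusive, and the next one starts at 2^r +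
-- u. All evaluations thus take place at distinct coordinates, where the identities for Q are
-- available.
mixed-cong-Unique : ∀ ρ u {f g} → (∀ {x} → Unique x → All (AbsFrom u) x → f x ≡ g x) → mixed ρ u f ≡ mixed ρ u g
mixed-cong-Unique []      u e = e [] []
mixed-cong-Unique (r ∷ ρ) u {f} {g} e = mixed-cong-Unique ρ (2 ℕ.^ r ℕ.+ u) (λ {x} ux x≥ → cong₂ _-_
  (e (Unique-++ (prouhet-AbsIn r u) x≥ (prouhet-Unique r u) ux)
     (Allₚ.++⁺ (All.map AbsIn⇒AbsFrom (prouhet-AbsIn r u)) (weaken x≥)))
  (e ux (weaken x≥)))
  where
  weaken : ∀ {x} → All (AbsFrom (2 ℕ.^ r ℕ.+ u)) x → All (AbsFrom u) x
  weaken = All.map (λ (n , k≤n , ∣q∣) → n , ℕₚ.≤-trans (ℕₚ.m≤n+m u (2 ℕ.^ r)) k≤n , ∣q∣)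

mixed-cong : ∀ ρ u {f g} → (∀ x → f x ≡ g x) → mixed ρ u f ≡ mixed ρ u g
mixed-cong ρ u e = mixed-cong-Unique ρ u (λ {x} _ _ → e x)

mixed-+ : ∀ ρ u f g → mixed ρ u (λ x → f x + g x) ≡ mixed ρ u f + mixed ρ u g
mixed-+ []      u f g = refl
mixed-+ (r ∷ ρ) u f g = trans
  (mixed-cong ρ _ (λ x → lemma (f (prouhet r u ++ x)) (g (prouhet r u ++ x)) (f x) (g x)))
  (mixed-+ ρ _ (λ x → f (prouhet r u ++ x) - f x) (λ x → g (prouhet r u ++ x) - g x))
  where
  lemma : ∀ a b c d → a + b - (c + d) ≡ a - c + (b - d)
  lemma = solve-∀ ℚ-ring

mixed-*ˡ : ∀ ρ u c f → mixed ρ u (λ x → c * f x) ≡ c * mixed ρ u f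
mixed-*ˡ []      u c f = refl
mixed-*ˡ (r ∷ ρ) u c f = trans
  (mixed-cong ρ _ (λ x → lemma c (f (prouhet r u ++ x)) (f x)))
  (mixed-*ˡ ρ _ c (λ x → f (prouhet r u ++ x) - f x))
  where
  lemma : ∀ c a b → c * a - c * b ≡ c * (a - b)
  lemma = solve-∀ ℚ-ring

mixed-Σ : ∀ {A : Set} ρ u (xs : List A) (c : A → ℚ) (f : A → List ℚ → ℚ) →
  mixed ρ u (λ x → Σℚ xs (λ a → c a * f a x)) ≡ Σℚ xs (λ a → c a * mixed ρ u (f a))
mixed-Σ ρ u []       c f = zero-mixed ρ u
  where
  zero-mixed : ∀ ρ u → mixed ρ u (λ _ → 0ℚ) ≡ 0ℚ
  zero-mixed []      u = refl
  zero-mixed (r ∷ ρ) u = zero-mixed ρ _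
mixed-Σ ρ u (a ∷ xs) c f = trans
  (mixed-+ ρ u (λ x → c a * f a x) (λ x → Σℚ xs (λ b → c b * f b x)))
  (cong₂ _+_ (mixed-*ˡ ρ u (c a) (f a)) (mixed-Σ ρ u xs c f))

-- The ways to multiply out the product of the p_s(y) + p_s(x) over the parts s of σ, except the one
-- that takes every factor at x; positions count, so equal parts give separate entries.
splits⁺ : List ℕ → List (List ℕ × List ℕ)
splits⁺ []      = []
splits⁺ (s ∷ σ) = map (λ (τ , υ) → s ∷ τ , υ) (([] , σ) ∷ splits⁺ σ) ++ map (λ (τ , υ) → τ , s ∷ υ) (splits⁺ σ)

pprod-++ : ∀ σ y x → pprod σ (y ++ x) ≡ pprod σ x + Σℚ (splits⁺ σ) (λ (τ , υ) → pprod τ y * pprod υ x)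
pprod-++ []      y x = refl
pprod-++ (s ∷ σ) y x = begin
  pow s (y ++ x) * pprod σ (y ++ x)
    ≡⟨ cong₂ _*_ (pow-++ s y x) (pprod-++ σ y x) ⟩
  (pow s y + pow s x) * (pprod σ x + R)
    ≡⟨ lemma (pow s y) (pow s x) (pprod σ x) R ⟩
  pow s x * pprod σ x + (pow s y * 1ℚ * pprod σ x + pow s y * R + pow s x * R)
    ≡⟨ cong (pow s x * pprod σ x +_) (cong₂ (λ p q → pow s y * 1ℚ * pprod σ x + p + q) (left (splits⁺ σ)) (right (splits⁺ σ))) ⟩
  pow s x * pprod σ x + (pow s y * 1ℚ * pprod σ x + Σℚ (map (λ (τ , υ) → s ∷ τ , υ) (splits⁺ σ)) F
                                                  + Σℚ (map (λ (τ , υ) → τ , s ∷ υ) (splits⁺ σ)) F)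
    ≡⟨ cong (pow s x * pprod σ x +_) (Σ-++ F (map (λ (τ , υ) → s ∷ τ , υ) (([] , σ) ∷ splits⁺ σ)) (map (λ (τ , υ) → τ , s ∷ υ) (splits⁺ σ))) ⟨
  pow s x * pprod σ x + Σℚ (splits⁺ (s ∷ σ)) F ∎
  where
  open ≡-Reasoning
  F : List ℕ × List ℕ → ℚ
  F (τ , υ) = pprod τ y * pprod υ x
  R = Σℚ (splits⁺ σ) F
  lemma : ∀ a b p r → (a + b) * (p + r) ≡ b * p + (a * 1ℚ * p + a * r + b * r)
  lemma = solve-∀ ℚ-ring
  left : ∀ ts → pow s y * Σℚ ts F ≡ Σℚ (map (λ (τ , υ) → s ∷ τ , υ) ts) F
  left ts = trans (sym (Σ-*ˡ (pow s y) F ts)) (trans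
    (Σ-cong (λ (τ , υ) → sym (ℚₚ.*-assoc (pow s y) (pprod τ y) (pprod υ x))) ts)
    (sym (Σ-map F (λ (τ , υ) → s ∷ τ , υ) ts)))
  right : ∀ ts → pow s x * Σℚ ts F ≡ Σℚ (map (λ (τ , υ) → τ , s ∷ υ) ts) F
  right ts = trans (sym (Σ-*ˡ (pow s x) F ts)) (trans
    (Σ-cong (λ (τ , υ) → *-left-comm (pow s x) (pprod τ y) (pprod υ x)) ts)
    (sym (Σ-map F (λ (τ , υ) → τ , s ∷ υ) ts)))

-- The excluded split is the term that the difference f(prouhet ++ x) - f(x) cancels.
mixed-∷ : ∀ r ρ u σ → mixed (r ∷ ρ) u (pprod σ) ≡
  Σℚ (splits⁺ σ) (λ (τ , υ) → pprod τ (prouhet r u) * mixed ρ (2 ℕ.^ r ℕ.+ u) (pprod υ))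
mixed-∷ r ρ u σ = trans
  (mixed-cong ρ _ (λ x → trans (cong (_- pprod σ x) (pprod-++ σ (prouhet r u) x)) (lemma (pprod σ x) _)))
  (mixed-Σ ρ _ (splits⁺ σ) (λ (τ , _) → pprod τ (prouhet r u)) (λ (_ , υ) → pprod υ))
  where
  lemma : ∀ a b → a + b - a ≡ b
  lemma = solve-∀ ℚ-ring

Split : List ℕ → List ℕ × List ℕ → Set
Split σ (τ , υ) = τ ++ υ ↭ σ × τ ≢ []

splits⁺-Split : ∀ σ → All (Split σ) (splits⁺ σ)
splits⁺-Split []      = []
splits⁺-Split (s ∷ σ) = Allₚ.++⁺
  ((↭-refl , λ ()) ∷ Allₚ.map⁺ (All.map (λ (p , _) → Perm.prep s p , λ ()) (splits⁺-Split σ)))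
  (Allₚ.map⁺ (All.map (λ { {τ , υ} (p , τ≢[]) → ↭-trans (Permₚ.shift s τ υ) (Perm.prep s p) , τ≢[] }) (splits⁺-Split σ)))

AllOdd : List ℕ → Set
AllOdd = All (λ r → T (oddB r))

odd-pos : ∀ r → T (oddB r) → 0 ℕ.< r
odd-pos (suc r) _ = s≤s z≤n

pprod-prouhet-vanish : ∀ {τ r} u → AllOdd τ → ¬ All (r ℕ.≤_) τ → pprod τ (prouhet r u) ≡ 0ℚ
pprod-prouhet-vanish u [] small = ⊥-elim (small [])
pprod-prouhet-vanish {t ∷ τ} {r} u (odd ∷ odds) small with r ℕₚ.≤? t
... | yes r≤t = trans (cong (pow t (prouhet r u) *_) (pprod-prouhet-vanish u odds (λ all → small (r≤t ∷ all)))) (ℚₚ.*-zeroʳ (pow t (prouhet r u)))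
... | no r≰t  = trans (cong (_* pprod τ (prouhet r u)) (pow-prouhet-vanish odd (ℕₚ.≰⇒> r≰t) u)) (ℚₚ.*-zeroˡ (pprod τ (prouhet r u)))

data SplitView (r n u : ℕ) (τ υ : List ℕ) : Set where
  vanishing : pprod τ (prouhet r u) ≡ 0ℚ → SplitView r n u τ υ
  smaller   : sum υ ℕ.< n → SplitView r n u τ υ
  singleton : τ ≡ r ∷ [] → sum υ ℕ.≤ n → SplitView r n u τ υ

-- A part of τ below r makes its factor vanish on the Prouhet set of order r. Otherwise the nonempty
-- τ has size at least r, with equality only for the single part r; so the rest has size less than n
-- unless τ is that part.
splitView : ∀ {σ τ υ r n} u → AllOdd σ → Split σ (τ , υ) → sum σ ℕ.≤ r ℕ.+ n → SplitView r n u τ υ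
splitView {τ = []} u odds (p , τ≢[]) le = ⊥-elim (τ≢[] refl)
splitView {σ} {t ∷ τ} {υ} {r} {n} u odds (p , _) le with All.all? (r ℕₚ.≤?_) (t ∷ τ) | Permₚ.All-resp-↭ (↭-sym p) odds
... | no small   | odds′ = vanishing (pprod-prouhet-vanish u (Allₚ.++⁻ˡ (t ∷ τ) odds′) small)
... | yes (r≤t ∷ _) | odds′ = go τ (Allₚ.++⁻ˡ τ (All.tail odds′)) bound
  where
  bound : t ℕ.+ sum τ ℕ.+ sum υ ℕ.≤ r ℕ.+ n
  bound = subst (ℕ._≤ r ℕ.+ n) (trans (sym (sum-↭ p)) (sum-++ (t ∷ τ) υ)) le
  go : ∀ τ → AllOdd τ → t ℕ.+ sum τ ℕ.+ sum υ ℕ.≤ r ℕ.+ n → SplitView r n u (t ∷ τ) υ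
  go [] [] bound with ℕₚ.m≤n⇒m<n∨m≡n r≤t
  ... | inj₂ refl = singleton refl (ℕₚ.+-cancelˡ-≤ r (sum υ) n (subst (λ k → k ℕ.+ sum υ ℕ.≤ r ℕ.+ n) (ℕₚ.+-identityʳ r) bound))
  ... | inj₁ r<t  = smaller (ℕₚ.+-cancelˡ-< r (sum υ) n (ℕₚ.<-≤-trans (ℕₚ.+-monoˡ-< (sum υ) (ℕₚ.<-≤-trans r<t (ℕₚ.m≤m+n t 0))) bound))
  go (t′ ∷ τ) (odd ∷ _) bound = smaller (ℕₚ.+-cancelˡ-< r (sum υ) n (ℕₚ.<-≤-trans (ℕₚ.+-monoˡ-< (sum υ) r<) bound))
    where
    r< : r ℕ.< t ℕ.+ (t′ ℕ.+ sum τ)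
    r< = ℕₚ.≤-<-trans r≤t (ℕₚ.<-≤-trans (ℕₚ.m<m+n t (odd-pos t′ odd)) (ℕₚ.+-monoʳ-≤ t (ℕₚ.m≤m+n t′ (sum τ))))

Split-odd : ∀ {σ τ υ} → AllOdd σ → Split σ (τ , υ) → AllOdd υ
Split-odd {τ = τ} odds (p , _) = Allₚ.++⁻ʳ τ (Permₚ.All-resp-↭ (↭-sym p) odds)

sum-0⇒[] : ∀ {σ} → AllOdd σ → sum σ ℕ.≤ 0 → σ ≡ []
sum-0⇒[] []           _  = refl
sum-0⇒[] {suc s ∷ σ} (odd ∷ _) ()

-- Triangularity, by induction on ρ: a nonzero term must spend exactly the part r on the first
-- Prouhet set, and its remainder must then be a rearrangement of the other parts of ρ.
mixed-vanish : ∀ ρ u {σ} → AllOdd σ → sum σ ℕ.≤ sum ρ → ¬ (σ ↭ ρ) → mixed ρ u (pprod σ) ≡ 0ℚ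
mixed-vanish [] u odds le ≁ with refl ← sum-0⇒[] odds le = ⊥-elim (≁ ↭-refl)
mixed-vanish (r ∷ ρ) u {σ} odds le ≁ = trans (mixed-∷ r ρ u σ) (Σ-zero-All (All.map (λ { {τ , υ} → term τ υ }) (splits⁺-Split σ)))
  where
  u′ = 2 ℕ.^ r ℕ.+ u
  term : ∀ τ υ → Split σ (τ , υ) → pprod τ (prouhet r u) * mixed ρ u′ (pprod υ) ≡ 0ℚ
  term τ υ split with splitView {r = r} {n = sum ρ} u odds split le
  ... | vanishing e        = trans (cong (_* mixed ρ u′ (pprod υ)) e) (ℚₚ.*-zeroˡ (mixed ρ u′ (pprod υ)))
  ... | smaller lt         = trans (cong (pprod τ (prouhet r u) *_)
                               (mixed-vanish ρ u′ (Split-odd odds split) (ℕₚ.<⇒≤ lt) (λ q → ℕₚ.<-irrefl (sum-↭ q) lt)))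
                             (ℚₚ.*-zeroʳ (pprod τ (prouhet r u)))
  ... | singleton refl le′ = trans (cong (pprod τ (prouhet r u) *_)
                               (mixed-vanish ρ u′ (Split-odd odds split) le′ (λ q → ≁ (↭-trans (↭-sym (proj₁ split)) (Perm.prep r q)))))
                             (ℚₚ.*-zeroʳ (pprod τ (prouhet r u)))

Σ-nonNeg : ∀ {A : Set} {f : A → ℚ} {xs} → All (λ x → 0ℚ ℚ.≤ f x) xs → 0ℚ ℚ.≤ Σℚ xs f
Σ-nonNeg []       = ℚₚ.≤-refl
Σ-nonNeg (p ∷ ps) = ℚₚ.+-mono-≤ p (Σ-nonNeg ps)

mutual

  -- When ρ has repeated parts, several splits of p_ρ survive. Their nonnegativity excludes
  -- cancellation in `mixed-pos`.
  mixed-nonNeg : ∀ ρ u {σ} → AllOdd ρ → AllOdd σ → sum σ ℕ.≤ sum ρ → 0ℚ ℚ.≤ mixed ρ u (pprod σ)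
  mixed-nonNeg [] u _ odds le with refl ← sum-0⇒[] odds le = ℕ→ℚ-nonNeg 1
  mixed-nonNeg (r ∷ ρ) u {σ} ρ-odd odds le = subst (0ℚ ℚ.≤_) (sym (mixed-∷ r ρ u σ))
    (Σ-nonNeg (All.map (mixed-term-nonNeg r ρ u ρ-odd odds le) (splits⁺-Split σ)))

  mixed-term-nonNeg : ∀ r ρ u {σ} → AllOdd (r ∷ ρ) → AllOdd σ → sum σ ℕ.≤ sum (r ∷ ρ) → ∀ {t} → Split σ t →
    0ℚ ℚ.≤ pprod (proj₁ t) (prouhet r u) * mixed ρ (2 ℕ.^ r ℕ.+ u) (pprod (proj₂ t))
  mixed-term-nonNeg r ρ u {σ} (r-odd ∷ ρ-odd) odds le {τ , υ} split with splitView {r = r} {n = sum ρ} u odds split le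
  ... | vanishing e = ℚₚ.≤-reflexive (sym (trans (cong (_* mixed ρ (2 ℕ.^ r ℕ.+ u) (pprod υ)) e) (ℚₚ.*-zeroˡ (mixed ρ (2 ℕ.^ r ℕ.+ u) (pprod υ)))))
  ... | smaller lt  = ℚₚ.≤-reflexive (sym (trans (cong (pprod τ (prouhet r u) *_)
                        (mixed-vanish ρ (2 ℕ.^ r ℕ.+ u) (Split-odd odds split) (ℕₚ.<⇒≤ lt) (λ q → ℕₚ.<-irrefl (sum-↭ q) lt)))
                        (ℚₚ.*-zeroʳ (pprod τ (prouhet r u)))))
  ... | singleton refl le′ = *-nonNeg (ℚₚ.<⇒≤ (*-pos (pow-prouhet-pos {r} r-odd u) (ℕ→ℚ-pos 1)))
                               (mixed-nonNeg ρ (2 ℕ.^ r ℕ.+ u) ρ-odd (Split-odd odds split) le′)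

mixed-pos : ∀ ρ u → AllOdd ρ → 0ℚ ℚ.< mixed ρ u (pprod ρ)
mixed-pos []      u _ = ℕ→ℚ-pos 1
mixed-pos (r ∷ ρ) u odds@(r-odd ∷ ρ-odd) = subst (0ℚ ℚ.<_) (sym (mixed-∷ r ρ u (r ∷ ρ)))
  (ℚₚ.+-mono-<-≤ (*-pos (*-pos (pow-prouhet-pos {r} r-odd u) (ℕ→ℚ-pos 1)) (mixed-pos ρ (2 ℕ.^ r ℕ.+ u) ρ-odd))
    (Σ-nonNeg (All.map (mixed-term-nonNeg r ρ u odds odds ℕₚ.≤-refl) (All.tail (splits⁺-Split (r ∷ ρ))))))

OddParts-odd : ∀ {b x} → OddParts b x → AllOdd x
OddParts-odd []                  = []
OddParts-odd (cons odd _ parts) = odd ∷ OddParts-odd parts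

OddParts-↭⇒≡ : ∀ {b c x y} → OddParts b x → OddParts c y → x ↭ y → x ≡ y
OddParts-↭⇒≡ px py = sorted-↭⇒≡ (Parts-sorted (λ _ → ℕₚ.≤-refl) px) (Parts-sorted (λ _ → ℕₚ.≤-refl) py)

pow-1 : ∀ x → pow 1 x ≡ sumℚ x
pow-1 []      = refl
pow-1 (q ∷ x) = cong₂ _+_ (ℚₚ.*-identityʳ q) (pow-1 x)

-- Apply the functional of ρ to both sides. On the left only p_ρ survives, with a positive value; on
-- the right each p₁ p_τ has a part 1, so it is not a rearrangement of ρ and vanishes.
p₁-multiple-coefficient : ∀ {k ρ} → OddParts (sum ρ) ρ → All (λ r → r ≢ 1) ρ → sum ρ ≡ suc k → ∀ (c d : List ℕ → ℚ) →
  (∀ {x} → Unique x → Σℚ (OP (suc k)) (λ σ → c σ * pprod σ x) ≡ sumℚ x * Σℚ (OP k) (λ τ → d τ * pprod τ x)) →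
  c ρ ≡ 0ℚ
p₁-multiple-coefficient {k} {ρ} parts no-1 e c d eq = *-cancelˡ (≢0 (mixed-pos ρ 0 (OddParts-odd parts))) (begin
  m ρ * c ρ
    ≡⟨ ℚₚ.*-comm (m ρ) (c ρ) ⟩
  c ρ * m ρ
    ≡⟨ OP-δ parts (λ σ → c σ * m σ) ⟨
  Σℚ (OP (sum ρ)) (λ σ → δ ρ σ * (c σ * m σ))
    ≡⟨ Σ-cong-All (All.map (λ {σ} (pσ , eσ) → concentrate pσ eσ) (OP-All (sum ρ))) ⟩
  Σℚ (OP (sum ρ)) (λ σ → c σ * m σ)
    ≡⟨ cong (λ n → Σℚ (OP n) (λ σ → c σ * m σ)) e ⟩
  Σℚ (OP (suc k)) (λ σ → c σ * m σ)
    ≡⟨ mixed-Σ ρ 0 (OP (suc k)) c pprod ⟨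
  mixed ρ 0 (λ x → Σℚ (OP (suc k)) (λ σ → c σ * pprod σ x))
    ≡⟨ mixed-cong-Unique ρ 0 (λ {x} ux _ → trans (eq ux) (multiply x)) ⟩
  mixed ρ 0 (λ x → Σℚ (OP k) (λ τ → d τ * pprod (1 ∷ τ) x))
    ≡⟨ mixed-Σ ρ 0 (OP k) d (λ τ → pprod (1 ∷ τ)) ⟩
  Σℚ (OP k) (λ τ → d τ * m (1 ∷ τ))
    ≡⟨ Σ-zero-All (All.map (λ {τ} (pτ , eτ) → trans (cong (d τ *_)
         (mixed-vanish ρ 0 (tt ∷ OddParts-odd pτ) (ℕₚ.≤-reflexive (trans (cong suc eτ) (sym e)))
            (λ p → All.head (Permₚ.All-resp-↭ (↭-sym p) no-1) refl))) (ℚₚ.*-zeroʳ (d τ))) (OP-All k)) ⟩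
  0ℚ
    ≡⟨ ℚₚ.*-zeroʳ (m ρ) ⟨
  m ρ * 0ℚ ∎)
  where
  open ≡-Reasoning
  m : List ℕ → ℚ
  m σ = mixed ρ 0 (pprod σ)
  ≢0 : ∀ {q} → 0ℚ ℚ.< q → q ≢ 0ℚ
  ≢0 0<q refl = ℚₚ.<-irrefl refl 0<q
  multiply : ∀ x → sumℚ x * Σℚ (OP k) (λ τ → d τ * pprod τ x) ≡ Σℚ (OP k) (λ τ → d τ * pprod (1 ∷ τ) x)
  multiply x = trans (sym (Σ-*ˡ (sumℚ x) (λ τ → d τ * pprod τ x) (OP k)))
    (Σ-cong (λ τ → trans (*-left-comm (sumℚ x) (d τ) (pprod τ x)) (cong (λ p → d τ * (p * pprod τ x)) (sym (pow-1 x)))) (OP k))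
  concentrate : ∀ {σ} → OddParts (sum ρ) σ → sum σ ≡ sum ρ → δ ρ σ * (c σ * m σ) ≡ c σ * m σ
  concentrate {σ} pσ eσ with Listₚ.≡-dec ℕₚ._≟_ ρ σ
  ... | yes refl = trans (cong (_* (c ρ * m ρ)) (δ-refl ρ)) (ℚₚ.*-identityˡ (c ρ * m ρ))
  ... | no ρ≢σ   = trans (cong (_* (c σ * m σ)) (δ-≢ ρ≢σ)) (trans (ℚₚ.*-zeroˡ (c σ * m σ)) (sym
        (trans (cong (c σ *_) (mixed-vanish ρ 0 (OddParts-odd pσ) (ℕₚ.≤-reflexive eσ) (λ p → ρ≢σ (sym (OddParts-↭⇒≡ pσ parts p)))))
               (ℚₚ.*-zeroʳ (c σ)))))

-- The expectation

dn^-cong-Strict : ∀ j {x f g} → Strict nothing x → (∀ {z} → Strict nothing z → f z ≡ g z) → dn^ j f x ≡ dn^ j g x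
dn^-cong-Strict zero    strict e = e strict
dn^-cong-Strict (suc j) strict e = dn-cong-Strict strict (λ strict′ _ → dn^-cong-Strict j strict′ e)

dn^-Σ : ∀ {A : Set} j x (as : List A) (c : A → ℚ) (f : A → List ℕ → ℚ) →
  dn^ j (λ z → Σℚ as (λ a → c a * f a z)) x ≡ Σℚ as (λ a → c a * dn^ j (f a) x)
dn^-Σ zero    x as c f = refl
dn^-Σ (suc j) x as c f = trans (dn-cong x (λ z → dn^-Σ j z as c f))
  (trans (dn-Σ x as (λ z a → c a * dn^ j (f a) z)) (Σ-cong (λ a → dn-*ˡ x (c a) (dn^ j (f a))) as))

gate-≡ᵇ : ∀ {m n} → m ≡ n → ∀ q → gate (m ≡ᵇ n) q ≡ q
gate-≡ᵇ {m} {n} e = gate-T (ℕₚ.≡⇒≡ᵇ m n e)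

gate-≢ᵇ : ∀ {m n} → m ≢ n → ∀ q → gate (m ≡ᵇ n) q ≡ 0ℚ
gate-≢ᵇ {m} {n} m≢n q with m ≡ᵇ n in eq
... | true  = ⊥-elim (m≢n (ℕₚ.≡ᵇ⇒≡ m n (subst T (sym eq) tt)))
... | false = refl

-- The product in zρ is a local definition without a name of its own; zρ-product recovers it by unification.
mutual

  zρ-product : List ℕ → List ℕ → ℕ
  zρ-product ρ = _

  zρ-≡ : ∀ ρ → zρ ρ ≡ zρ-product ρ (applyUpTo suc (sum ρ))
  zρ-≡ ρ with applyUpTo suc (sum ρ)
  ... | rs = refl

zρ≢0 : ∀ ρ → ℕ→ℚ (zρ ρ) ≢ 0ℚ
zρ≢0 ρ = ℕ→ℚ≢0 (zρ ρ) {{nonZero (Allₚ.applyUpTo⁺₂ suc (sum ρ) (λ _ → s≤s z≤n))}}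
  where
  nonZero : ∀ {rs} → All (ℕ._> 0) rs → ℕ.NonZero (zρ-product ρ rs)
  nonZero []                       = _
  nonZero {suc r ∷ rs} (_ ∷ pos) =
    ℕₚ.m*n≢0 _ _ {{ℕₚ.m*n≢0 _ _ {{ℕₚ.m^n≢0 (suc r) (mult (suc r) ρ)}} {{mult (suc r) ρ ℕₚ.!≢0}}}} {{nonZero pos}}

Qfun-up : ∀ {ν} x → Strict nothing ν → Unique x → up< 2ℚ nothing ν (λ κ → Qfun κ x) ≡ sumℚ x * (2ℚ * Qfun ν x)
Qfun-up {ν} x strict uniq = begin
  up< 2ℚ nothing ν (λ κ → 2ℚ ^′ length κ * Pfun κ x)
    ≡⟨ up-2^length nothing ν (λ κ → Pfun κ x) ⟩
  2ℚ * 2ℚ ^′ length ν * up< 1ℚ nothing ν (λ κ → Pfun κ x)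
    ≡⟨ cong (2ℚ * 2ℚ ^′ length ν *_) (trans (up-cong _<ᵇ_ 1ℚ nothing ν (λ κ → symmetrise-S _^′_ κ x))
         (trans (power-up x strict uniq) (cong (sumℚ x *_) (sym (symmetrise-S _^′_ ν x))))) ⟩
  2ℚ * 2ℚ ^′ length ν * (sumℚ x * Pfun ν x)
    ≡⟨ lemma (2ℚ ^′ length ν) (sumℚ x) (Pfun ν x) ⟩
  sumℚ x * (2ℚ * (2ℚ ^′ length ν * Pfun ν x)) ∎
  where
  open ≡-Reasoning
  lemma : ∀ p s q → 2ℚ * p * (s * q) ≡ s * (2ℚ * (p * q))
  lemma = solve-∀ ℚ-ring

-- Spin characters under addition and removal

module _ (X : List ℕ → List ℕ → ℚ) (table : IsSpinCharacterTable X) where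

  -- The table constrains X^ν_ρ only for |ν| = |ρ|; the cut-off makes this a function on all strict
  -- partitions that addition can annihilate.
  character : List ℕ → List ℕ → ℚ
  character ρ ν = gate (sum ν ≡ᵇ sum ρ) (X ν ρ)

  private
    -- The reciprocal of the scalar product of p_σ with itself.
    norm : List ℕ → ℚ
    norm σ = 2ℚ ^′ length σ * inv (ℕ→ℚ (zρ σ))

  Qfun-expansion : ∀ {ν} → Strict nothing ν → ∀ {x} → Unique x → Qfun ν x ≡ Σℚ (OP (sum ν)) (λ σ → X ν σ * (norm σ * pprod σ x))
  Qfun-expansion {ν} strict {x} uniq = trans (table ν (Strict⇒IsStrict strict) x uniq)
    (Σ-cong (λ σ → trans (cong (_* pprod σ x) (÷′-inv (2ℚ ^′ length σ * X ν σ) (ℕ→ℚ (zρ σ))))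
                         (lemma (2ℚ ^′ length σ) (X ν σ) (inv (ℕ→ℚ (zρ σ))) (pprod σ x))) (OP (sum ν)))
    where
    lemma : ∀ a b c d → a * b * c * d ≡ b * (a * c * d)
    lemma = solve-∀ ℚ-ring

  character-Harmonic : ∀ {ρ} → IsOddPartition ρ → All (λ r → r ≢ 1) ρ → Harmonic (character ρ)
  character-Harmonic {ρ} odd no-1 {ν} strict with sum ρ ℕₚ.≟ suc (sum ν)
  -- Adding a box to ν does not reach size |ρ|, so only cut-off values occur.
  ... | no size≢ = trans (up-cong-Strict 2ℚ strict (λ {κ} _ e → gate-≢ᵇ (λ e′ → size≢ (trans (sym e′) e)) (X κ ρ)))
                         (up-zero _<ᵇ_ 2ℚ nothing ν)
  ... | yes size = trans (up-cong-Strict 2ℚ strict (λ {κ} _ e → gate-≡ᵇ (trans e (sym size)) (X κ ρ)))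
      (*-cancelˡ norm≢0 (trans (ℚₚ.*-comm (norm ρ) (up< 2ℚ nothing ν (λ κ → X κ ρ))) (trans coefficient (sym (ℚₚ.*-zeroʳ (norm ρ))))))
    where
    open ≡-Reasoning
    norm≢0 : norm ρ ≢ 0ℚ
    norm≢0 = *≢0 (^′≢0 2ℚ≢0 (length ρ)) (inv≢0 (zρ≢0 ρ))
    c d : List ℕ → ℚ
    c σ = up< 2ℚ nothing ν (λ κ → X κ σ) * norm σ
    d τ = 2ℚ * (X ν τ * norm τ)
    identity : ∀ {x} → Unique x → Σℚ (OP (suc (sum ν))) (λ σ → c σ * pprod σ x) ≡ sumℚ x * Σℚ (OP (sum ν)) (λ τ → d τ * pprod τ x)
    identity {x} uniq = begin
      Σℚ (OP (suc (sum ν))) (λ σ → c σ * pprod σ x)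
        ≡⟨ Σ-cong (λ σ → trans (lemma₁ (up< 2ℚ nothing ν (λ κ → X κ σ)) (norm σ) (pprod σ x))
             (trans (sym (up-*ˡ _<ᵇ_ 2ℚ nothing ν (norm σ * pprod σ x) (λ κ → X κ σ)))
                    (up-cong _<ᵇ_ 2ℚ nothing ν (λ κ → ℚₚ.*-comm (norm σ * pprod σ x) (X κ σ))))) (OP (suc (sum ν))) ⟩
      Σℚ (OP (suc (sum ν))) (λ σ → up< 2ℚ nothing ν (λ κ → X κ σ * (norm σ * pprod σ x)))
        ≡⟨ up-Σ _<ᵇ_ 2ℚ nothing ν (OP (suc (sum ν))) (λ κ σ → X κ σ * (norm σ * pprod σ x)) ⟨
      up< 2ℚ nothing ν (λ κ → Σℚ (OP (suc (sum ν))) (λ σ → X κ σ * (norm σ * pprod σ x)))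
        ≡⟨ up-cong-Strict 2ℚ strict (λ {κ} strict′ e → trans
             (cong (λ n → Σℚ (OP n) (λ σ → X κ σ * (norm σ * pprod σ x))) (sym e)) (sym (Qfun-expansion strict′ uniq))) ⟩
      up< 2ℚ nothing ν (λ κ → Qfun κ x)
        ≡⟨ Qfun-up x strict uniq ⟩
      sumℚ x * (2ℚ * Qfun ν x)
        ≡⟨ cong (λ q → sumℚ x * (2ℚ * q)) (Qfun-expansion strict uniq) ⟩
      sumℚ x * (2ℚ * Σℚ (OP (sum ν)) (λ τ → X ν τ * (norm τ * pprod τ x)))
        ≡⟨ cong (sumℚ x *_) (trans (sym (Σ-*ˡ 2ℚ (λ τ → X ν τ * (norm τ * pprod τ x)) (OP (sum ν))))
             (Σ-cong (λ τ → lemma₂ (X ν τ) (norm τ) (pprod τ x)) (OP (sum ν)))) ⟩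
      sumℚ x * Σℚ (OP (sum ν)) (λ τ → d τ * pprod τ x) ∎
      where
      lemma₁ : ∀ a b c → a * b * c ≡ b * c * a
      lemma₁ = solve-∀ ℚ-ring
      lemma₂ : ∀ a b c → 2ℚ * (a * (b * c)) ≡ 2ℚ * (a * b) * c
      lemma₂ = solve-∀ ℚ-ring
    coefficient : c ρ ≡ 0ℚ
    coefficient = p₁-multiple-coefficient (IsOddPartition⇒Parts ρ odd) no-1 size c d identity

  character-δ : ∀ ρ {z} → Strict nothing z → character ρ z ≡ Σℚ (SP (sum ρ)) (λ ν → X ν ρ * δ z ν)
  character-δ ρ {z} strict with sum z ℕₚ.≟ sum ρ
  ... | yes e = trans (gate-≡ᵇ e (X z ρ)) (trans (sym (SP-δ strict (λ ν → X ν ρ)))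
                  (trans (cong (λ k → Σℚ (SP k) (λ ν → δ z ν * X ν ρ)) e) (Σ-cong (λ ν → ℚₚ.*-comm (δ z ν) (X ν ρ)) (SP (sum ρ)))))
  ... | no e≢ = trans (gate-≢ᵇ e≢ (X z ρ)) (sym (Σ-zero-All (All.map (λ { {ν} (_ , e) →
                  trans (cong (X ν ρ *_) (δ-≢ {z} {ν} (λ { refl → e≢ e }))) (ℚₚ.*-zeroʳ (X ν ρ)) }) (SP-All (sum ρ)))))

  frakp-vanish : ∀ ρ {x} → Strict nothing x → sum x ℕ.< sum ρ → frakp X ρ x ≡ 0ℚ
  frakp-vanish ρ {x} strict lt = Σ-zero-All (All.map (λ { {ν} (sν , e) → trans
    (cong (X ν ρ *_) (Pstar-vanish sν strict (ℕₚ.≤-trans (ℕₚ.<⇒≤ lt) (ℕₚ.≤-reflexive (sym e))) (λ { refl → ℕₚ.<-irrefl e lt })))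
    (ℚₚ.*-zeroʳ (X ν ρ)) }) (SP-All (sum ρ)))

  frakp-dn^ : ∀ ρ j {x} → Strict nothing x → sum x ≡ j ℕ.+ sum ρ →
    ℕ→ℚ (j !) * (ℕ→ℚ (g x) * frakp X ρ x) ≡ ℕ→ℚ (sum x !) * dn^ j (character ρ) x
  frakp-dn^ ρ j {x} strict size = begin
    ℕ→ℚ (j !) * (ℕ→ℚ (g x) * frakp X ρ x)
      ≡⟨ ℚₚ.*-assoc (ℕ→ℚ (j !)) (ℕ→ℚ (g x)) (frakp X ρ x) ⟨
    ℕ→ℚ (j !) * ℕ→ℚ (g x) * frakp X ρ x
      ≡⟨ Σ-*ˡ (ℕ→ℚ (j !) * ℕ→ℚ (g x)) (λ ν → X ν ρ * Pstar ν (map ℕ→ℚ x)) (SP (sum ρ)) ⟨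
    Σℚ (SP (sum ρ)) (λ ν → ℕ→ℚ (j !) * ℕ→ℚ (g x) * (X ν ρ * Pstar ν (map ℕ→ℚ x)))
      ≡⟨ Σ-cong-All (All.map (λ {ν} (sν , e) → term sν e) (SP-All (sum ρ))) ⟩
    Σℚ (SP (sum ρ)) (λ ν → ℕ→ℚ (sum x !) * (X ν ρ * dn^ j (λ z → δ z ν) x))
      ≡⟨ Σ-*ˡ (ℕ→ℚ (sum x !)) (λ ν → X ν ρ * dn^ j (λ z → δ z ν) x) (SP (sum ρ)) ⟩
    ℕ→ℚ (sum x !) * Σℚ (SP (sum ρ)) (λ ν → X ν ρ * dn^ j (λ z → δ z ν) x)
      ≡⟨ cong (ℕ→ℚ (sum x !) *_) (dn^-Σ j x (SP (sum ρ)) (λ ν → X ν ρ) (λ ν z → δ z ν)) ⟨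
    ℕ→ℚ (sum x !) * dn^ j (λ z → Σℚ (SP (sum ρ)) (λ ν → X ν ρ * δ z ν)) x
      ≡⟨ cong (ℕ→ℚ (sum x !) *_) (dn^-cong-Strict j strict (character-δ ρ)) ⟨
    ℕ→ℚ (sum x !) * dn^ j (character ρ) x ∎
    where
    open ≡-Reasoning
    lemma₁ : ∀ a b c d → a * b * (c * d) ≡ c * (a * (b * d))
    lemma₁ = solve-∀ ℚ-ring
    term : ∀ {ν} → Strict nothing ν → sum ν ≡ sum ρ →
      ℕ→ℚ (j !) * ℕ→ℚ (g x) * (X ν ρ * Pstar ν (map ℕ→ℚ x)) ≡ ℕ→ℚ (sum x !) * (X ν ρ * dn^ j (λ z → δ z ν) x)
    term {ν} sν e = begin
      ℕ→ℚ (j !) * ℕ→ℚ (g x) * (X ν ρ * Pstar ν (map ℕ→ℚ x))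
        ≡⟨ lemma₁ (ℕ→ℚ (j !)) (ℕ→ℚ (g x)) (X ν ρ) (Pstar ν (map ℕ→ℚ x)) ⟩
      X ν ρ * (ℕ→ℚ (j !) * (ℕ→ℚ (g x) * Pstar ν (map ℕ→ℚ x)))
        ≡⟨ cong (X ν ρ *_) (trans (Pstar-chains strict j sν (trans size (cong (j ℕ.+_) (sym e))))
                                  (cong (ℕ→ℚ (sum x !) *_) (chains-dn^ j ν strict))) ⟩
      X ν ρ * (ℕ→ℚ (sum x !) * dn^ j (λ z → δ z ν) x)
        ≡⟨ *-left-comm (X ν ρ) (ℕ→ℚ (sum x !)) (dn^ j (λ z → δ z ν) x) ⟩
      ℕ→ℚ (sum x !) * (X ν ρ * dn^ j (λ z → δ z ν) x) ∎

-- The expectation as iterated box addition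

gskew-chains : ∀ n x μ → sum x ≡ n ℕ.+ sum μ → gskew x μ ≡ chains n x μ
gskew-chains n x μ e with sum μ ≤ᵇ sum x in eq
... | true  = cong (λ k → chains k x μ) (trans (cong (_∸ sum μ) e) (ℕₚ.m+n∸n≡m n (sum μ)))
... | false = ⊥-elim (subst T eq (ℕₚ.≤⇒≤ᵇ (subst (sum μ ℕ.≤_) (sym e) (ℕₚ.m≤n+m (sum μ) n))))

-- Adjointness turns the sum weighted by chain counts into n weight-one additions from μ, and the
-- powers of 2 in `weight` make them weight two. The hypothesis describes g^λ φ(λ), so g^λ and (n +
-- m)! cancel against the weight; `c` clears a denominator of φ.
𝔼-up^ : ∀ {μ} n (φ F : List ℕ → ℚ) c → c ≢ 0ℚ → Strict nothing μ →
  (∀ {x} → Strict nothing x → sum x ≡ n ℕ.+ sum μ → c * (ℕ→ℚ (g x) * φ x) ≡ ℕ→ℚ (sum x !) * F x) →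
  c * (ℕ→ℚ (g μ) * 𝔼 μ n φ) ≡ ℕ→ℚ (sum μ !) * up^ 2ℚ n F μ
𝔼-up^ {μ} n φ F c c≢0 strict hyp = begin
  c * (G * Σℚ (SP N) (λ x → weight μ n x * φ x))
    ≡⟨ ℚₚ.*-assoc c G (Σℚ (SP N) (λ x → weight μ n x * φ x)) ⟨
  c * G * Σℚ (SP N) (λ x → weight μ n x * φ x)
    ≡⟨ Σ-*ˡ (c * G) (λ x → weight μ n x * φ x) (SP N) ⟨
  Σℚ (SP N) (λ x → c * G * (weight μ n x * φ x))
    ≡⟨ Σ-cong-All (All.map (λ {x} (sx , e) → term sx e) (SP-All N)) ⟩
  Σℚ (SP N) (λ x → ℕ→ℚ (sum μ !) * P * (dn^ n (λ z → δ z μ) x * (inv (2ℚ ^′ length x) * F x)))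
    ≡⟨ Σ-*ˡ (ℕ→ℚ (sum μ !) * P) (λ x → dn^ n (λ z → δ z μ) x * (inv (2ℚ ^′ length x) * F x)) (SP N) ⟩
  ℕ→ℚ (sum μ !) * P * Σℚ (SP N) (λ x → dn^ n (λ z → δ z μ) x * (inv (2ℚ ^′ length x) * F x))
    ≡⟨ cong (ℕ→ℚ (sum μ !) * P *_) (Σ-SP-dn^ n strict (λ x → inv (2ℚ ^′ length x) * F x)) ⟩
  ℕ→ℚ (sum μ !) * P * up^ 1ℚ n (λ x → inv (2ℚ ^′ length x) * F x) μ
    ≡⟨ ℚₚ.*-assoc (ℕ→ℚ (sum μ !)) P _ ⟩
  ℕ→ℚ (sum μ !) * (P * up^ 1ℚ n (λ x → inv (2ℚ ^′ length x) * F x) μ)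
    ≡⟨ cong (ℕ→ℚ (sum μ !) *_) (up^-2^length n strict (λ x → inv (2ℚ ^′ length x) * F x)) ⟨
  ℕ→ℚ (sum μ !) * up^ 2ℚ n (λ x → 2ℚ ^′ length x * (inv (2ℚ ^′ length x) * F x)) μ
    ≡⟨ cong (ℕ→ℚ (sum μ !) *_) (up^-cong 2ℚ n strict (λ {x} _ _ → trans
         (sym (ℚₚ.*-assoc (2ℚ ^′ length x) (inv (2ℚ ^′ length x)) (F x)))
         (trans (cong (_* F x) (*-inv (^′≢0 2ℚ≢0 (length x)))) (ℚₚ.*-identityˡ (F x))))) ⟩
  ℕ→ℚ (sum μ !) * up^ 2ℚ n F μ ∎
  where
  open ≡-Reasoning
  N = n ℕ.+ sum μ
  G = ℕ→ℚ (g μ)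
  P = 2ℚ ^′ (n ℕ.+ length μ)
  gather : ∀ c G m N⁻¹ p t γ G⁻¹ ch φ →
    c * G * (m * N⁻¹ * (p * t) * (γ * G⁻¹) * ch * φ) ≡ (G * G⁻¹) * (m * p * (ch * t)) * N⁻¹ * (c * (γ * φ))
  gather = solve-∀ ℚ-ring
  finish : ∀ N⁻¹ N f m p ch t → 1ℚ * (m * p * (ch * t)) * N⁻¹ * (N * f) ≡ (N * N⁻¹) * (m * p * (ch * (t * f)))
  finish = solve-∀ ℚ-ring
  term : ∀ {x} → Strict nothing x → sum x ≡ N →
    c * G * (weight μ n x * φ x) ≡ ℕ→ℚ (sum μ !) * P * (dn^ n (λ z → δ z μ) x * (inv (2ℚ ^′ length x) * F x))
  term {x} sx e = begin
    c * G * (weight μ n x * φ x)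
      ≡⟨ cong (λ w → c * G * (w * φ x)) (cong₂ _*_ (cong₂ _*_ (cong₂ _*_ (÷′-inv m (ℕ→ℚ (N !))) (÷′-inv P (2ℚ ^′ length x)))
           (÷′-inv (ℕ→ℚ (g x)) G)) (trans (cong ℕ→ℚ (gskew-chains n x μ e)) (chains-dn^ n μ sx))) ⟩
    c * G * (m * inv (ℕ→ℚ (N !)) * (P * t) * (ℕ→ℚ (g x) * inv G) * ch * φ x)
      ≡⟨ gather c G m (inv (ℕ→ℚ (N !))) P t (ℕ→ℚ (g x)) (inv G) ch (φ x) ⟩
    G * inv G * (m * P * (ch * t)) * inv (ℕ→ℚ (N !)) * (c * (ℕ→ℚ (g x) * φ x))
      ≡⟨ cong₂ (λ p q → p * (m * P * (ch * t)) * inv (ℕ→ℚ (N !)) * q) (*-inv (g≢0 strict))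
           (trans (hyp sx e) (cong (λ k → ℕ→ℚ (k !) * F x) e)) ⟩
    1ℚ * (m * P * (ch * t)) * inv (ℕ→ℚ (N !)) * (ℕ→ℚ (N !) * F x)
      ≡⟨ finish (inv (ℕ→ℚ (N !))) (ℕ→ℚ (N !)) (F x) m P ch t ⟩
    ℕ→ℚ (N !) * inv (ℕ→ℚ (N !)) * (m * P * (ch * (t * F x)))
      ≡⟨ cong (_* (m * P * (ch * (t * F x)))) (*-inv (!≢0 N)) ⟩
    1ℚ * (m * P * (ch * (t * F x)))
      ≡⟨ ℚₚ.*-identityˡ (m * P * (ch * (t * F x))) ⟩
    m * P * (ch * (t * F x)) ∎
    where
    m = ℕ→ℚ (sum μ !)
    t = inv (2ℚ ^′ length x)
    ch = dn^ n (λ z → δ z μ) x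

module _ (X : List ℕ → List ℕ → ℚ) (table : IsSpinCharacterTable X) {μ ρ : List ℕ} (strict : Strict nothing μ)
         (odd : IsOddPartition ρ) (no-1 : All (λ r → r ≢ 1) ρ) where

  private
    φ χ : List ℕ → ℚ
    φ = frakp X ρ
    χ = character X table ρ

    m! gμ : ℚ
    m! = ℕ→ℚ (sum μ !)
    gμ = ℕ→ℚ (g μ)

  open ≡-Reasoning

  𝔼-frakp-dn^ : ∀ n j → n ℕ.+ sum μ ≡ j ℕ.+ sum ρ → ℕ→ℚ (j !) * (gμ * 𝔼 μ n φ) ≡ m! * up^ 2ℚ n (dn^ j χ) μ
  𝔼-frakp-dn^ n j size = 𝔼-up^ n φ (dn^ j χ) (ℕ→ℚ (j !)) (!≢0 j) strict
    (λ strict′ e → frakp-dn^ X table ρ j strict′ (trans e size))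

  -- The n additions undo n of the n + i removals, and the remaining D^i χ at μ is what `frakp-dn^`
  -- gives for 𝔭_ρ(μ). The factorials and g^μ then cancel.
  𝔼-frakp-≥ : ∀ n i → sum μ ≡ i ℕ.+ sum ρ → 𝔼 μ n φ ≡ φ μ
  𝔼-frakp-≥ n i size = *-cancelˡ (g≢0 strict) (*-cancelˡ (!≢0 i) (*-cancelˡ (!≢0 (n ℕ.+ i)) (begin
    j! * (i! * (gμ * 𝔼 μ n φ))                 ≡⟨ *-left-comm j! i! (gμ * 𝔼 μ n φ) ⟩
    i! * (j! * (gμ * 𝔼 μ n φ))                 ≡⟨ cong (i! *_) (𝔼-frakp-dn^ n (n ℕ.+ i) (trans (cong (n ℕ.+_) size) (sym (ℕₚ.+-assoc n i (sum ρ))))) ⟩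
    i! * (m! * up^ 2ℚ n (dn^ (n ℕ.+ i) χ) μ)   ≡⟨ right-comm i! m! (up^ 2ℚ n (dn^ (n ℕ.+ i) χ) μ) ⟩
    m! * (up^ 2ℚ n (dn^ (n ℕ.+ i) χ) μ * i!)   ≡⟨ cong (m! *_) (up^-dn^ (character-Harmonic X table odd no-1) n i strict) ⟩
    m! * (j! * dn^ i χ μ)                       ≡⟨ *-left-comm m! j! (dn^ i χ μ) ⟩
    j! * (m! * dn^ i χ μ)                       ≡⟨ cong (j! *_) (frakp-dn^ X table ρ i strict size) ⟨
    j! * (i! * (gμ * φ μ))                      ∎)))
    where
    i! = ℕ→ℚ (i !)
    j! = ℕ→ℚ ((n ℕ.+ i) !)
    right-comm : ∀ a b c → a * (b * c) ≡ b * (c * a)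
    right-comm = solve-∀ ℚ-ring

  -- Here n = j + i + 1 exceeds the number j of removals, so the expectation is 0; so is 𝔭_ρ(μ),
  -- because |μ| < |ρ|.
  𝔼-frakp-< : ∀ i j → sum μ ℕ.< sum ρ → (j ℕ.+ suc i) ℕ.+ sum μ ≡ j ℕ.+ sum ρ → 𝔼 μ (j ℕ.+ suc i) φ ≡ φ μ
  𝔼-frakp-< i j m<k size = trans (*-cancelˡ (g≢0 strict) (*-cancelˡ (!≢0 j) (begin
    ℕ→ℚ (j !) * (gμ * 𝔼 μ (j ℕ.+ suc i) φ)   ≡⟨ 𝔼-frakp-dn^ (j ℕ.+ suc i) j size ⟩
    m! * up^ 2ℚ (j ℕ.+ suc i) (dn^ j χ) μ     ≡⟨ cong (m! *_) (up^-dn^-vanish (character-Harmonic X table odd no-1) j i strict) ⟩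
    m! * 0ℚ                                    ≡⟨ zeros m! (ℕ→ℚ (j !)) gμ ⟩
    ℕ→ℚ (j !) * (gμ * 0ℚ)                     ∎)))
    (sym (frakp-vanish X table ρ strict m<k))
    where
    zeros : ∀ a b c → a * 0ℚ ≡ b * (c * 0ℚ)
    zeros = solve-∀ ℚ-ring

  -- Every λ in the sum is smaller than ρ, as is μ, so all values of 𝔭_ρ vanish.
  𝔼-frakp-≪ : ∀ n → n ℕ.+ sum μ ℕ.< sum ρ → 𝔼 μ n φ ≡ φ μ
  𝔼-frakp-≪ n N<k = trans
    (Σ-zero-All (All.map (λ {x} (strict′ , e) → trans
      (cong (weight μ n x *_) (frakp-vanish X table ρ strict′ (subst (ℕ._< sum ρ) (sym e) N<k)))
      (ℚₚ.*-zeroʳ (weight μ n x))) (SP-All (n ℕ.+ sum μ))))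
    (sym (frakp-vanish X table ρ strict (ℕₚ.≤-<-trans (ℕₚ.m≤n+m (sum μ) n) N<k)))

  𝔼-frakp : ∀ n → 𝔼 μ n φ ≡ φ μ
  𝔼-frakp n = [ (λ k≤m → 𝔼-frakp-≥ n (sum μ ∸ sum ρ) (sym (ℕₚ.m∸n+n≡m k≤m)))
              , (λ m<k → [ below m<k , 𝔼-frakp-≪ n ]′ (ℕₚ.≤-<-connex (sum ρ) (n ℕ.+ sum μ)))
              ]′ (ℕₚ.≤-<-connex (sum ρ) (sum μ))
    where
    below : sum μ ℕ.< sum ρ → sum ρ ℕ.≤ n ℕ.+ sum μ → 𝔼 μ n φ ≡ φ μ
    below m<k k≤N = subst (λ k → 𝔼 μ k φ ≡ φ μ) (sym n≡)
      (𝔼-frakp-< i j m<k (trans (cong (ℕ._+ sum μ) (sym n≡)) size))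
      where
      -- The additions first make up the deficit i + 1 = |ρ| - |μ|; j is the surplus of |λ| over
      -- |ρ|.
      i = sum ρ ∸ suc (sum μ)
      j = n ℕ.+ sum μ ∸ sum ρ
      size : n ℕ.+ sum μ ≡ j ℕ.+ sum ρ
      size = sym (ℕₚ.m∸n+n≡m k≤N)
      n≡ : n ≡ j ℕ.+ suc i
      n≡ = ℕₚ.+-cancelʳ-≡ (sum μ) n (j ℕ.+ suc i) (trans size (trans
        (cong (j ℕ.+_) (trans (sym (ℕₚ.m∸n+n≡m m<k)) (ℕₚ.+-suc i (sum μ)))) (sym (ℕₚ.+-assoc j (suc i) (sum μ)))))

-- The value X^∅_∅ = 1 comes from the table, by evaluating Q_∅ in zero variables.
frakp-[] : ∀ X → IsSpinCharacterTable X → ∀ x → frakp X [] x ≡ 1ℚ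
frakp-[] X table x = begin
  X [] [] * Pstar [] (map ℕ→ℚ x) + 0ℚ   ≡⟨ cong₂ (λ p q → p * q + 0ℚ) (sym X-[]) (Pstar-S [] x) ⟩
  1ℚ * 1ℚ + 0ℚ                          ≡⟨⟩
  1ℚ                                    ∎
  where
  open ≡-Reasoning
  lemma : ∀ q → 1ℚ * q * 1ℚ * 1ℚ + 0ℚ ≡ q
  lemma = solve-∀ ℚ-ring
  X-[] : 1ℚ ≡ X [] []
  X-[] = trans (table [] tt [] []) (trans (cong (λ q → q * 1ℚ + 0ℚ) (÷′-inv (1ℚ * X [] []) 1ℚ)) (lemma (X [] [])))

theorem4p2 : (X : List ℕ → List ℕ → ℚ) → IsSpinCharacterTable X →
    ((μ ρ : List ℕ) → IsStrict μ → IsOddPartition ρ → All (λ r → r ≢ 1) ρ →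
    (n : ℕ) → 𝔼 μ n (frakp X ρ) ≡ frakp X ρ μ)
    × ((μ : List ℕ) → IsStrict μ → (n : ℕ) → 𝔼 μ n (λ _ → 1ℚ) ≡ 1ℚ)
theorem4p2 X table = expectation , λ μ strict n → begin
  𝔼 μ n (λ _ → 1ℚ)      ≡⟨ Σ-cong (λ x → cong (weight μ n x *_) (sym (frakp-[] X table x))) (SP (n ℕ.+ sum μ)) ⟩
  𝔼 μ n (frakp X [])    ≡⟨ expectation μ [] strict tt [] n ⟩
  frakp X [] μ          ≡⟨ frakp-[] X table μ ⟩
  1ℚ                    ∎
  where
  open ≡-Reasoning
  expectation : (μ ρ : List ℕ) → IsStrict μ → IsOddPartition ρ → All (λ r → r ≢ 1) ρ → (n : ℕ) → 𝔼 μ n (frakp X ρ) ≡ frakp X ρ μ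
  expectation μ ρ strict odd no-1 = 𝔼-frakp X table (IsStrict⇒Strict μ strict) odd no-1
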